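{- Let $G$ be a simple $k$-regular one-factorable graph on an ordered vertex set, and let $\mathcal M(G)$ be its set of perfect matchings. Then $$\sum_{M\in\mathcal M(G)}\varepsilon(M)\,S(G-M)=k\,S(G).$$ In particular, if $n\ge4$ is even and $I$ is any perfect matching of $K_n$, then $$S(K_n-I)=\varepsilon(I)\frac{(n-1)S_n}{(n-1)!!}=\varepsilon(I)\frac{S_n}{(n-3)!!}.$$ Consequently, $(n-3)!!$ divides $S_n$, and $$S_n\ne0\quad\Longrightarrow\quad\chi'_{\mathrm P}(K_n-I)=\chi'_{\ell}(K_n-I)=n-2.$$ The quantities $\varepsilon$, $S(\cdot)$, $S_n$, $\chi'_\ell$, $\chi'_{\mathrm P}$ are as defined in the context.
   Context: Signs. For a perfect matching $M$ of a graph on a finite linearly ordered vertex set, let $\operatorname{cr}(M)$ be the number of unordered pairs of edges $\{a,c\},\{b,d\}\in M$ with $a<b<c<d$, and put $\varepsilon(M)=(-1)^{\operatorname{cr}(M)}$. A one-factorization of a graph is a partition of its edge set into perfect matchings (an unordered collection); a graph is one-factorable if it has one. For a one-factorization $\mathcal F$ put $\varepsilon(\mathcal F)=\prod_{M\in\mathcal F}\varepsilon(M)$. For a regular graph $G$ on an ordered vertex set, $S(G)=\sum_{\mathcal F}\varepsilon(\mathcal F)$, the sum over all one-factorizations of $G$ (with $S(G)=0$ if none exist; an edgeless graph has exactly the empty one-factorization, of sign $1$). For $n$ even, $K_n$ has ordered vertex set $0<1<\dots<n-1$ and $S_n=S(K_n)$. $G-M$ denotes $G$ with the edges of $M$ removed,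 on the same ordered vertex set. For odd $j$, $j!!=1\cdot3\cdots j$. Coloring indices of a graph $G$. $\chi'_\ell(G)$ is the least integer $k$ such that whenever each edge is assigned a list of $k$ colors, the edges can be properly colored from their lists. The edge-paintability index $\chi'_{\mathrm P}(G)$ is the least $k$ for which Painter has a winning strategy in the following game: each edge starts with $k$ tokens; in each round Lister marks a nonempty set of uncolored edges and removes one token from each of them; Painter then colors a matching consisting of marked edges (these edges are then colored permanently). After Painter's move, Lister wins if some uncolored edge has no token left. Painter wins if every edge is eventually colored. -}

module Defs where

open import Data.Fin.Base using (Fin)
import Data.Fin.Base as Fin
import Data.Fin.Properties as Fin
open import Data.Integer.Base using (ℤ; 0ℤ; 1ℤ; -1ℤ)
import Data.Integer.Base as ℤ
open import Data.List.Base using (List; []; _∷_; _++_; map; filter; foldr; length; allFin; cartesianProduct)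
import Data.List.Membership.DecPropositional as DecMembership
open import Data.List.Membership.Propositional using (_∈_)
open import Data.List.Relation.Binary.Sublist.Propositional using (_⊆_)
open import Data.List.Relation.Unary.All using (All; all?)
open import Data.List.Relation.Unary.Unique.Propositional using (Unique)
open import Data.Nat.Base using (ℕ; zero; suc; _∸_; _*_; _≤_; _<_; NonZero)
import Data.Nat.Properties as ℕ
open import Data.Product.Base using (_×_; _,_; ∃)
import Data.Product.Properties as Product
open import Data.Sum.Base using (_⊎_)
open import Level using (0ℓ)
open import Relation.Binary.Core using (Rel)
open import Relation.Binary.Definitions using (Decidable; DecidableEquality; Symmetric)
open import Relation.Binary.PropositionalEquality using (_≡_; _≢_; refl; ≢-sym)
open import Relation.Nullary.Decidable using (Dec; yes; no; _×-dec_; _⊎-dec_; ¬?)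
open import Relation.Nullary.Negation using (¬_)
open import Relation.Unary using (Pred)

------------------------------------------------------------------------
-- Arithmetic and lists

infix 8 _‼

_‼ : ℕ → ℕ
0             ‼ = 1
1             ‼ = 1
suc (suc n)   ‼ = suc (suc n) * n ‼

_‼≢0 : ∀ n → NonZero (n ‼)
0           ‼≢0 = _
1           ‼≢0 = _
suc (suc n) ‼≢0 = ℕ.m*n≢0 (suc (suc n)) (n ‼) {{_}} {{n ‼≢0}}

sumℤ productℤ : List ℤ → ℤ
sumℤ     = foldr ℤ._+_ 0ℤ
productℤ = foldr ℤ._*_ 1ℤ

-- When xs has no repetitions, sublists xs lists every subset of xs exactly
-- once.
sublists : {A : Set} → List A → List (List A)
sublists []       = [] ∷ []
sublists (x ∷ xs) = map (x ∷_) (sublists xs) ++ sublists xs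

Least : Pred ℕ 0ℓ → Pred ℕ 0ℓ
Least P k = P k × (∀ j → P j → k ≤ j)

------------------------------------------------------------------------
-- Graphs on the ordered vertex set 0 < 1 < … < n - 1

record Graph (n : ℕ) : Set₁ where
  field
    Adj    : Rel (Fin n) 0ℓ
    adj?   : Decidable Adj
    adjSym : Symmetric Adj
    irrefl : ∀ {v} → ¬ Adj v v

-- The edge {a , b} with a < b is represented by the pair (a , b); the edge
-- lists below only ever contain pairs of this form.
Edge : ℕ → Set
Edge n = Fin n × Fin n

-- Finite sets of edges, as repetition-free lists: every edge set below is a
-- sublist of the list `edges G`, so distinct lists are distinct sets.
EdgeSet : ℕ → Set
EdgeSet n = List (Edge n)

module _ {n : ℕ} where

  infix 4 _≟ₑ_ _incident_ _incident?_
  infixl 6 _∖_ _─_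

  _≟ₑ_ : DecidableEquality (Edge n)
  _≟ₑ_ = Product.≡-dec Fin._≟_ Fin._≟_

  open DecMembership _≟ₑ_ public using (_∈?_)

  edges : Graph n → EdgeSet n
  edges G = filter (λ { (a , b) → (a Fin.<? b) ×-dec Graph.adj? G a b })
                   (cartesianProduct (allFin n) (allFin n))

  _incident_ : Fin n → Edge n → Set
  v incident (a , b) = v ≡ a ⊎ v ≡ b

  _incident?_ : Decidable _incident_
  v incident? (a , b) = (v Fin.≟ a) ⊎-dec (v Fin.≟ b)

  degree : EdgeSet n → Fin n → ℕ
  degree E v = length (filter (v incident?_) E)

  Regular : ℕ → Graph n → Set
  Regular k G = ∀ v → degree (edges G) v ≡ k

  _∖_ : EdgeSet n → EdgeSet n → EdgeSet n
  E ∖ F = filter (λ e → ¬? (e ∈? F)) E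

  _─_ : Graph n → EdgeSet n → Graph n
  G ─ M = record
    { Adj    = λ a b → Adj a b × ¬ (a , b) ∈ M × ¬ (b , a) ∈ M
    ; adj?   = λ a b → adj? a b ×-dec ¬? ((a , b) ∈? M) ×-dec ¬? ((b , a) ∈? M)
    ; adjSym = λ (ab , p , q) → adjSym ab , q , p
    ; irrefl = λ (vv , _) → irrefl vv
    } where open Graph G

  ----------------------------------------------------------------------
  -- Perfect matchings and one-factorizations

  Matching : EdgeSet n → Set
  Matching M = ∀ v → degree M v ≤ 1

  Perfect : EdgeSet n → Set
  Perfect M = ∀ v → degree M v ≡ 1

  perfect? : ∀ M → Dec (Perfect M)
  perfect? M = Fin.all? (λ v → degree M v ℕ.≟ 1)

  perfectMatchings : Graph n → List (EdgeSet n)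
  perfectMatchings G = filter perfect? (sublists (edges G))

  -- For a collection 𝓕 of subsets of E: its blocks are nonempty, and every
  -- element of E lies in exactly one block.  Nonemptiness matters only for
  -- n = 0, where the empty matching is perfect.
  Partition : EdgeSet n → List (EdgeSet n) → Set
  Partition E 𝓕 = All (λ M → 0 < length M) 𝓕
                × All (λ e → length (filter (e ∈?_) 𝓕) ≡ 1) E

  partition? : ∀ E 𝓕 → Dec (Partition E 𝓕)
  partition? E 𝓕 = all? (λ M → 0 ℕ.<? length M) 𝓕
             ×-dec all? (λ e → length (filter (e ∈?_) 𝓕) ℕ.≟ 1) E

  oneFactorizations : Graph n → List (List (EdgeSet n))
  oneFactorizations G = filter (partition? (edges G)) (sublists (perfectMatchings G))

  OneFactorable : Graph n → Set
  OneFactorable G = ∃ λ 𝓕 → 𝓕 ∈ oneFactorizations G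

  ----------------------------------------------------------------------
  -- Signs

  Crossing : Rel (Edge n) 0ℓ
  Crossing (a , c) (b , d) = a Fin.< b × b Fin.< c × c Fin.< d

  crossing? : Decidable Crossing
  crossing? (a , c) (b , d) = (a Fin.<? b) ×-dec (b Fin.<? c) ×-dec (c Fin.<? d)

  -- Crossing is asymmetric, so each unordered pair is counted once.
  cr : EdgeSet n → ℕ
  cr M = length (filter (λ { (e , f) → crossing? e f }) (cartesianProduct M M))

  ε : EdgeSet n → ℤ
  ε M = -1ℤ ℤ.^ cr M

  εF : List (EdgeSet n) → ℤ
  εF 𝓕 = productℤ (map ε 𝓕)

  S : Graph n → ℤ
  S G = sumℤ (map εF (oneFactorizations G))

  ----------------------------------------------------------------------
  -- List edge coloring (colors are natural numbers)

  Adjacent : Rel (Edge n) 0ℓ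
  Adjacent e f = e ≢ f × ∃ λ v → v incident e × v incident f

  EdgeChoosable : Graph n → ℕ → Set
  EdgeChoosable G k =
    (L : Edge n → List ℕ) →
    (∀ {e} → e ∈ edges G → Unique (L e) × length (L e) ≡ k) →
    ∃ λ (c : Edge n → ℕ) →
      (∀ {e} → e ∈ edges G → c e ∈ L e) ×
      (∀ {e f} → e ∈ edges G → f ∈ edges G → Adjacent e f → c e ≢ c f)

  ----------------------------------------------------------------------
  -- The edge painting game

  spend : EdgeSet n → (Edge n → ℕ) → (Edge n → ℕ)
  spend X t e with e ∈? X
  ... | yes _ = t e ∸ 1
  ... | no  _ = t e

  -- Painter has a winning strategy from the position with set U of uncolored
  -- edges and token counts t: no uncolored edge has run out of tokens, and
  -- every move X of Lister has a reply P leading to a winning position.  The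
  -- definition is inductive, so play ends, which happens only when U is
  -- empty.  Checking tokens also before the first round makes Lister win at
  -- once if k = 0 and there is an edge.
  data PainterWins (U : EdgeSet n) (t : Edge n → ℕ) : Set where
    wins : All (λ e → 0 < t e) U →
           (∀ X → X ⊆ U → 0 < length X →
            ∃ λ P → P ⊆ X × Matching P × PainterWins (U ∖ P) (spend X t)) →
           PainterWins U t

  EdgePaintable : Graph n → ℕ → Set
  EdgePaintable G k = PainterWins (edges G) (λ _ → k)

  -- "χ′ℓ(G) = k" and "χ′P(G) = k".
  χ′ℓ[_]≡_ χ′P[_]≡_ : Graph n → ℕ → Set
  χ′ℓ[ G ]≡ k = Least (EdgeChoosable G) k
  χ′P[ G ]≡ k = Least (EdgePaintable G) k

K : ∀ n → Graph n
K n = record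
  { Adj    = _≢_
  ; adj?   = λ a b → ¬? (a Fin.≟ b)
  ; adjSym = ≢-sym
  ; irrefl = λ v≢v → v≢v refl
  }

-- One-factorizations of G with a distinguished block M are pairs of a perfect
-- matching M and a one-factorization of G ─ M; counting them with signs in
-- both ways gives the first identity.
--
-- Relabelling the vertices by a permutation π changes ε M by the product of
-- g x y = ± 1 over all pairs of vertices x, y that are not edges of M, where
-- g x y tells whether π reverses the order of x and y.  Over the n - 1 blocks
-- of a one-factorization of K n these signs multiply to the (n - 2)-nd power
-- of the product of all g x y, which is 1 as n is even.  Hence
-- ε I * S (K n ─ I) does not depend on I, and as there are (n - 1)!! perfect
-- matchings, the first identity for K n determines it.
--
-- Paintability is the online form of the theorem of Alon and Tarsi: Painter
-- can keep alive a nonzero coefficient, with exponents below the numbers of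
-- tokens, of ∏ (x_e - x_f), taken over the adjacent pairs of uncolored edges.
-- For a k-regular G, finite differences turn the coefficient of ∏ x_e^(k-1)
-- into a weighted sum of the values of the polynomial at all colourings with
-- k colours.  Multiply it by the signs of x - y over all pairs of distinct
-- endpoints x, y of two edges.  If a colour class M is a perfect matching,
-- then each vertex is an endpoint of exactly one edge of M, so the factors
-- between M and the remaining edges multiply to a constant, whereas the
-- factors within M multiply to ε M.  Hence the coefficient is a nonzero
-- multiple of S G.

module Submission where

open import Defs
open import Algebra.Bundles using (CommutativeSemigroup)
open import Algebra.Structures using (IsCommutativeMonoid)
import Algebra.Properties.CommutativeSemigroup as CommutativeSemigroupProperties
open import Data.Bool.Base using (if_then_else_; true; false)
open import Data.Fin.Base as Fin using (Fin)
import Data.Fin.Properties as Fin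
open import Data.Integer.Base using (+_; 0ℤ; _*_)
open import Data.Integer.Base as ℤ using (ℤ; 1ℤ; -1ℤ)
open import Data.Integer.Divisibility using (_∣_)
import Data.Integer.Properties as ℤ
import Data.Integer.Tactic.RingSolver as ℤ-Solver
open import Data.List.Base
  using (List; []; _∷_; _++_; map; filter; foldr; length; concatMap; allFin; cartesianProduct; downFrom; upTo)
import Data.List.Membership.DecPropositional as DecMembership
open import Data.List.Membership.Propositional using (_∈_; _∉_; find; lose)
open import Data.List.Membership.Propositional.Properties
  using ( ∈-map⁻; ∈-map⁺; ∈-++⁻; ∈-++⁺ˡ; ∈-++⁺ʳ; ∈-filter⁻; ∈-filter⁺; ∈-length; ∈-allFin; ∈-∃++; ∈-downFrom⁻; ∈-upTo⁺
        ; ∈-concatMap⁺; ∈-concatMap⁻; ∈-cartesianProduct⁺)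
open import Data.List.Properties
  using ( map-∘; map-++; map-id-local; map-cong-local; ∷-injectiveˡ; ∷-injectiveʳ; length-++; length-map; length-tabulate
        ; length-upTo; filter-all; filter-none; filter-accept; filter-reject; filter-≐; filter-++)
open import Data.List.Relation.Binary.Permutation.Propositional as Perm using (_↭_; ↭-sym; ↭-trans; ↭⇒↭ₛ; prep; swap)
open import Data.List.Relation.Binary.Permutation.Propositional.Properties
  using (shift; ↭-length; filter-↭; All-resp-↭; ∈-resp-↭; ++-comm; ++⁺; map⁺; drop-∷)
import Data.List.Relation.Binary.Permutation.Setoid.Properties as Permutationₛ
open import Data.List.Relation.Binary.Sublist.Propositional using (_⊆_; []; _∷_; _∷ʳ_; ⊆-refl; ⊆-trans)
import Data.List.Relation.Binary.Sublist.Propositional.Properties as Sublist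
open import Data.List.Relation.Ternary.Interleaving.Propositional as Interleaving
  using (Interleaving; []; consˡ; consʳ; toPermutation)
open import Data.List.Relation.Unary.All as All using (All; []; _∷_; all?)
import Data.List.Relation.Unary.All.Properties as All
open import Data.List.Relation.Unary.AllPairs using (AllPairs; []; _∷_)
open import Data.List.Relation.Unary.AllPairs.Properties using (tabulate⁺-<)
open import Data.List.Relation.Unary.Any using (here; there)
open import Data.List.Relation.Unary.Unique.Propositional using (Unique)
import Data.List.Relation.Unary.Unique.Propositional.Properties as Unique
open import Data.Nat.Base as ℕ using (ℕ; zero; suc; NonZero; _≤_; _<_; _∸_)
open import Data.Nat.Divisibility as ℕ using ()
import Data.Nat.Properties as ℕ
import Data.Nat.Tactic.RingSolver as ℕ-Solver
open import Data.Product.Base using (_×_; _,_; ∃; ∃₂; proj₁; proj₂; uncurry)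
open import Data.Rational.Base using (_/_)
import Data.Rational.Properties as ℚ
import Data.Rational.Unnormalised.Base as ℚᵘ
open import Data.Sum.Base using (_⊎_; inj₁; inj₂)
open import Function.Base using (_∘_; id)
open import Level using (0ℓ)
open import Relation.Binary.Definitions using (DecidableEquality; Tri; tri<; tri≈; tri>)
open import Relation.Binary.PropositionalEquality hiding (J)
open import Relation.Nullary.Decidable using (Dec; yes; no; does; ¬?; _×-dec_; decidable-stable; dec-true; dec-false)
open import Relation.Nullary.Negation using (¬_; contradiction)
open import Relation.Unary using (Pred; Decidable)
open ≡-Reasoning
open DecMembership ℕ._≟_ using () renaming (_∈?_ to _∈ℕ?_)

-- No polynomial appears as an object. A product of linear forms is known only through linear
-- functionals (`apply`), given by arbitrary weights on exponent vectors. This one format covers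
-- coefficients, evaluation at a colouring, differences in every variable, and the mixed functionals
-- behind Painter's reply, which put 1 for the variables of the edges to be colored and bound the
-- exponents of the other marked ones. In the relevant total degree the mixed functionals sum to the
-- coefficient functional, so one of them is nonzero; its edges form a matching, because a
-- functional blind to both x_a and x_b kills every multiple of x_a - x_b.
--
-- Differences alone only bound each exponent from below by k - 1. Equality comes from the degree: a
-- k-regular graph with edge set E has exactly (k - 1)|E| adjacent pairs.
--
-- Sums over one-factorizations are handled through ordered partitions of the edge list (`ordered`):
-- colourings produce them and relabellings respect them. The price is a factor k!, harmless over
-- the integers.

-- Folds over lists and over pairs of entries in a commutative monoid

pairs : {A : Set} → List A → List (A × A)
pairs []       = []
pairs (x ∷ xs) = map (x ,_) xs ++ pairs xs

module Fold {C : Set} (_∙_ : C → C → C) (e : C) (isCM : IsCommutativeMonoid _≡_ _∙_ e) where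
  open IsCommutativeMonoid isCM using (assoc; comm; identityˡ; identityʳ; isCommutativeSemigroup)

  commutativeSemigroup : CommutativeSemigroup 0ℓ 0ℓ
  commutativeSemigroup = record { isCommutativeSemigroup = isCommutativeSemigroup }

  open CommutativeSemigroupProperties commutativeSemigroup using (interchange; x∙yz≈y∙xz)

  fold : {A : Set} → (A → C) → List A → C
  fold f xs = foldr _∙_ e (map f xs)

  fold-cong∈ : {A : Set} {f g : A → C} (xs : List A) → (∀ {x} → x ∈ xs → f x ≡ g x) → fold f xs ≡ fold g xs
  fold-cong∈ []       eq = refl
  fold-cong∈ (x ∷ xs) eq = cong₂ _∙_ (eq (here refl)) (fold-cong∈ xs (eq ∘ there))

  fold-cong : {A : Set} {f g : A → C} (xs : List A) → (∀ x → f x ≡ g x) → fold f xs ≡ fold g xs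
  fold-cong xs eq = fold-cong∈ xs (λ {x} _ → eq x)

  fold-++ : {A : Set} (f : A → C) (xs ys : List A) → fold f (xs ++ ys) ≡ fold f xs ∙ fold f ys
  fold-++ f []       ys = sym (identityˡ _)
  fold-++ f (x ∷ xs) ys = trans (cong (f x ∙_) (fold-++ f xs ys)) (sym (assoc _ _ _))

  fold-map : {A B : Set} (f : B → C) (g : A → B) (xs : List A) → fold f (map g xs) ≡ fold (f ∘ g) xs
  fold-map f g xs = cong (foldr _∙_ e) (sym (map-∘ xs))

  fold-ε : {A : Set} (xs : List A) → fold (λ _ → e) xs ≡ e
  fold-ε []       = refl
  fold-ε (x ∷ xs) = trans (identityˡ _) (fold-ε xs)

  fold-∙ : {A : Set} (f g : A → C) (xs : List A) → fold (λ x → f x ∙ g x) xs ≡ fold f xs ∙ fold g xs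
  fold-∙ f g []       = sym (identityˡ _)
  fold-∙ f g (x ∷ xs) = trans (cong ((f x ∙ g x) ∙_) (fold-∙ f g xs)) (interchange (f x) (g x) _ _)

  fold-swap : {A B : Set} (f : A → B → C) (xs : List A) (ys : List B) →
              fold (λ x → fold (f x) ys) xs ≡ fold (λ y → fold (λ x → f x y) xs) ys
  fold-swap f []       ys = sym (fold-ε ys)
  fold-swap f (x ∷ xs) ys = trans (cong (fold (f x) ys ∙_) (fold-swap f xs ys)) (sym (fold-∙ _ _ ys))

  fold-concatMap : {A B : Set} (f : B → C) (g : A → List B) (xs : List A) →
                   fold f (concatMap g xs) ≡ fold (λ x → fold f (g x)) xs
  fold-concatMap f g []       = refl
  fold-concatMap f g (x ∷ xs) =
    trans (fold-++ f (g x) (concatMap g xs)) (cong (fold f (g x) ∙_) (fold-concatMap f g xs))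

  fold-filter : {A : Set} {P : Pred A 0ℓ} (P? : Decidable P) (f : A → C) (xs : List A) →
                fold f (filter P? xs) ≡ fold (λ x → if does (P? x) then f x else e) xs
  fold-filter P? f []       = refl
  fold-filter P? f (x ∷ xs) with does (P? x)
  ... | true  = cong (f x ∙_) (fold-filter P? f xs)
  ... | false = trans (fold-filter P? f xs) (sym (identityˡ _))

  fold-↭ : {A : Set} (f : A → C) {xs ys : List A} → xs ↭ ys → fold f xs ≡ fold f ys
  fold-↭ f Perm.refl        = refl
  fold-↭ f (prep x p)       = cong (f x ∙_) (fold-↭ f p)
  fold-↭ f (swap x y p)     = trans (x∙yz≈y∙xz (f x) (f y) _) (cong (λ z → f y ∙ (f x ∙ z)) (fold-↭ f p))
  fold-↭ f (Perm.trans p q) = trans (fold-↭ f p) (fold-↭ f q)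

  foldPairs : {A : Set} → (A → A → C) → List A → C
  foldPairs f xs = fold (uncurry f) (pairs xs)

  foldPairs-∷ : {A : Set} (f : A → A → C) (x : A) (xs : List A) →
                foldPairs f (x ∷ xs) ≡ fold (f x) xs ∙ foldPairs f xs
  foldPairs-∷ f x xs = trans (fold-++ (uncurry f) (map (x ,_) xs) (pairs xs))
                             (cong (_∙ foldPairs f xs) (fold-map (uncurry f) (x ,_) xs))

  foldPairs-++ : {A : Set} (f : A → A → C) (xs ys : List A) →
    foldPairs f (xs ++ ys) ≡ (foldPairs f xs ∙ foldPairs f ys) ∙ fold (λ x → fold (f x) ys) xs
  foldPairs-++ f []       ys = sym (trans (identityʳ _) (identityˡ _))
  foldPairs-++ f (x ∷ xs) ys = begin
    foldPairs f (x ∷ xs ++ ys)  ≡⟨ foldPairs-∷ f x (xs ++ ys) ⟩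
    fold (f x) (xs ++ ys) ∙ foldPairs f (xs ++ ys)  ≡⟨ cong₂ _∙_ (fold-++ (f x) xs ys) (foldPairs-++ f xs ys) ⟩
    (a ∙ b) ∙ ((c ∙ d) ∙ g)  ≡⟨ interchange a b (c ∙ d) g ⟩
    (a ∙ (c ∙ d)) ∙ (b ∙ g)  ≡⟨ cong (_∙ (b ∙ g)) (sym (assoc a c d)) ⟩
    ((a ∙ c) ∙ d) ∙ (b ∙ g)  ≡⟨ cong (λ z → (z ∙ d) ∙ (b ∙ g)) (sym (foldPairs-∷ f x xs)) ⟩
    (foldPairs f (x ∷ xs) ∙ d) ∙ (b ∙ g)  ∎
    where
    a = fold (f x) xs ; b = fold (f x) ys ; c = foldPairs f xs ; d = foldPairs f ys
    g = fold (λ x → fold (f x) ys) xs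

  foldPairs-↭ : {A : Set} (f : A → A → C) → (∀ x y → f x y ≡ f y x) →
                {xs ys : List A} → xs ↭ ys → foldPairs f xs ≡ foldPairs f ys
  foldPairs-↭ f f-sym Perm.refl = refl
  foldPairs-↭ f f-sym {x ∷ xs} {_ ∷ ys} (prep x p) =
    trans (foldPairs-∷ f x xs) (trans (cong₂ _∙_ (fold-↭ (f x) p) (foldPairs-↭ f f-sym p)) (sym (foldPairs-∷ f x ys)))
  foldPairs-↭ f f-sym {x ∷ y ∷ xs} {_ ∷ _ ∷ ys} (swap x y p) = begin
    foldPairs f (x ∷ y ∷ xs)  ≡⟨ unfold x y xs ⟩
    (f x y ∙ fold (f x) xs) ∙ (fold (f y) xs ∙ foldPairs f xs)
      ≡⟨ cong₂ _∙_ (cong₂ _∙_ (f-sym x y) (fold-↭ (f x) p)) (cong₂ _∙_ (fold-↭ (f y) p) (foldPairs-↭ f f-sym p)) ⟩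
    (f y x ∙ fold (f x) ys) ∙ (fold (f y) ys ∙ foldPairs f ys)  ≡⟨ interchange _ _ _ _ ⟩
    (f y x ∙ fold (f y) ys) ∙ (fold (f x) ys ∙ foldPairs f ys)  ≡⟨ unfold y x ys ⟨
    foldPairs f (y ∷ x ∷ ys)  ∎
    where
    unfold : ∀ x y xs → foldPairs f (x ∷ y ∷ xs) ≡ (f x y ∙ fold (f x) xs) ∙ (fold (f y) xs ∙ foldPairs f xs)
    unfold x y xs = trans (foldPairs-∷ f x (y ∷ xs)) (cong (fold (f x) (y ∷ xs) ∙_) (foldPairs-∷ f y xs))
  foldPairs-↭ f f-sym (Perm.trans p q) = trans (foldPairs-↭ f f-sym p) (foldPairs-↭ f f-sym q)

  foldPairs-cong∈ : {A : Set} {f g : A → A → C} (xs : List A) → (∀ {x y} → x ∈ xs → y ∈ xs → f x y ≡ g x y) →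
                    foldPairs f xs ≡ foldPairs g xs
  foldPairs-cong∈ []       eq = refl
  foldPairs-cong∈ {f = f} {g} (x ∷ xs) eq = trans (foldPairs-∷ f x xs) (trans
    (cong₂ _∙_ (fold-cong∈ xs (λ y∈ → eq (here refl) (there y∈)))
        (foldPairs-cong∈ xs (λ x∈ y∈ → eq (there x∈) (there y∈))))
    (sym (foldPairs-∷ g x xs)))

  foldPairs-∙ : {A : Set} (f g : A → A → C) (xs : List A) →
                foldPairs (λ x y → f x y ∙ g x y) xs ≡ foldPairs f xs ∙ foldPairs g xs
  foldPairs-∙ f g xs = fold-∙ (uncurry f) (uncurry g) (pairs xs)

  -- Needed twice: `cr` runs over ordered pairs of edges while the signs live on unordered ones, and
  -- the size of the line graph is found by double counting.
  fold-square : {A : Set} (f : A → A → C) (xs : List A) →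
    fold (λ x → fold (f x) xs) xs ≡ fold (λ x → f x x) xs ∙ foldPairs (λ x y → f x y ∙ f y x) xs
  fold-square f []       = sym (identityˡ _)
  fold-square f (x ∷ xs) = begin
    (f x x ∙ a) ∙ fold (λ y → f y x ∙ fold (f y) xs) xs  ≡⟨ cong ((f x x ∙ a) ∙_)
        (fold-∙ (λ y → f y x) (λ y → fold (f y) xs) xs) ⟩
    (f x x ∙ a) ∙ (b ∙ fold (λ y → fold (f y) xs) xs)  ≡⟨ cong (λ z → (f x x ∙ a) ∙ (b ∙ z)) (fold-square f xs) ⟩
    (f x x ∙ a) ∙ (b ∙ (c ∙ d))  ≡⟨ cong ((f x x ∙ a) ∙_) (x∙yz≈y∙xz b c d) ⟩
    (f x x ∙ a) ∙ (c ∙ (b ∙ d))  ≡⟨ interchange (f x x) a c (b ∙ d) ⟩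
    (f x x ∙ c) ∙ (a ∙ (b ∙ d))  ≡⟨ cong ((f x x ∙ c) ∙_) (assoc a b d) ⟨
    (f x x ∙ c) ∙ ((a ∙ b) ∙ d)  ≡⟨ cong (λ z → (f x x ∙ c) ∙ (z ∙ d)) (fold-∙ (f x) (λ y → f y x) xs) ⟨
    (f x x ∙ c) ∙ (fold (λ y → f x y ∙ f y x) xs ∙ d)  ≡⟨ cong ((f x x ∙ c) ∙_)
        (foldPairs-∷ (λ x y → f x y ∙ f y x) x xs) ⟨
    (f x x ∙ c) ∙ foldPairs (λ x y → f x y ∙ f y x) (x ∷ xs) ∎
    where
    a = fold (f x) xs ; b = fold (λ y → f y x) xs ; c = fold (λ y → f y y) xs
    d = foldPairs (λ x y → f x y ∙ f y x) xs

open Fold ℤ._+_ 0ℤ ℤ.+-0-isCommutativeMonoid public using () renaming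
  ( fold to ∑; fold-cong∈ to ∑-cong∈; fold-cong to ∑-cong; fold-++ to ∑-++; fold-map to ∑-map; fold-ε to ∑-0
  ; fold-∙ to ∑-+; fold-filter to ∑-filter)
open Fold _*_ 1ℤ ℤ.*-1-isCommutativeMonoid public using () renaming
  ( fold to ∏; fold-cong∈ to ∏-cong∈; fold-cong to ∏-cong; fold-++ to ∏-++; fold-map to ∏-map; fold-ε to ∏-1
  ; fold-∙ to ∏-*; fold-swap to ∏-swap; fold-↭ to ∏-↭; fold-concatMap to ∏-concatMap
  ; foldPairs to ∏Pairs; foldPairs-∷ to ∏Pairs-∷; foldPairs-++ to ∏Pairs-++; foldPairs-↭ to ∏Pairs-↭
  ; foldPairs-cong∈ to ∏Pairs-cong∈; foldPairs-∙ to ∏Pairs-*; fold-square to ∏-square)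
open Fold ℕ._+_ 0 ℕ.+-0-isCommutativeMonoid public using () renaming
  ( fold to sum; fold-cong∈ to sum-cong∈; fold-cong to sum-cong; fold-ε to sum-0
  ; fold-swap to sum-swap; fold-filter to sum-filter; fold-↭ to sum-↭; fold-concatMap to sum-concatMap
  ; foldPairs to sumPairs
  ; foldPairs-cong∈ to sumPairs-cong∈; foldPairs-∙ to sumPairs-+; fold-square to sum-square)

open CommutativeSemigroupProperties ℤ.+-commutativeSemigroup public using () renaming (interchange to +-interchange)
open CommutativeSemigroupProperties ℤ.*-commutativeSemigroup public using () renaming
  (interchange to *-interchange; x∙yz≈y∙xz to *-leftComm)

∑-*ˡ : {A : Set} (c : ℤ) (f : A → ℤ) (xs : List A) → ∑ (λ x → c * f x) xs ≡ c * ∑ f xs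
∑-*ˡ c f []       = sym (ℤ.*-zeroʳ c)
∑-*ˡ c f (x ∷ xs) = trans (cong (λ z → (c * f x) ℤ.+ z) (∑-*ˡ c f xs)) (sym (ℤ.*-distribˡ-+ c (f x) (∑ f xs)))

∑-nonzero : {A : Set} (f : A → ℤ) (xs : List A) → ∑ f xs ≢ 0ℤ → ∃ λ x → x ∈ xs × f x ≢ 0ℤ
∑-nonzero f []       ne = contradiction refl ne
∑-nonzero f (x ∷ xs) ne with f x ℤ.≟ 0ℤ
... | no  fx≢0 = x , here refl , fx≢0
... | yes fx≡0 with ∑-nonzero f xs (λ eq → ne (cong₂ ℤ._+_ fx≡0 eq))
...   | y , y∈xs , fy≢0 = y , there y∈xs , fy≢0

∏-zero : {A : Set} (f : A → ℤ) {x : A} (xs : List A) → x ∈ xs → f x ≡ 0ℤ → ∏ f xs ≡ 0ℤ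
∏-zero f (_ ∷ xs) (here refl) fx≡0 = trans (cong (_* ∏ f xs) fx≡0) (ℤ.*-zeroˡ (∏ f xs))
∏-zero f (y ∷ xs) (there x∈)  fx≡0 = trans (cong (f y *_) (∏-zero f xs x∈ fx≡0)) (ℤ.*-zeroʳ (f y))

*-≢0 : ∀ {i j : ℤ} → i ≢ 0ℤ → j ≢ 0ℤ → i * j ≢ 0ℤ
*-≢0 {i} i≢0 j≢0 ij≡0 with ℤ.i*j≡0⇒i≡0∨j≡0 i ij≡0
... | inj₁ i≡0 = i≢0 i≡0
... | inj₂ j≡0 = j≢0 j≡0

∏-nonzero : {A : Set} (f : A → ℤ) (xs : List A) → (∀ {x} → x ∈ xs → f x ≢ 0ℤ) → ∏ f xs ≢ 0ℤ
∏-nonzero f []       ne = λ ()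
∏-nonzero f (x ∷ xs) ne = *-≢0 (ne (here refl)) (∏-nonzero f xs (ne ∘ there))

∏-nonzero⁻ : {A : Set} (f : A → ℤ) (xs : List A) → ∏ f xs ≢ 0ℤ → ∀ {x} → x ∈ xs → f x ≢ 0ℤ
∏-nonzero⁻ f xs ne x∈ fx≡0 = ne (∏-zero f xs x∈ fx≡0)

-- Sums over splittings of a list, and indicators

-- Carrying the complement R along with M makes sums over subsets and their complements structurally
-- recursive, free of membership tests and of `Unique`.
∑Splits : {A : Set} → (List A → List A → ℤ) → List A → ℤ
∑Splits f []       = f [] []
∑Splits f (x ∷ xs) = ∑Splits (λ M R → f (x ∷ M) R) xs ℤ.+ ∑Splits (λ M R → f M (x ∷ R)) xs

∑Splits-cong : {A : Set} {f g : List A → List A → ℤ} (xs : List A) →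
         (∀ {M R} → Interleaving M R xs → f M R ≡ g M R) → ∑Splits f xs ≡ ∑Splits g xs
∑Splits-cong []       eq = eq []
∑Splits-cong (x ∷ xs) eq = cong₂ ℤ._+_ (∑Splits-cong xs (eq ∘ consˡ)) (∑Splits-cong xs (eq ∘ consʳ))

∑Splits-0 : {A : Set} (xs : List A) → ∑Splits (λ _ _ → 0ℤ) xs ≡ 0ℤ
∑Splits-0 []       = refl
∑Splits-0 (x ∷ xs) = cong₂ ℤ._+_ (∑Splits-0 xs) (∑Splits-0 xs)

∑Splits-+ : {A : Set} (f g : List A → List A → ℤ) (xs : List A) → ∑Splits (λ M R → f M R ℤ.+ g M R) xs ≡
    ∑Splits f xs ℤ.+ ∑Splits g xs
∑Splits-+ f g []       = refl
∑Splits-+ f g (x ∷ xs) = trans (cong₂ ℤ._+_ (∑Splits-+ f₁ g₁ xs) (∑Splits-+ f₂ g₂ xs))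
    (+-interchange (∑Splits f₁ xs) (∑Splits g₁ xs) (∑Splits f₂ xs) (∑Splits g₂ xs))
  where
  f₁ = λ M R → f (x ∷ M) R ; f₂ = λ M R → f M (x ∷ R)
  g₁ = λ M R → g (x ∷ M) R ; g₂ = λ M R → g M (x ∷ R)

∑Splits-*ˡ : {A : Set} (c : ℤ) (f : List A → List A → ℤ) (xs : List A) → ∑Splits (λ M R → c * f M R) xs ≡
    c * ∑Splits f xs
∑Splits-*ˡ c f []       = refl
∑Splits-*ˡ c f (x ∷ xs) = trans (cong₂ ℤ._+_ (∑Splits-*ˡ c _ xs) (∑Splits-*ˡ c _ xs)) (sym (ℤ.*-distribˡ-+ c _ _))

∑Splits-nonzero : {A : Set} (f : List A → List A → ℤ) (xs : List A) → ∑Splits f xs ≢ 0ℤ →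
            ∃₂ λ M R → Interleaving M R xs × f M R ≢ 0ℤ
∑Splits-nonzero f []       ne = [] , [] , [] , ne
∑Splits-nonzero f (x ∷ xs) ne with ∑Splits (λ M R → f (x ∷ M) R) xs ℤ.≟ 0ℤ
... | no ne₁ with ∑Splits-nonzero _ xs ne₁
...   | M , R , i , ne₂ = x ∷ M , R , consˡ i , ne₂
∑Splits-nonzero f (x ∷ xs) ne | yes eq₁ with ∑Splits-nonzero _ xs (λ eq₂ → ne (cong₂ ℤ._+_ eq₁ eq₂))
...   | M , R , i , ne₂ = M , x ∷ R , consʳ i , ne₂

∑Splits-↭ : {A : Set} (f : List A → List A → ℤ) → (∀ {M M′ R R′} → M ↭ M′ → R ↭ R′ → f M R ≡ f M′ R′) →
      {xs ys : List A} → xs ↭ ys → ∑Splits f xs ≡ ∑Splits f ys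
∑Splits-↭ f f-↭ Perm.refl        = refl
∑Splits-↭ f f-↭ (prep x p)       = cong₂ ℤ._+_ (∑Splits-↭ _ (λ q r → f-↭ (prep x q) r) p)
    (∑Splits-↭ _ (λ q r → f-↭ q (prep x r)) p)
∑Splits-↭ f f-↭ {x ∷ y ∷ xs} {_ ∷ _ ∷ ys} (swap x y p) = begin
  (∑Splits f₁ xs ℤ.+ ∑Splits f₂ xs) ℤ.+ (∑Splits f₃ xs ℤ.+ ∑Splits f₄ xs)
    ≡⟨ +-interchange (∑Splits f₁ xs) (∑Splits f₂ xs) (∑Splits f₃ xs) (∑Splits f₄ xs) ⟩
  (∑Splits f₁ xs ℤ.+ ∑Splits f₃ xs) ℤ.+ (∑Splits f₂ xs ℤ.+ ∑Splits f₄ xs)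
    ≡⟨ cong₂ ℤ._+_ (cong₂ ℤ._+_ (step (λ q r → f-↭ (swap x y q) r)) (step (λ q r → f-↭ (prep y q) (prep x r))))
                   (cong₂ ℤ._+_ (step (λ q r → f-↭ (prep x q) (prep y r))) (step (λ q r → f-↭ q (swap x y r)))) ⟩
  _ ∎
  where
  f₁ = λ M R → f (x ∷ y ∷ M) R ; f₂ = λ M R → f (x ∷ M) (y ∷ R)
  f₃ = λ M R → f (y ∷ M) (x ∷ R) ; f₄ = λ M R → f M (x ∷ y ∷ R)
  step : ∀ {g h} → (∀ {M M′ R R′} → M ↭ M′ → R ↭ R′ → g M R ≡ h M′ R′) → ∑Splits g xs ≡ ∑Splits h ys
  step {g} {h} eq = trans (∑Splits-cong xs (λ _ → eq Perm.refl Perm.refl))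
                          (∑Splits-↭ h (λ q r → trans (sym (eq Perm.refl Perm.refl)) (eq q r)) p)
∑Splits-↭ f f-↭ (Perm.trans p q) = trans (∑Splits-↭ f f-↭ p) (∑Splits-↭ f f-↭ q)

∑Splits-map : {A B : Set} (h : A → B) (f : List B → List B → ℤ) (xs : List A) →
        ∑Splits f (map h xs) ≡ ∑Splits (λ M R → f (map h M) (map h R)) xs
∑Splits-map h f []       = refl
∑Splits-map h f (x ∷ xs) = cong₂ ℤ._+_ (∑Splits-map h _ xs) (∑Splits-map h _ xs)

-- The distributive law: M collects the factors from which the first summand is taken.
∏-+ : {A : Set} (f g : A → ℤ) (xs : List A) → ∏ (λ x → f x ℤ.+ g x) xs ≡ ∑Splits (λ M R → ∏ f M * ∏ g R) xs
∏-+ f g []       = refl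
∏-+ f g (x ∷ xs) = begin
  (f x ℤ.+ g x) * ∏ (λ x → f x ℤ.+ g x) xs  ≡⟨ cong ((f x ℤ.+ g x) *_) (∏-+ f g xs) ⟩
  (f x ℤ.+ g x) * s  ≡⟨ ℤ.*-distribʳ-+ s (f x) (g x) ⟩
  f x * s ℤ.+ g x * s  ≡⟨ cong₂ ℤ._+_ (∑Splits-*ˡ (f x) _ xs) (∑Splits-*ˡ (g x) _ xs) ⟨
  ∑Splits (λ M R → f x * (∏ f M * ∏ g R)) xs ℤ.+ ∑Splits (λ M R → g x * (∏ f M * ∏ g R)) xs
    ≡⟨ cong₂ ℤ._+_ (∑Splits-cong xs (λ {M} {R} _ → sym (ℤ.*-assoc (f x) (∏ f M) (∏ g R))))
                   (∑Splits-cong xs (λ {M} {R} _ → *-leftComm (g x) (∏ f M) (∏ g R))) ⟩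
  _ ∎
  where
  s = ∑Splits (λ M R → ∏ f M * ∏ g R) xs

∑-sublists : {A : Set} (f : List A → ℤ) (xs : List A) → ∑ f (sublists xs) ≡ ∑Splits (λ M _ → f M) xs
∑-sublists f []       = ℤ.+-identityʳ (f [])
∑-sublists f (x ∷ xs) = trans (∑-++ f (map (x ∷_) (sublists xs)) (sublists xs))
  (cong₂ ℤ._+_ (trans (∑-map f (x ∷_) (sublists xs)) (∑-sublists (f ∘ (x ∷_)) xs)) (∑-sublists f xs))

infixr 8 ⟦_⟧_

⟦_⟧_ : {P : Set} → Dec P → ℤ → ℤ
⟦ d ⟧ z = if does d then z else 0ℤ

⟦⟧-yes : {P : Set} (d : Dec P) (z : ℤ) → P → ⟦ d ⟧ z ≡ z
⟦⟧-yes d z p = cong (if_then z else 0ℤ) (dec-true d p)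

⟦⟧-no : {P : Set} (d : Dec P) (z : ℤ) → ¬ P → ⟦ d ⟧ z ≡ 0ℤ
⟦⟧-no d z ¬p = cong (if_then z else 0ℤ) (dec-false d ¬p)

⟦⟧-⇔ : {P Q : Set} (d : Dec P) (d′ : Dec Q) {z z′ : ℤ} → (P → Q) → (Q → P) → (P → z ≡ z′) → ⟦ d ⟧ z ≡ ⟦ d′ ⟧ z′
⟦⟧-⇔ (yes p) d′ f g eq = trans (eq p) (sym (⟦⟧-yes d′ _ (f p)))
⟦⟧-⇔ (no ¬p) d′ f g eq = sym (⟦⟧-no d′ _ (¬p ∘ g))

⟦⟧-× : {P Q R : Set} (d : Dec P) (d′ : Dec Q) (d″ : Dec R) {z : ℤ} →
       (P → Q → R) → (R → P × Q) → ⟦ d ⟧ ⟦ d′ ⟧ z ≡ ⟦ d″ ⟧ z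
⟦⟧-× (yes p) d′ d″ f g = ⟦⟧-⇔ d′ d″ (f p) (proj₂ ∘ g) (λ _ → refl)
⟦⟧-× (no ¬p) d′ d″ f g = sym (⟦⟧-no d″ _ (¬p ∘ proj₁ ∘ g))

⟦⟧-≢0 : {P : Set} (d : Dec P) {z : ℤ} → ⟦ d ⟧ z ≢ 0ℤ → P
⟦⟧-≢0 (yes p) _  = p
⟦⟧-≢0 (no _)  ne = contradiction refl ne

⟦⟧-≡ˡ : {P : Set} (d : Dec P) {z c : ℤ} → (P → z ≡ c) → ⟦ d ⟧ z ≡ c * (⟦ d ⟧ 1ℤ)
⟦⟧-≡ˡ (yes p) {c = c} eq = trans (eq p) (sym (ℤ.*-identityʳ c))
⟦⟧-≡ˡ (no _)  {c = c} _  = sym (ℤ.*-zeroʳ c)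

⟦⟧-*ˡ : {P : Set} (d : Dec P) (c z : ℤ) → c * (⟦ d ⟧ z) ≡ ⟦ d ⟧ (c * z)
⟦⟧-*ˡ (yes _) c z = refl
⟦⟧-*ˡ (no _)  c z = ℤ.*-zeroʳ c

-- Sublists, interleavings and filters

∈-sublists⁻ : {A : Set} {M : List A} (xs : List A) → M ∈ sublists xs → M ⊆ xs
∈-sublists⁻ []       (here refl) = []
∈-sublists⁻ (x ∷ xs) M∈ with ∈-++⁻ (map (x ∷_) (sublists xs)) M∈
... | inj₂ M∈′ = x ∷ʳ ∈-sublists⁻ xs M∈′
... | inj₁ M∈′ with ∈-map⁻ (x ∷_) M∈′
...   | N , N∈ , refl = refl ∷ ∈-sublists⁻ xs N∈

⊆⇒Interleaving : {A : Set} {M xs : List A} → M ⊆ xs → ∃ λ R → Interleaving M R xs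
⊆⇒Interleaving []         = [] , []
⊆⇒Interleaving (y ∷ʳ s)   = _ , consʳ (proj₂ (⊆⇒Interleaving s))
⊆⇒Interleaving (refl ∷ s) = _ , consˡ (proj₂ (⊆⇒Interleaving s))

Interleaving⇒⊆ : {A : Set} {M R xs : List A} → Interleaving M R xs → M ⊆ xs
Interleaving⇒⊆ []        = []
Interleaving⇒⊆ (consˡ i) = refl ∷ Interleaving⇒⊆ i
Interleaving⇒⊆ (consʳ i) = _ ∷ʳ Interleaving⇒⊆ i

⊆-∈ : {A : Set} {x : A} {M xs : List A} → M ⊆ xs → x ∈ M → x ∈ xs
⊆-∈ = Sublist.Any-resp-⊆

⊆-Unique : {A : Set} {M xs : List A} → M ⊆ xs → Unique xs → Unique M
⊆-Unique []         u        = u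
⊆-Unique (y ∷ʳ s)   (_ ∷ u)  = ⊆-Unique s u
⊆-Unique (refl ∷ s) (x ∷ u)  = Sublist.All-resp-⊆ s x ∷ ⊆-Unique s u

∉-head : {A : Set} {x : A} {xs : List A} → Unique (x ∷ xs) → x ∉ xs
∉-head (x≢ ∷ _) x∈ = All.lookup x≢ x∈ refl

Interleaving-disjoint : {A : Set} {M R xs : List A} → Unique xs → Interleaving M R xs →
                        ∀ {x} → x ∈ M → x ∉ R
Interleaving-disjoint u@(_ ∷ _)  (consˡ i) (here refl) x∈R = ∉-head u (⊆-∈ (Interleaving⇒⊆ (Interleaving.swap i)) x∈R)
Interleaving-disjoint (_ ∷ u)    (consˡ i) (there x∈M) x∈R = Interleaving-disjoint u i x∈M x∈R
Interleaving-disjoint u@(_ ∷ _)  (consʳ i) x∈M (here refl) = ∉-head u (⊆-∈ (Interleaving⇒⊆ i) x∈M)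
Interleaving-disjoint (_ ∷ u)    (consʳ i) x∈M (there x∈R) = Interleaving-disjoint u i x∈M x∈R

filter-Interleaving : {A : Set} {P : Pred A 0ℓ} (P? : Decidable P) {M R xs : List A} → Interleaving M R xs →
                      (∀ {x} → x ∈ M → ¬ P x) → (∀ {x} → x ∈ R → P x) → filter P? xs ≡ R
filter-Interleaving P? []        _  _ = refl
filter-Interleaving P? (consˡ i) ¬p p =
  trans (filter-reject P? (¬p (here refl))) (filter-Interleaving P? i (¬p ∘ there) p)
filter-Interleaving P? (consʳ i) ¬p p =
  trans (filter-accept P? (p (here refl))) (cong (_ ∷_) (filter-Interleaving P? i ¬p (p ∘ there)))

filter-map : {A B : Set} {P : Pred B 0ℓ} (P? : Decidable P) (f : A → B) (xs : List A) →
             filter P? (map f xs) ≡ map f (filter (P? ∘ f) xs)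
filter-map P? f []       = refl
filter-map P? f (x ∷ xs) with does (P? (f x))
... | true  = cong (f x ∷_) (filter-map P? f xs)
... | false = filter-map P? f xs

filter-comm : {A : Set} {P Q : Pred A 0ℓ} (P? : Decidable P) (Q? : Decidable Q) (xs : List A) →
              filter P? (filter Q? xs) ≡ filter Q? (filter P? xs)
filter-comm P? Q? []       = refl
filter-comm P? Q? (x ∷ xs) with does (P? x) in p | does (Q? x) in q
... | true  | true  rewrite p | q = cong (x ∷_) (filter-comm P? Q? xs)
... | true  | false rewrite q     = filter-comm P? Q? xs
... | false | true  rewrite p     = filter-comm P? Q? xs
... | false | false               = filter-comm P? Q? xs

sublists-filter : {A : Set} {P : Pred A 0ℓ} (P? : Decidable P) (xs : List A) →
                  sublists (filter P? xs) ≡ filter (all? P?) (sublists xs)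
sublists-filter P? []       = refl
sublists-filter P? (x ∷ xs) with P? x
... | yes px = begin
  map (x ∷_) (sublists (filter P? xs)) ++ sublists (filter P? xs)
    ≡⟨ cong (λ ys → map (x ∷_) ys ++ ys) (sublists-filter P? xs) ⟩
  map (x ∷_) (filter (all? P?) (sublists xs)) ++ filter (all? P?) (sublists xs)
    ≡⟨ cong (λ ys → map (x ∷_) ys ++ filter (all? P?) (sublists xs))
            (filter-≐ (all? P?) (all? P? ∘ (x ∷_)) ((λ p → px ∷ p) , All.tail) (sublists xs)) ⟩
  map (x ∷_) (filter (all? P? ∘ (x ∷_)) (sublists xs)) ++ filter (all? P?) (sublists xs)
    ≡⟨ cong (_++ filter (all? P?) (sublists xs)) (filter-map (all? P?) (x ∷_) (sublists xs)) ⟨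
  filter (all? P?) (map (x ∷_) (sublists xs)) ++ filter (all? P?) (sublists xs)
    ≡⟨ filter-++ (all? P?) (map (x ∷_) (sublists xs)) (sublists xs) ⟨
  filter (all? P?) (map (x ∷_) (sublists xs) ++ sublists xs) ∎
... | no ¬px = begin
  sublists (filter P? xs)  ≡⟨ sublists-filter P? xs ⟩
  filter (all? P?) (sublists xs)  ≡⟨ cong (_++ filter (all? P?) (sublists xs)) nothing ⟨
  filter (all? P?) (map (x ∷_) (sublists xs)) ++ filter (all? P?) (sublists xs)
    ≡⟨ filter-++ (all? P?) (map (x ∷_) (sublists xs)) (sublists xs) ⟨
  filter (all? P?) (map (x ∷_) (sublists xs) ++ sublists xs) ∎
  where
  nothing : filter (all? P?) (map (x ∷_) (sublists xs)) ≡ []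
  nothing = filter-none (all? P?) (All.tabulate λ M∈ → λ all → ¬px (bad (∈-map⁻ (x ∷_) M∈) all))
    where
    bad : ∀ {M} → (∃ λ N → N ∈ sublists xs × M ≡ x ∷ N) → All _ M → _
    bad (_ , _ , refl) (px ∷ _) = px

∑Splits-filter : {A : Set} {P : Pred A 0ℓ} (P? : Decidable P) (f : List A → ℤ) (xs : List A) →
           (∀ M → ¬ All P M → f M ≡ 0ℤ) → ∑Splits (λ M _ → f M) xs ≡ ∑Splits (λ M _ → f M) (filter P? xs)
∑Splits-filter P? f []       f≡0 = refl
∑Splits-filter P? f (x ∷ xs) f≡0 with P? x
... | yes px = cong₂ ℤ._+_ (∑Splits-filter P? (f ∘ (x ∷_)) xs (λ M ¬all → f≡0 (x ∷ M) (¬all ∘ All.tail)))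
    (∑Splits-filter P? f xs f≡0)
... | no ¬px = begin
  ∑Splits (λ M _ → f (x ∷ M)) xs ℤ.+ ∑Splits (λ M _ → f M) xs
    ≡⟨ cong (ℤ._+ ∑Splits (λ M _ → f M) xs) (trans (∑Splits-cong xs (λ {M} _ → f≡0 (x ∷ M) (¬px ∘ All.head)))
        (∑Splits-0 xs)) ⟩
  0ℤ ℤ.+ ∑Splits (λ M _ → f M) xs  ≡⟨ ℤ.+-identityˡ _ ⟩
  ∑Splits (λ M _ → f M) xs  ≡⟨ ∑Splits-filter P? f xs f≡0 ⟩
  ∑Splits (λ M _ → f M) (filter P? xs) ∎

-- Sums over a distinguished entry

∑Picks : {A : Set} → (A → List A → ℤ) → List A → ℤ
∑Picks f []       = 0ℤ
∑Picks f (x ∷ xs) = f x xs ℤ.+ ∑Picks (λ y ys → f y (x ∷ ys)) xs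

∑Picks-cong : {A : Set} {f g : A → List A → ℤ} (xs : List A) →
         (∀ {x ys} → x ∷ ys ↭ xs → f x ys ≡ g x ys) → ∑Picks f xs ≡ ∑Picks g xs
∑Picks-cong []       eq = refl
∑Picks-cong (x ∷ xs) eq = cong₂ ℤ._+_ (eq Perm.refl)
    (∑Picks-cong xs (λ {y} p → eq (↭-trans (swap y x Perm.refl) (prep x p))))

∑Picks-+ : {A : Set} (f g : A → List A → ℤ) (xs : List A) → ∑Picks (λ x ys → f x ys ℤ.+ g x ys) xs ≡
    ∑Picks f xs ℤ.+ ∑Picks g xs
∑Picks-+ f g []       = refl
∑Picks-+ f g (x ∷ xs) = trans (cong (λ z → (f x xs ℤ.+ g x xs) ℤ.+ z) (∑Picks-+ f′ g′ xs))
    (+-interchange (f x xs) (g x xs) (∑Picks f′ xs) (∑Picks g′ xs))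
  where
  f′ = λ y ys → f y (x ∷ ys) ; g′ = λ y ys → g y (x ∷ ys)

∑Picks-∑ : {A : Set} (f : A → ℤ) (xs : List A) → ∑Picks (λ x _ → f x) xs ≡ ∑ f xs
∑Picks-∑ f []       = refl
∑Picks-∑ f (x ∷ xs) = cong (λ z → f x ℤ.+ z) (∑Picks-∑ f xs)

∑Picks-const : {A : Set} (c : ℤ) (xs : List A) → ∑Picks (λ _ _ → c) xs ≡ + length xs * c
∑Picks-const c []       = refl
∑Picks-const c (x ∷ xs) = trans (cong (λ z → c ℤ.+ z) (∑Picks-const c xs)) (sym (ℤ.suc-* (+ length xs) c))

-- A subset with a distinguished element can be chosen element first, the rest of the subset coming
-- from the other entries. This is the double count behind `signedSum-recursion`.
∑Splits-∑Picks : {A : Set} (f : A → List A → ℤ) (xs : List A) →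
      ∑Splits (λ F _ → ∑Picks f F) xs ≡ ∑Picks (λ x ys → ∑Splits (λ F _ → f x F) ys) xs
∑Splits-∑Picks f []       = refl
∑Splits-∑Picks f (x ∷ xs) = begin
  ∑Splits (λ F _ → f x F ℤ.+ ∑Picks f′ F) xs ℤ.+ ∑Splits (λ F _ → ∑Picks f F) xs
    ≡⟨ cong (λ z → z ℤ.+ ∑Splits (λ F _ → ∑Picks f F) xs) (∑Splits-+ (λ F _ → f x F) (λ F _ → ∑Picks f′ F) xs) ⟩
  (∑Splits (λ F _ → f x F) xs ℤ.+ ∑Splits (λ F _ → ∑Picks f′ F) xs) ℤ.+ ∑Splits (λ F _ → ∑Picks f F) xs
    ≡⟨ ℤ.+-assoc (∑Splits (λ F _ → f x F) xs) (∑Splits (λ F _ → ∑Picks f′ F) xs) (∑Splits (λ F _ → ∑Picks f F) xs) ⟩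
  ∑Splits (λ F _ → f x F) xs ℤ.+ (∑Splits (λ F _ → ∑Picks f′ F) xs ℤ.+ ∑Splits (λ F _ → ∑Picks f F) xs)
    ≡⟨ cong (λ z → ∑Splits (λ F _ → f x F) xs ℤ.+ z) (cong₂ ℤ._+_ (∑Splits-∑Picks f′ xs) (∑Splits-∑Picks f xs)) ⟩
  ∑Splits (λ F _ → f x F) xs ℤ.+ (∑Picks (λ y ys → ∑Splits (λ F _ → f′ y F) ys) xs ℤ.+ ∑Picks
      (λ y ys → ∑Splits (λ F _ → f y F) ys) xs)
    ≡⟨ cong (λ z → ∑Splits (λ F _ → f x F) xs ℤ.+ z) (∑Picks-+ _ _ xs) ⟨
  _ ∎
  where
  f′ = λ y ys → f y (x ∷ ys)

-- Degrees and complements of edge sets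

module _ {n : ℕ} where

  degree-++ : (M R : EdgeSet n) (v : Fin n) → degree (M ++ R) v ≡ degree M v ℕ.+ degree R v
  degree-++ M R v = trans (cong length (filter-++ (v incident?_) M R)) (length-++ (filter (v incident?_) M))

  degree-↭ : {E E′ : EdgeSet n} → E ↭ E′ → ∀ v → degree E v ≡ degree E′ v
  degree-↭ p v = ↭-length (filter-↭ (v incident?_) p)

  degree-Interleaving : {M R E : EdgeSet n} → Interleaving M R E → ∀ v → degree E v ≡ degree M v ℕ.+ degree R v
  degree-Interleaving {M} {R} i v = trans (degree-↭ (toPermutation i) v) (degree-++ M R v)

  degree≡0 : {E : EdgeSet n} → (∀ v → degree E v ≡ 0) → E ≡ []
  degree≡0 {[]}          eq = refl
  degree≡0 {(a , b) ∷ E} eq with trans (sym (cong length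
      (filter-accept (a incident?_) {x = a , b} {xs = E} (inj₁ refl)))) (eq a)
  ... | ()

  Perfect-↭ : {M M′ : EdgeSet n} → M ↭ M′ → Perfect M → Perfect M′
  Perfect-↭ p perf v = trans (sym (degree-↭ p v)) (perf v)

  ∖-Interleaving : {M R E : EdgeSet n} → Unique E → Interleaving M R E → E ∖ M ≡ R
  ∖-Interleaving {M} u i = filter-Interleaving (λ e → ¬? (e ∈? M)) i (λ e∈M e∉M → e∉M e∈M)
                             (λ e∈R e∈M → Interleaving-disjoint u i e∈M e∈R)

  Interleaving-∖ : {M E : EdgeSet n} → Unique E → M ⊆ E → Interleaving M (E ∖ M) E
  Interleaving-∖ u s with ⊆⇒Interleaving s
  ... | R , i rewrite ∖-Interleaving u i = i

  filter-∈ : {M E : EdgeSet n} → Unique E → M ⊆ E → filter (_∈? M) E ≡ M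
  filter-∈ {M} u s with ⊆⇒Interleaving s
  ... | R , i = filter-Interleaving (_∈? M) (Interleaving.swap i)
                  (λ e∈R e∈M → Interleaving-disjoint u i e∈M e∈R) id

  ∑Splits-∖ : (f : EdgeSet n → EdgeSet n → ℤ) {E : EdgeSet n} → Unique E →
        ∑Splits f E ≡ ∑ (λ M → f M (E ∖ M)) (sublists E)
  ∑Splits-∖ f {E} u = trans (∑Splits-cong E (λ {M} i → cong (f M) (sym (∖-Interleaving u i))))
                      (sym (∑-sublists (λ M → f M (E ∖ M)) E))

  -- One-factorizations of a set of edges

  matchings : EdgeSet n → List (EdgeSet n)
  matchings E = filter perfect? (sublists E)

  signedSum : EdgeSet n → ℤ
  signedSum E = ∑ εF (filter (partition? E) (sublists (matchings E)))

  weight : EdgeSet n → List (EdgeSet n) → ℤ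
  weight E F = ⟦ partition? E F ⟧ εF F

  signedSum-weight : (E : EdgeSet n) → signedSum E ≡ ∑Splits (λ F _ → weight E F) (matchings E)
  signedSum-weight E = trans (∑-filter (partition? E) εF (sublists (matchings E))) (∑-sublists (weight E) (matchings E))

  Partition-↭ : {E : EdgeSet n} {F F′ : List (EdgeSet n)} → F ↭ F′ → Partition E F → Partition E F′
  Partition-↭ p (ne , one) =
    All-resp-↭ p ne , All.map (λ {e} eq → trans (sym (↭-length (filter-↭ (e ∈?_) p))) eq) one

  weight-↭ : (E : EdgeSet n) {F F′ : List (EdgeSet n)} → F ↭ F′ → weight E F ≡ weight E F′
  weight-↭ E p = ⟦⟧-⇔ (partition? E _) (partition? E _) (Partition-↭ p) (Partition-↭ (↭-sym p)) (λ _ → ∏-↭ ε p)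

  ∈-matchings⁻ : {E M : EdgeSet n} → M ∈ matchings E → M ⊆ E × Perfect M
  ∈-matchings⁻ {E} M∈ with ∈-filter⁻ perfect? {xs = sublists E} M∈
  ... | M∈′ , perf = ∈-sublists⁻ E M∈′ , perf

  disjoint? : (M M′ : EdgeSet n) → Dec (All (_∉ M) M′)
  disjoint? M = all? (λ e → ¬? (e ∈? M))

  matchings-∖ : (E M : EdgeSet n) → matchings (E ∖ M) ≡ filter (disjoint? M) (matchings E)
  matchings-∖ E M = trans (cong (filter perfect?) (sublists-filter (λ e → ¬? (e ∈? M)) E))
                          (filter-comm perfect? (disjoint? M) (sublists E))


-- Removing a block from a one-factorization

length-sum : {A : Set} (xs : List A) → length xs ≡ sum (λ _ → 1) xs
length-sum []       = refl
length-sum (x ∷ xs) = cong suc (length-sum xs)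

length-filter-sum : {A : Set} {P : Pred A 0ℓ} (P? : Decidable P) (xs : List A) →
                    length (filter P? xs) ≡ sum (λ x → if does (P? x) then 1 else 0) xs
length-filter-sum P? xs = trans (length-sum (filter P? xs)) (sum-filter P? (λ _ → 1) xs)

module _ {n : ℕ} where

  -- Count the pairs of an edge at v and a block containing it: each edge lies in one block, and
  -- each block, being perfect, has one edge at v.
  degree-Partition : {E : EdgeSet n} {F : List (EdgeSet n)} → Unique E → (∀ {M} → M ∈ F → M ⊆ E × Perfect M) →
                     Partition E F → ∀ v → degree E v ≡ length F
  degree-Partition {E} {F} u perf (_ , one) v = begin
    length Eᵥ  ≡⟨ length-sum Eᵥ ⟩
    sum (λ _ → 1) Eᵥ  ≡⟨ sum-cong∈ Eᵥ covered ⟨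
    sum (λ e → length (filter (e ∈?_) F)) Eᵥ  ≡⟨ sum-cong Eᵥ (λ e → length-filter-sum (e ∈?_) F) ⟩
    sum (λ e → sum (λ M → if does (e ∈? M) then 1 else 0) F) Eᵥ  ≡⟨ sum-swap
        (λ e M → if does (e ∈? M) then 1 else 0) Eᵥ F ⟩
    sum (λ M → sum (λ e → if does (e ∈? M) then 1 else 0) Eᵥ) F  ≡⟨ sum-cong F (λ M → length-filter-sum (_∈? M) Eᵥ) ⟨
    sum (λ M → length (filter (_∈? M) Eᵥ)) F  ≡⟨ sum-cong∈ F perfect ⟩
    sum (λ _ → 1) F  ≡⟨ length-sum F ⟨
    length F  ∎
    where
    Eᵥ = filter (v incident?_) E
    covered : ∀ {e} → e ∈ Eᵥ → length (filter (e ∈?_) F) ≡ 1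
    covered e∈ = All.lookup one (proj₁ (∈-filter⁻ (v incident?_) {xs = E} e∈))
    perfect : ∀ {M} → M ∈ F → length (filter (_∈? M) Eᵥ) ≡ 1
    perfect {M} M∈ = begin
      length (filter (_∈? M) Eᵥ)  ≡⟨ cong length (filter-comm (_∈? M) (v incident?_) E) ⟩
      length (filter (v incident?_) (filter (_∈? M) E))  ≡⟨ cong (λ z → degree z v) (filter-∈ u (proj₁ (perf M∈))) ⟩
      degree M v  ≡⟨ proj₂ (perf M∈) v ⟩
      1  ∎

module _ {m : ℕ} where

  private n = suc m

  -- The vertex `zero` has to be covered; on an empty vertex set the empty matching would be
  -- perfect.
  Perfect-nonempty : (M : EdgeSet n) → Perfect M → 0 < length M
  Perfect-nonempty []      perf with perf Fin.zero
  ... | ()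
  Perfect-nonempty (_ ∷ _) perf = ℕ.s≤s ℕ.z≤n

  module _ {E M : EdgeSet n} {F : List (EdgeSet n)} where

    Partition-∷⁻ : Partition E (M ∷ F) → Partition (E ∖ M) F
    Partition-∷⁻ (_ ∷ ne , one) = ne , All.tabulate λ {e} e∈ →
      let e∈E , e∉M = ∈-filter⁻ (λ e → ¬? (e ∈? M)) {xs = E} e∈
      in  trans (cong length (sym (filter-reject (e ∈?_) {xs = F} e∉M))) (All.lookup one e∈E)

    Partition-∷⁺ : Perfect M → All (All (_∉ M)) F → Partition (E ∖ M) F → Partition E (M ∷ F)
    Partition-∷⁺ perf disj (ne , one) = Perfect-nonempty M perf ∷ ne , All.tabulate (λ {e} → covered (e ∈? M))
      where
      covered : ∀ {e} → Dec (e ∈ M) → e ∈ E → length (filter (e ∈?_) (M ∷ F)) ≡ 1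
      covered {e} (no e∉M)  e∈E = trans (cong length (filter-reject (e ∈?_) {xs = F} e∉M))
                                        (All.lookup one (∈-filter⁺ (λ e → ¬? (e ∈? M)) e∈E e∉M))
      covered {e} (yes e∈M) _   = trans (cong length (filter-accept (e ∈?_) {xs = F} e∈M))
                                        (cong (suc ∘ length) (filter-none (e ∈?_)
                                            (All.map (λ d e∈M′ → All.lookup d e∈M′ e∈M) disj)))

    -- An edge of M in a further block would be covered twice.
    Partition-disjoint : M ⊆ E → Partition E (M ∷ F) → All (All (_∉ M)) F
    Partition-disjoint s (_ , one) = All.tabulate λ {M′} M′∈F → All.tabulate λ {e} e∈M′ e∈M →
      case (M′ , M′∈F , e∈M′) e∈M (All.lookup one (⊆-∈ s e∈M))
      where
      case : ∀ {e} → (∃ λ M′ → M′ ∈ F × e ∈ M′) → e ∈ M → length (filter (e ∈?_) (M ∷ F)) ≢ 1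
      case {e} (M′ , M′∈F , e∈M′) e∈M eq =
        ℕ.<⇒≢ (∈-length (∈-filter⁺ (e ∈?_) M′∈F e∈M′))
              (sym (ℕ.suc-injective (trans (sym (cong length (filter-accept (e ∈?_) {xs = F} e∈M))) eq)))

  module _ {E : EdgeSet n} {k : ℕ} (u : Unique E) (reg : ∀ v → degree E v ≡ k) where

    private
      -- The matchings available after deleting M are the members of `matchings E` disjoint from M.
      -- Restricting to them loses nothing, since a family containing M and a block that meets M has
      -- weight 0.
      step : ∀ {M L} → M ∷ L ↭ matchings E → ε M * signedSum (E ∖ M) ≡ ∑Splits (λ F _ → weight E (M ∷ F)) L
      step {M} {L} p = begin
        ε M * signedSum (E ∖ M)  ≡⟨ cong (ε M *_) (signedSum-weight (E ∖ M)) ⟩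
        ε M * ∑Splits (λ F _ → weight (E ∖ M) F) (matchings (E ∖ M))  ≡⟨ ∑Splits-*ˡ (ε M) _ (matchings (E ∖ M)) ⟨
        ∑Splits (λ F _ → ε M * weight (E ∖ M) F) (matchings (E ∖ M))  ≡⟨ cong (∑Splits _) (matchings-∖ E M) ⟩
        ∑Splits (λ F _ → ε M * weight (E ∖ M) F) (filter (disjoint? M) (matchings E))
          ≡⟨ ∑Splits-cong (filter (disjoint? M) (matchings E)) weight-∷ ⟨
        ∑Splits (λ F _ → weight E (M ∷ F)) (filter (disjoint? M) (matchings E))
          ≡⟨ ∑Splits-↭ _ (λ q _ → weight-↭ E (prep M q)) (filter-↭ (disjoint? M) (↭-sym p)) ⟩
        ∑Splits (λ F _ → weight E (M ∷ F)) (filter (disjoint? M) (M ∷ L))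
          -- M itself is filtered out: being nonempty, it is not disjoint from itself.
          ≡⟨ cong (∑Splits (λ F _ → weight E (M ∷ F))) (filter-reject (disjoint? M) (self (Perfect-nonempty M perf))) ⟩
        ∑Splits (λ F _ → weight E (M ∷ F)) (filter (disjoint? M) L)
          ≡⟨ ∑Splits-filter (disjoint? M) (λ F → weight E (M ∷ F)) L
               (λ F ¬disj → ⟦⟧-no (partition? E (M ∷ F)) _ (¬disj ∘ Partition-disjoint M⊆E)) ⟨
        ∑Splits (λ F _ → weight E (M ∷ F)) L  ∎
        where
        M⊆E  = proj₁ (∈-matchings⁻ {E = E} (∈-resp-↭ p (here refl)))
        perf = proj₂ (∈-matchings⁻ {E = E} (∈-resp-↭ p (here refl)))
        self : ∀ {M : EdgeSet n} → 0 < length M → ¬ All (_∉ M) M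
        self {_ ∷ _} _ (e∉ ∷ _) = e∉ (here refl)
        weight-∷ : ∀ {F R} → Interleaving F R (filter (disjoint? M) (matchings E)) →
                   weight E (M ∷ F) ≡ ε M * weight (E ∖ M) F
        weight-∷ {F} i = trans (⟦⟧-⇔ (partition? E (M ∷ F)) (partition? (E ∖ M) F) Partition-∷⁻
            (Partition-∷⁺ perf disj) (λ _ → refl))
                               (sym (⟦⟧-*ˡ (partition? (E ∖ M) F) (ε M) (εF F)))
          where
          disj : All (All (_∉ M)) F
          disj = All.tabulate (λ M′∈F → proj₂ (∈-filter⁻ (disjoint? M) {xs = matchings E}
              (⊆-∈ (Interleaving⇒⊆ i) M′∈F)))

      -- Where the weight is not 0, F partitions E, so `degree-Partition` at the vertex `zero` gives
      -- its number of blocks.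
      size : ∀ {F R} → Interleaving F R (matchings E) → + length F * weight E F ≡ + k * weight E F
      size {F} i = go (partition? E F)
        where
        go : (d : Dec (Partition E F)) → + length F * (⟦ d ⟧ εF F) ≡ + k * (⟦ d ⟧ εF F)
        go (no _)  = trans (ℤ.*-zeroʳ (+ length F)) (sym (ℤ.*-zeroʳ (+ k)))
        go (yes p) = cong (λ z → + z * εF F)
          (trans (sym (degree-Partition u (∈-matchings⁻ {E = E} ∘ ⊆-∈ (Interleaving⇒⊆ i)) p Fin.zero)) (reg Fin.zero))

    signedSum-recursion : ∑ (λ M → ε M * signedSum (E ∖ M)) (matchings E) ≡ + k * signedSum E
    signedSum-recursion = begin
      ∑ (λ M → ε M * signedSum (E ∖ M)) (matchings E)  ≡⟨ ∑Picks-∑ _ (matchings E) ⟨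
      ∑Picks (λ M _ → ε M * signedSum (E ∖ M)) (matchings E)  ≡⟨ ∑Picks-cong (matchings E) step ⟩
      ∑Picks (λ M L → ∑Splits (λ F _ → weight E (M ∷ F)) L) (matchings E)  ≡⟨ ∑Splits-∑Picks
          (λ M F → weight E (M ∷ F)) (matchings E) ⟨
      ∑Splits (λ F _ → ∑Picks (λ M F′ → weight E (M ∷ F′)) F) (matchings E)  ≡⟨ ∑Splits-cong (matchings E) picks ⟩
      ∑Splits (λ F _ → + k * weight E F) (matchings E)  ≡⟨ ∑Splits-*ˡ (+ k) _ (matchings E) ⟩
      + k * ∑Splits (λ F _ → weight E F) (matchings E)  ≡⟨ cong (+ k *_) (signedSum-weight E) ⟨
      + k * signedSum E  ∎
      where
      picks : ∀ {F R} → Interleaving F R (matchings E) → ∑Picks (λ M F′ → weight E (M ∷ F′)) F ≡ + k * weight E F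
      picks {F} i = trans (∑Picks-cong F (weight-↭ E)) (trans (∑Picks-const (weight E F) F) (size i))

-- Ordered partitions into perfect matchings

-- The sum of products of φ over all ordered partitions of E into k classes, empty ones included.
-- With φ = `signed` only perfect classes contribute.
ordered : {A : Set} → ℕ → (List A → ℤ) → List A → ℤ
ordered zero    φ []      = 1ℤ
ordered zero    φ (_ ∷ _) = 0ℤ
ordered (suc k) φ E       = ∑Splits (λ M R → φ M * ordered k φ R) E

factorial : ℕ → ℤ
factorial zero    = 1ℤ
factorial (suc k) = + suc k * factorial k

factorial≢0 : ∀ k → factorial k ≢ 0ℤ
factorial≢0 zero    = λ ()
factorial≢0 (suc k) = *-≢0 {+ suc k} (λ ()) (factorial≢0 k)

signed : ∀ {n} → EdgeSet n → ℤ
signed M = ⟦ perfect? M ⟧ ε M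

-- A one-factorization into k blocks can be ordered in k! ways. In the induction, the factor
-- supplied by `signedSum-recursion` is the new factor of the factorial.
ordered≡signedSum : ∀ {m} k {E : EdgeSet (suc m)} → Unique E → (∀ v → degree E v ≡ k) →
                    ordered k signed E ≡ factorial k * signedSum E
ordered≡signedSum {m} zero {E} u reg = empty (degree≡0 {E = E} reg)
  where
  -- There is a vertex, so the empty edge set has no perfect matching, and the empty family of sign
  -- 1 is the only one.
  none : filter (perfect? {suc m}) ([] ∷ []) ≡ []
  none = filter-reject perfect? {x = []} {xs = []} (λ perf → ℕ.0≢1+n (perf Fin.zero))
  empty : ∀ {E : EdgeSet (suc m)} → E ≡ [] → ordered 0 signed E ≡ factorial 0 * signedSum E
  empty refl = sym (trans (ℤ.*-identityˡ (signedSum {suc m} []))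
      (trans (signedSum-weight {suc m} []) (cong (∑Splits (λ F _ → weight {suc m} [] F)) none)))
ordered≡signedSum (suc k) {E} u reg = begin
  ∑Splits (λ M R → ⟦ perfect? M ⟧ ε M * ordered k signed R) E  ≡⟨ ∑Splits-cong E (λ {M} {R} i → step i (perfect? M)) ⟩
  ∑Splits (λ M R → factorial k * (⟦ perfect? M ⟧ (ε M * signedSum R))) E  ≡⟨ ∑Splits-*ˡ (factorial k) _ E ⟩
  factorial k * ∑Splits (λ M R → ⟦ perfect? M ⟧ (ε M * signedSum R)) E
    ≡⟨ cong (factorial k *_) (∑Splits-∖ (λ M R → ⟦ perfect? M ⟧ (ε M * signedSum R)) u) ⟩
  factorial k * ∑ (λ M → ⟦ perfect? M ⟧ (ε M * signedSum (E ∖ M))) (sublists E)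
    ≡⟨ cong (factorial k *_) (∑-filter perfect? (λ M → ε M * signedSum (E ∖ M)) (sublists E)) ⟨
  factorial k * ∑ (λ M → ε M * signedSum (E ∖ M)) (matchings E)
    ≡⟨ cong (factorial k *_) (signedSum-recursion u reg) ⟩
  factorial k * (+ suc k * signedSum E)  ≡⟨ *-leftComm (factorial k) (+ suc k) (signedSum E) ⟩
  + suc k * (factorial k * signedSum E)  ≡⟨ ℤ.*-assoc (+ suc k) (factorial k) (signedSum E) ⟨
  factorial (suc k) * signedSum E  ∎
  where
  step : ∀ {M R} → Interleaving M R E → (d : Dec (Perfect M)) →
         (⟦ d ⟧ ε M) * ordered k signed R ≡ factorial k * (⟦ d ⟧ (ε M * signedSum R))
  step {R = R} i (no _) = trans (ℤ.*-zeroˡ (ordered k signed R)) (sym (ℤ.*-zeroʳ (factorial k)))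
  step {M} {R} i (yes perf) = begin
    ε M * ordered k signed R  ≡⟨ cong (ε M *_) (ordered≡signedSum k
                                                    (⊆-Unique (Interleaving⇒⊆ (Interleaving.swap i)) u) regular) ⟩
    ε M * (factorial k * signedSum R)  ≡⟨ *-leftComm (ε M) (factorial k) (signedSum R) ⟩
    factorial k * (ε M * signedSum R)  ∎
    where
    regular : ∀ v → degree R v ≡ k
    regular v = ℕ.suc-injective (trans (sym (trans (degree-Interleaving i v)
        (cong (λ d → d ℕ.+ degree R v) (perf v)))) (reg v))

∑-single : {A : Set} (f : A → ℤ) {x : A} (xs : List A) → Unique xs → x ∈ xs → (∀ y → y ≢ x → f y ≡ 0ℤ) → ∑ f xs ≡ f x
∑-single f {x} (.x ∷ xs) u (here refl) f≡0 =
  trans (cong (λ z → f x ℤ.+ z) (trans (∑-cong∈ xs (λ {y} y∈ → f≡0 y λ { refl → ∉-head u y∈ })) (∑-0 xs)))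
      (ℤ.+-identityʳ (f x))
∑-single f {x} (y ∷ xs) u@(_ ∷ u′) (there x∈) f≡0 =
  trans (cong₂ ℤ._+_ (f≡0 y λ { refl → ∉-head u x∈ }) (∑-single f xs u′ x∈ f≡0)) (ℤ.+-identityˡ (f x))

sum-mono-≤ : {A : Set} {f g : A → ℕ} (xs : List A) → (∀ {x} → x ∈ xs → f x ≤ g x) → sum f xs ≤ sum g xs
sum-mono-≤ []       f≤g = ℕ.z≤n
sum-mono-≤ (x ∷ xs) f≤g = ℕ.+-mono-≤ (f≤g (here refl)) (sum-mono-≤ xs (f≤g ∘ there))

sum-mono-< : {A : Set} {f g : A → ℕ} {x : A} (xs : List A) → (∀ {x} → x ∈ xs → f x ≤ g x) →
             x ∈ xs → f x < g x → sum f xs < sum g xs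
sum-mono-< (x ∷ xs) f≤g (here refl) f<g = ℕ.+-mono-<-≤ f<g (sum-mono-≤ xs (f≤g ∘ there))
sum-mono-< (x ∷ xs) f≤g (there x∈)  f<g = ℕ.+-mono-≤-< (f≤g (here refl)) (sum-mono-< xs (f≤g ∘ there) x∈ f<g)

sum-≤⇒≡ : {A : Set} {f g : A → ℕ} (xs : List A) → (∀ {x} → x ∈ xs → f x ≤ g x) → sum f xs ≡ sum g xs →
          ∀ {x} → x ∈ xs → f x ≡ g x
sum-≤⇒≡ {f = f} {g} xs f≤g eq {x} x∈ with f x ℕ.≟ g x
... | yes fx≡gx = fx≡gx
... | no  fx≢gx = contradiction eq (ℕ.<⇒≢ (sum-mono-< xs f≤g x∈ (ℕ.≤∧≢⇒< (f≤g x∈) fx≢gx)))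

sum-filter-≤ : {A : Set} {P : Pred A 0ℓ} (P? : Decidable P) (f : A → ℕ) (xs : List A) → sum f (filter P? xs) ≤ sum f xs
sum-filter-≤ P? f []       = ℕ.z≤n
sum-filter-≤ P? f (x ∷ xs) with does (P? x)
... | true  = ℕ.+-monoʳ-≤ (f x) (sum-filter-≤ P? f xs)
... | false = ℕ.≤-trans (sum-filter-≤ P? f xs) (ℕ.m≤n+m _ (f x))

∈⇒≤sum : {A : Set} (f : A → ℕ) {x : A} (xs : List A) → x ∈ xs → f x ≤ sum f xs
∈⇒≤sum f (x ∷ xs) (here refl) = ℕ.m≤m+n (f x) _
∈⇒≤sum f (y ∷ xs) (there x∈)  = ℕ.≤-trans (∈⇒≤sum f xs x∈) (ℕ.m≤n+m _ (f y))

filter-split-↭ : {A : Set} {P : Pred A 0ℓ} (P? : Decidable P) (xs : List A) → xs ↭ filter (¬? ∘ P?) xs ++ filter P? xs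
filter-split-↭ P? []       = Perm.refl
filter-split-↭ P? (x ∷ xs) with does (P? x)
... | true  = ↭-trans (prep x (filter-split-↭ P? xs)) (↭-sym (shift x (filter (¬? ∘ P?) xs) (filter P? xs)))
... | false = prep x (filter-split-↭ P? xs)

-- The graph polynomial

module GraphPolynomial {V : Set} (_≟_ : DecidableEquality V) where

  open DecMembership _≟_ using () renaming (_∈?_ to _∈ᵥ?_)

  bump : V → (V → ℕ) → (V → ℕ)
  bump v s u = if does (u ≟ v) then suc (s u) else s u

  -- The linear functional x^a ↦ w (s + a) applied to the product of the
  -- linear forms x_u - x_v over all pairs (u , v) in L.
  apply : List (V × V) → (V → ℕ) → ((V → ℕ) → ℤ) → ℤ
  apply []            s w = w s
  apply ((u , v) ∷ L) s w = apply L (bump u s) w ℤ.- apply L (bump v s) w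

  Inside : List V → List (V × V) → Set
  Inside U = All (λ (u , v) → u ∈ U × v ∈ U)

  Local : List V → ((V → ℕ) → ℤ) → Set
  Local U w = ∀ {s s′} → (∀ {u} → u ∈ U → s u ≡ s′ u) → w s ≡ w s′

  matches? : (U : List V) (t s : V → ℕ) → Dec (All (λ u → s u ≡ t u) U)
  matches? U t s = all? (λ u → s u ℕ.≟ t u) U

  -- The coefficient functional of the monomial x^t in the variables U.
  δ : List V → (V → ℕ) → (V → ℕ) → ℤ
  δ U t s = ⟦ matches? U t s ⟧ 1ℤ

  bump-≡ : ∀ v s → bump v s v ≡ suc (s v)
  bump-≡ v s = cong (if_then suc (s v) else s v) (dec-true (v ≟ v) refl)

  bump-≢ : ∀ {u v} s → u ≢ v → bump v s u ≡ s u
  bump-≢ {u} {v} s u≢v = cong (if_then suc (s u) else s u) (dec-false (u ≟ v) u≢v)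

  bump-cong : ∀ v {s s′ u} → s u ≡ s′ u → bump v s u ≡ bump v s′ u
  bump-cong v {u = u} eq = cong (λ z → if does (u ≟ v) then suc z else z) eq

  bump-comm : ∀ a b s u → bump a (bump b s) u ≡ bump b (bump a s) u
  bump-comm a b s u with does (u ≟ a) | does (u ≟ b)
  ... | true  | true  = refl
  ... | true  | false = refl
  ... | false | true  = refl
  ... | false | false = refl

  sum-bump-∉ : ∀ {v} s U → v ∉ U → sum (bump v s) U ≡ sum s U
  sum-bump-∉ s U v∉U = sum-cong∈ U (λ u∈ → bump-≢ s λ { refl → v∉U u∈ })

  sum-bump : ∀ {v} s {U} → Unique U → v ∈ U → sum (bump v s) U ≡ suc (sum s U)
  sum-bump {v} s {_ ∷ U} u (here refl) = cong₂ ℕ._+_ (bump-≡ v s) (sum-bump-∉ s U (∉-head u))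
  sum-bump {v} s {x ∷ U} u@(_ ∷ u′) (there v∈) =
    trans (cong₂ ℕ._+_ (bump-≢ s λ { refl → ∉-head u v∈ }) (sum-bump s u′ v∈)) (ℕ.+-suc (s x) (sum s U))

  module _ {U : List V} (uniq : Unique U) where

    private
      shifted : ∀ {v} (s : V → ℕ) {r : V → ℕ} (L : List (V × V)) → v ∈ U →
                sum r U ≡ sum (bump v s) U ℕ.+ length L → sum r U ≡ sum s U ℕ.+ suc (length L)
      shifted s L v∈ eq = trans eq (trans (cong (ℕ._+ length L) (sum-bump s uniq v∈))
          (sym (ℕ.+-suc (sum s U) (length L))))

    -- Homogeneity: every monomial in the expansion has the same total degree in U, so only the
    -- values of w in that degree matter.
    apply-cong : ∀ {L s w w′} → Inside U L → (∀ r → sum r U ≡ sum s U ℕ.+ length L → w r ≡ w′ r) →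
                 apply L s w ≡ apply L s w′
    apply-cong {[]}          {s} []                eq = eq s (sym (ℕ.+-identityʳ _))
    apply-cong {(a , b) ∷ L} {s} ((a∈ , b∈) ∷ ins) eq =
      cong₂ ℤ._-_ (apply-cong ins (λ r p → eq r (shifted s L a∈ p))) (apply-cong ins (λ r p → eq r (shifted s L b∈ p)))

    apply-support : ∀ {L s w} → Inside U L → apply L s w ≢ 0ℤ → ∃ λ r → sum r U ≡ sum s U ℕ.+ length L × w r ≢ 0ℤ
    apply-support {[]}          {s} []                     ne = s , sym (ℕ.+-identityʳ _) , ne
    apply-support {(a , b) ∷ L} {s} {w} ((a∈ , b∈) ∷ ins) ne with apply L (bump a s) w ℤ.≟ 0ℤ
    ... | no ne′ with apply-support ins ne′
    ...   | r , p , wr≢0 = r , shifted s L a∈ p , wr≢0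
    apply-support {(a , b) ∷ L} {s} {w} ((a∈ , b∈) ∷ ins) ne | yes eq
      with apply-support {w = w} ins (λ eq′ → ne (cong₂ ℤ._-_ eq eq′))
    ... | r , p , wr≢0 = r , shifted s L b∈ p , wr≢0

  apply-ext : ∀ L {s w w′} → (∀ r → w r ≡ w′ r) → apply L s w ≡ apply L s w′
  apply-ext []            eq = eq _
  apply-ext ((a , b) ∷ L) eq = cong₂ ℤ._-_ (apply-ext L eq) (apply-ext L eq)

  apply-0 : ∀ L s → apply L s (λ _ → 0ℤ) ≡ 0ℤ
  apply-0 []            s = refl
  apply-0 ((a , b) ∷ L) s = cong₂ ℤ._-_ (apply-0 L (bump a s)) (apply-0 L (bump b s))

  apply-+ : ∀ L s w w′ → apply L s (λ r → w r ℤ.+ w′ r) ≡ apply L s w ℤ.+ apply L s w′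
  apply-+ []            s w w′ = refl
  apply-+ ((a , b) ∷ L) s w w′ =
    trans (cong₂ ℤ._-_ (apply-+ L (bump a s) w w′) (apply-+ L (bump b s) w w′)) (regroup (apply L (bump a s) w) _ _ _)
    where
    regroup : ∀ p q p′ q′ → (p ℤ.+ q) ℤ.- (p′ ℤ.+ q′) ≡ (p ℤ.- p′) ℤ.+ (q ℤ.- q′)
    regroup = ℤ-Solver.solve-∀

  apply-*ˡ : ∀ c L s w → apply L s (λ r → c * w r) ≡ c * apply L s w
  apply-*ˡ c []            s w = refl
  apply-*ˡ c ((a , b) ∷ L) s w =
    trans (cong₂ ℤ._-_ (apply-*ˡ c L (bump a s) w) (apply-*ˡ c L (bump b s) w)) (distrib c _ _)
    where
    distrib : ∀ c p q → c * p ℤ.- c * q ≡ c * (p ℤ.- q)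
    distrib = ℤ-Solver.solve-∀

  apply-∑ : {A : Set} (xs : List A) (L : List (V × V)) (s : V → ℕ) (w : A → (V → ℕ) → ℤ) →
      apply L s (λ r → ∑ (λ x → w x r) xs) ≡ ∑ (λ x → apply L s (w x)) xs
  apply-∑ []       L s w = apply-0 L s
  apply-∑ (x ∷ xs) L s w = trans (apply-+ L s (w x) (λ r → ∑ (λ x → w x r) xs))
      (cong (λ z → apply L s (w x) ℤ.+ z) (apply-∑ xs L s w))

  apply-∑Splits : {A : Set} (xs : List A) (L : List (V × V)) (s : V → ℕ) (w : List A → List A → (V → ℕ) → ℤ) →
            apply L s (λ r → ∑Splits (λ M R → w M R r) xs) ≡ ∑Splits (λ M R → apply L s (w M R)) xs
  apply-∑Splits []       L s w = refl
  apply-∑Splits (x ∷ xs) L s w =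
    trans (apply-+ L s (λ r → ∑Splits (λ M R → w (x ∷ M) R r) xs) (λ r → ∑Splits (λ M R → w M (x ∷ R) r) xs))
          (cong₂ ℤ._+_ (apply-∑Splits xs L s (λ M R → w (x ∷ M) R)) (apply-∑Splits xs L s (λ M R → w M (x ∷ R))))

  module _ {U : List V} {w : (V → ℕ) → ℤ} (local : Local U w) where

    apply-local : ∀ L {s s′} → (∀ {u} → u ∈ U → s u ≡ s′ u) → apply L s w ≡ apply L s′ w
    apply-local []            eq = local eq
    apply-local ((a , b) ∷ L) {s} {s′} eq =
      cong₂ ℤ._-_ (apply-local L (λ u∈ → bump-cong a {s} {s′} (eq u∈)))
          (apply-local L (λ u∈ → bump-cong b {s} {s′} (eq u∈)))

    -- If w ignores both x_a and x_b, it cannot tell them apart.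
    apply-outside : ∀ {a b} L s → a ∉ U → b ∉ U → (a , b) ∈ L → apply L s w ≡ 0ℤ
    apply-outside (_ ∷ L) s a∉ b∉ (here refl) =
      ℤ.i≡j⇒i-j≡0
        (apply-local L (λ u∈ → trans (bump-≢ s λ { refl → a∉ u∈ }) (sym (bump-≢ s λ { refl → b∉ u∈ }))))
    apply-outside ((c , d) ∷ L) s a∉ b∉ (there ab∈) =
      cong₂ ℤ._-_ (apply-outside L (bump c s) a∉ b∉ ab∈) (apply-outside L (bump d s) a∉ b∉ ab∈)

    -- Exponents bumped in a different order agree only pointwise; locality of w turns this into
    -- equality of its values.
    apply-↭ : ∀ {L L′} → L ↭ L′ → ∀ s → apply L s w ≡ apply L′ s w
    apply-↭ Perm.refl s = refl
    apply-↭ (prep (a , b) p) s = cong₂ ℤ._-_ (apply-↭ p (bump a s)) (apply-↭ p (bump b s))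
    apply-↭ {_ ∷ _ ∷ L} {_ ∷ _ ∷ L′} (swap (a , b) (c , d) p) s = begin
      (φ c a ℤ.- φ d a) ℤ.- (φ c b ℤ.- φ d b)
        ≡⟨ exchange (φ c a) (φ d a) (φ c b) (φ d b) ⟩
      (φ c a ℤ.- φ c b) ℤ.- (φ d a ℤ.- φ d b)
        ≡⟨ cong₂ ℤ._-_ (cong₂ ℤ._-_ (exch c a) (exch c b)) (cong₂ ℤ._-_ (exch d a) (exch d b)) ⟩
      (ψ a c ℤ.- ψ b c) ℤ.- (ψ a d ℤ.- ψ b d) ∎
      where
      φ ψ : V → V → ℤ
      φ x y = apply L (bump x (bump y s)) w
      ψ x y = apply L′ (bump x (bump y s)) w
      exchange : ∀ p q r t → (p ℤ.- q) ℤ.- (r ℤ.- t) ≡ (p ℤ.- r) ℤ.- (q ℤ.- t)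
      exchange = ℤ-Solver.solve-∀
      exch : ∀ x y → φ x y ≡ ψ y x
      exch x y = trans (apply-local L (λ {u} _ → bump-comm x y s u)) (apply-↭ p (bump y (bump x s)))
    apply-↭ (Perm.trans p q) s = trans (apply-↭ p s) (apply-↭ q s)

    -- Expand only the factors in H: some monomial of this partial expansion leaves a nonzero value,
    -- and it is absorbed into the starting exponents s′.
    apply-++-nonzero : ∀ H {F s} → apply (H ++ F) s w ≢ 0ℤ → ∃ λ s′ → apply F s′ w ≢ 0ℤ
    apply-++-nonzero []            {s = s} ne = s , ne
    apply-++-nonzero ((a , b) ∷ H) {F} {s} ne with apply (H ++ F) (bump a s) w ℤ.≟ 0ℤ
    ... | no ne′ = apply-++-nonzero H ne′
    ... | yes eq = apply-++-nonzero H (λ eq′ → ne (cong₂ ℤ._-_ eq eq′))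

    apply-filter-nonzero : {P : Pred (V × V) 0ℓ} (P? : Decidable P) → ∀ {L s} → apply L s w ≢ 0ℤ →
                           ∃ λ s′ → apply (filter P? L) s′ w ≢ 0ℤ
    apply-filter-nonzero P? {L} {s} ne =
      apply-++-nonzero (filter (¬? ∘ P?) L) (λ eq → ne (trans (apply-↭ (filter-split-↭ P? L) s) eq))

  module _ {U : List V} {w : (V → ℕ) → ℤ} (uniq : Unique U) (local : Local U w) {L : List (V × V)} {s : V → ℕ} (ins : Inside U L) where

    private
      override : V → ℕ → (V → ℕ) → (V → ℕ)
      override u j t v = if does (v ≟ u) then j else t v

      override-≡ : ∀ u j t → override u j t u ≡ j
      override-≡ u j t = cong (if_then j else t u) (dec-true (u ≟ u) refl)

      override-≢ : ∀ {u v} j t → v ≢ u → override u j t v ≡ t v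
      override-≢ {u} {v} j t v≢u = cong (if_then j else t v) (dec-false (v ≟ u) v≢u)

      degree-bound = sum s U ℕ.+ length L

      -- The variables are pinned one at a time. The value is a sum over the possible exponents j of
      -- u, so some j has a nonzero share; homogeneity bounds j, which keeps the sum finite.
      prescribe : ∀ W → W ⊆ U → apply L s w ≢ 0ℤ → ∃ λ t → apply L s (λ r → ⟦ matches? W t r ⟧ w r) ≢ 0ℤ
      prescribe []      _   ne = s , ne
      prescribe (u ∷ W) W⊆U ne with prescribe W (Sublist.∷ˡ⁻ W⊆U) ne
      ... | t , ne′ with ∑-nonzero (λ j → apply L s (λ r → ⟦ r u ℕ.≟ j ⟧ (⟦ matches? W t r ⟧ w r)))
                           (upTo (suc degree-bound)) (λ eq → ne′ (trans split eq))
        where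
        split : apply L s (λ r → ⟦ matches? W t r ⟧ w r) ≡
                ∑ (λ j → apply L s (λ r → ⟦ r u ℕ.≟ j ⟧ (⟦ matches? W t r ⟧ w r))) (upTo (suc degree-bound))
        split = trans
          (apply-cong uniq ins (λ r eq → sym (trans
            (∑-single (λ j → ⟦ r u ℕ.≟ j ⟧ (⟦ matches? W t r ⟧ w r)) (upTo (suc degree-bound))
                (Unique.upTo⁺ (suc degree-bound))
              (∈-upTo⁺ (ℕ.s≤s (ℕ.≤-trans (∈⇒≤sum r U (⊆-∈ W⊆U (here refl))) (ℕ.≤-reflexive eq))))
              (λ j j≢ → ⟦⟧-no (r u ℕ.≟ j) _ (j≢ ∘ sym)))
            (⟦⟧-yes (r u ℕ.≟ r u) _ refl))))
          (apply-∑ (upTo (suc degree-bound)) L s (λ j r → ⟦ r u ℕ.≟ j ⟧ (⟦ matches? W t r ⟧ w r)))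
      ... | j , _ , ne″ = override u j t , λ eq → ne″ (trans (apply-ext L merge) eq)
        where
        u∉W : u ∉ W
        u∉W = ∉-head (⊆-Unique W⊆U uniq)
        other : ∀ {v} → v ∈ W → override u j t v ≡ t v
        other v∈ = override-≢ j t λ { refl → u∉W v∈ }
        merge : ∀ r → ⟦ r u ℕ.≟ j ⟧ (⟦ matches? W t r ⟧ w r) ≡ ⟦ matches? (u ∷ W) (override u j t) r ⟧ w r
        merge r = ⟦⟧-× (r u ℕ.≟ j) (matches? W t r) (matches? (u ∷ W) (override u j t) r)
          (λ ru≡j all → trans ru≡j (sym (override-≡ u j t)) ∷ All.tabulate
              (λ v∈ → trans (All.lookup all v∈) (sym (other v∈))))
          (λ { (eq ∷ all) → trans eq (override-≡ u j t) , All.tabulate (λ v∈ → trans (All.lookup all v∈) (other v∈)) })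

    -- The value is the sum over t of w t times the coefficient of x^t. A nonzero sum has a nonzero
    -- term, and then both of its factors are nonzero.
    apply-coefficient : apply L s w ≢ 0ℤ →
                        ∃ λ t → w t ≢ 0ℤ × sum t U ≡ sum s U ℕ.+ length L × apply L s (δ U t) ≢ 0ℤ
    apply-coefficient ne with prescribe U ⊆-refl ne
    ... | t , ne′ with apply-support uniq {w = λ r → ⟦ matches? U t r ⟧ w r} ins ne′
    ...   | r , sum≡ , wr≢0 = t , (λ eq → wr≢0 (trans (⟦⟧-≡ˡ (matches? U t r) (λ _ → trans (local r≡t) eq))
        (ℤ.*-zeroˡ (δ U t r))))
                              , trans (sum-cong∈ U (sym ∘ r≡t)) sum≡
                              , λ eq → ne′ (trans (apply-ext L factor)
                                  (trans (apply-*ˡ (w t) L s (δ U t)) (trans (cong (w t *_) eq) (ℤ.*-zeroʳ (w t)))))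
      where
      r≡t : ∀ {u} → u ∈ U → r u ≡ t u
      r≡t = All.lookup (⟦⟧-≢0 (matches? U t r) wr≢0)
      factor : ∀ r → ⟦ matches? U t r ⟧ w r ≡ w t * δ U t r
      factor r = ⟦⟧-≡ˡ (matches? U t r) (λ all → local (All.lookup all))

-- Painter's strategy from a nonzero coefficient

∑Splits-*ʳ : {A : Set} (c : ℤ) (f : List A → List A → ℤ) (xs : List A) → ∑Splits (λ M R → f M R * c) xs ≡
    ∑Splits f xs * c
∑Splits-*ʳ c f xs = trans (∑Splits-cong xs (λ {M} {R} _ → ℤ.*-comm (f M R) c))
    (trans (∑Splits-*ˡ c f xs) (ℤ.*-comm c (∑Splits f xs)))

length-≤1 : {A : Set} (xs : List A) → Unique xs → (∀ {x y} → x ∈ xs → y ∈ xs → x ≡ y) → length xs ≤ 1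
length-≤1 []           _            _  = ℕ.z≤n
length-≤1 (_ ∷ [])     _            _  = ℕ.s≤s ℕ.z≤n
length-≤1 (x ∷ y ∷ xs) ((x≢y ∷ _) ∷ _) eq = contradiction (eq (here refl) (there (here refl))) x≢y

module Painting {n : ℕ} where

  open GraphPolynomial (_≟ₑ_ {n})

  ∉-∖ : (U : EdgeSet n) {I : EdgeSet n} {e : Edge n} → e ∈ U ∖ I → e ∈ U × e ∉ I
  ∉-∖ U {I} = ∈-filter⁻ (λ e → ¬? (e ∈? I)) {xs = U}

  ∈-∖ : {U I : EdgeSet n} {e : Edge n} → e ∈ U → e ∉ I → e ∈ U ∖ I
  ∈-∖ {I = I} = ∈-filter⁺ (λ e → ¬? (e ∈? I))

  avoids? : (I : EdgeSet n) (p : Edge n × Edge n) → Dec (proj₁ p ∉ I × proj₂ p ∉ I)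
  avoids? I (a , b) = ¬? (a ∈? I) ×-dec ¬? (b ∈? I)

  Inside-∖ : ∀ {U L} I → Inside U L → Inside (U ∖ I) (filter (avoids? I) L)
  Inside-∖ {L = L} I ins = All.tabulate λ p∈ → let p∈L , a∉ , b∉ = ∈-filter⁻ (avoids? I) {xs = L} p∈
                                                   a∈U , b∈U = All.lookup ins p∈L
                                               in  ∈-∖ a∈U a∉ , ∈-∖ b∈U b∉

  -- Painter colors I in answer to X. The nonzero coefficient survives on the remaining edges, with
  -- exponents that are unchanged off X and strictly smaller on X; the drop pays for the token spent
  -- there.
  record Reply (U X : EdgeSet n) (L : List (Edge n × Edge n)) (t : Edge n → ℕ) : Set where
    field
      I           : EdgeSet n
      I⊆X         : I ⊆ X
      independent : ∀ {a b} → a ∈ I → b ∈ I → (a , b) ∉ L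
      start t′    : Edge n → ℕ
      nonzero     : apply (filter (avoids? I) L) start (δ (U ∖ I) t′) ≢ 0ℤ
      unmarked    : ∀ {u} → u ∈ U ∖ I → u ∉ X → t′ u ≡ t u
      marked      : ∀ {u} → u ∈ U ∖ I → u ∈ X → t′ u < t u

  -- On monomials of the right degree, x^t is the only one divisible by
  -- ∏_{v ∈ X} x_v^{t v} with the prescribed exponents outside X.  Writing
  -- [t v ≤ r v] = 1 - [r v < t v] for v ∈ X and expanding the product, the
  -- coefficient of x^t is a sum over I ⊆ X of functionals that evaluate
  -- x_v at 1 for v ∈ I and ask for an exponent below t v for v ∈ X ∖ I.
  reply : ∀ {U X L s t} → Unique U → X ⊆ U → Inside U L → apply L s (δ U t) ≢ 0ℤ → Reply U X L t
  reply {U} {X} {L} {s} {t} uniq X⊆U ins ne = fromTerm some-term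
    where
    below : (Edge n → ℕ) → Edge n → ℤ
    below r v = ℤ.- (⟦ r v ℕ.<? t v ⟧ 1ℤ)

    above : (Edge n → ℕ) → ℤ
    above r = ∏ (λ v → 1ℤ ℤ.+ below r v) X * δ (U ∖ X) t r

    term : EdgeSet n → EdgeSet n → (Edge n → ℕ) → ℤ
    term I J r = (∏ (λ _ → 1ℤ) I * ∏ (below r) J) * δ (U ∖ X) t r

    expand : ∀ r → above r ≡ ∑Splits (λ I J → term I J r) X
    expand r = trans (cong (_* δ (U ∖ X) t r) (∏-+ (λ _ → 1ℤ) (below r) X)) (sym (∑Splits-*ʳ (δ (U ∖ X) t r) _ X))

    sum-t : sum t U ≡ sum s U ℕ.+ length L
    sum-t with apply-support uniq {w = δ U t} ins ne
    ... | r , eq , δ≢0 = trans (sum-cong∈ U (λ u∈ → sym (All.lookup (⟦⟧-≢0 (matches? U t r) δ≢0) u∈))) eq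

    δ-above : ∀ r → sum r U ≡ sum s U ℕ.+ length L → δ U t r ≡ above r
    δ-above r eq = go (matches? U t r) (matches? (U ∖ X) t r) (all? (λ v → ¬? (r v ℕ.<? t v)) X)
      where
      go : Dec (All (λ u → r u ≡ t u) U) → Dec (All (λ u → r u ≡ t u) (U ∖ X)) → Dec (All (λ v → ¬ (r v < t v)) X) →
           δ U t r ≡ above r
      go (yes all) _ _ = trans (⟦⟧-yes (matches? U t r) 1ℤ all) (sym (cong₂ _*_
        (trans (∏-cong∈ X (λ {v} v∈ → cong (λ z → 1ℤ ℤ.+ (ℤ.- z))
                  (⟦⟧-no (r v ℕ.<? t v) 1ℤ (ℕ.<-irrefl (All.lookup all (⊆-∈ X⊆U v∈)))))) (∏-1 X))
        (⟦⟧-yes (matches? (U ∖ X) t r) 1ℤ (All.tabulate (λ u∈ → All.lookup all (proj₁ (∉-∖ U u∈)))))))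
      go (no ¬all) (no ¬rest) _ = trans (⟦⟧-no (matches? U t r) 1ℤ ¬all)
        (sym (trans (cong (∏ (λ v → 1ℤ ℤ.+ below r v) X *_) (⟦⟧-no (matches? (U ∖ X) t r) 1ℤ ¬rest))
            (ℤ.*-zeroʳ (∏ (λ v → 1ℤ ℤ.+ below r v) X))))
      -- Here r is at least t on all of U and has the same total, so the two agree after all.
      go (no ¬all) (yes rest) (yes t≤r) = contradiction
        (All.tabulate (λ u∈ → sym (sum-≤⇒≡ U t≤ (trans sum-t (sym eq)) u∈))) ¬all
        where
        t≤ : ∀ {u} → u ∈ U → t u ≤ r u
        t≤ {u} u∈ with u ∈? X
        ... | yes u∈X = ℕ.≮⇒≥ (All.lookup t≤r u∈X)
        ... | no  u∉X = ℕ.≤-reflexive (sym (All.lookup rest (∈-∖ u∈ u∉X)))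
      go (no ¬all) (yes rest) (no ¬t≤r) with find (All.¬All⇒Any¬ (λ v → ¬? (r v ℕ.<? t v)) X ¬t≤r)
      ... | v , v∈X , ¬¬r<t = trans (⟦⟧-no (matches? U t r) 1ℤ ¬all) (sym (trans
        (cong (_* δ (U ∖ X) t r) (∏-zero (λ v → 1ℤ ℤ.+ below r v) X v∈X
          (cong (λ z → 1ℤ ℤ.+ (ℤ.- z)) (⟦⟧-yes (r v ℕ.<? t v) 1ℤ (decidable-stable (r v ℕ.<? t v) ¬¬r<t)))))
        (ℤ.*-zeroˡ (δ (U ∖ X) t r))))

    some-term : ∃₂ λ I J → Interleaving I J X × apply L s (term I J) ≢ 0ℤ
    some-term = ∑Splits-nonzero (λ I J → apply L s (term I J)) X
      (λ eq → ne (trans (apply-cong uniq ins δ-above)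
          (trans (apply-ext L expand) (trans (apply-∑Splits X L s term) eq))))

    uniqX : Unique X
    uniqX = ⊆-Unique X⊆U uniq

    local : ∀ {I J} → Interleaving I J X → Local (U ∖ I) (term I J)
    local {I} {J} split {r} {r′} agree = cong₂ _*_
      (cong (∏ (λ _ → 1ℤ) I *_) (∏-cong∈ J (λ {v} v∈ → cong (λ z → ℤ.- (⟦ z ℕ.<? t v ⟧ 1ℤ)) (agree (J⊆ v∈)))))
      (⟦⟧-⇔ (matches? (U ∖ X) t r) (matches? (U ∖ X) t r′)
        (λ all → All.tabulate (λ u∈ → trans (sym (agree (rest⊆ u∈))) (All.lookup all u∈)))
        (λ all → All.tabulate (λ u∈ → trans (agree (rest⊆ u∈)) (All.lookup all u∈)))
        (λ _ → refl))
      where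
      J⊆ : ∀ {v} → v ∈ J → v ∈ U ∖ I
      J⊆ v∈ = ∈-∖ (⊆-∈ X⊆U (⊆-∈ (Interleaving⇒⊆ (Interleaving.swap split)) v∈))
                  (λ v∈I → Interleaving-disjoint uniqX split v∈I v∈)
      rest⊆ : ∀ {u} → u ∈ U ∖ X → u ∈ U ∖ I
      rest⊆ u∈ = ∈-∖ (proj₁ (∉-∖ U u∈)) (proj₂ (∉-∖ U u∈) ∘ ⊆-∈ (Interleaving⇒⊆ split))

    -- `term I J` ignores the exponents at I, so a factor x_a - x_b with both a and b in I would
    -- make the value 0.
    independent : ∀ {I J} → Interleaving I J X → apply L s (term I J) ≢ 0ℤ → ∀ {a b} → a ∈ I → b ∈ I → (a , b) ∉ L
    independent split ne a∈ b∈ ab∈ = ne (apply-outside (local split) L s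
      (λ a∈′ → proj₂ (∉-∖ U a∈′) a∈) (λ b∈′ → proj₂ (∉-∖ U b∈′) b∈) ab∈)

    unmarked : ∀ {I J t′} → term I J t′ ≢ 0ℤ → ∀ {u} → u ∈ U ∖ I → u ∉ X → t′ u ≡ t u
    unmarked {I} {J} {t′} term≢0 u∈ u∉X = All.lookup (⟦⟧-≢0 (matches? (U ∖ X) t t′)
      (λ eq → term≢0 (trans (cong ((∏ (λ _ → 1ℤ) I * ∏ (below t′) J) *_) eq)
          (ℤ.*-zeroʳ (∏ (λ _ → 1ℤ) I * ∏ (below t′) J)))))
      (∈-∖ (proj₁ (∉-∖ U u∈)) u∉X)

    marked : ∀ {I J t′} → Interleaving I J X → term I J t′ ≢ 0ℤ → ∀ {u} → u ∈ U ∖ I → u ∈ X → t′ u < t u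
    marked {I} {J} {t′} split term≢0 {u} u∈ u∈X with ∈-++⁻ I (∈-resp-↭ (toPermutation split) u∈X)
    ... | inj₁ u∈I = contradiction u∈I (proj₂ (∉-∖ U u∈))
    ... | inj₂ u∈J = ⟦⟧-≢0 (t′ u ℕ.<? t u) (λ eq → ∏-nonzero⁻ (below t′) J
            (λ eq′ → term≢0 (trans (cong (_* δ (U ∖ X) t t′)
                (trans (cong (∏ (λ _ → 1ℤ) I *_) eq′) (ℤ.*-zeroʳ (∏ (λ _ → 1ℤ) I))))
                                   (ℤ.*-zeroˡ (δ (U ∖ X) t t′))))
            u∈J (cong ℤ.-_ eq))

    fromTerm : (∃₂ λ I J → Interleaving I J X × apply L s (term I J) ≢ 0ℤ) → Reply U X L t
    -- The factors that touch I are expanded away into the starting exponents; a monomial of the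
    -- remaining product on which `term I J` is nonzero supplies the new exponents t′.
    fromTerm (I , J , split , ne) = fromStart (apply-filter-nonzero (local split) (avoids? I) {L} ne)
      where
      L′ = filter (avoids? I) L
      fromMonomial : ∀ {start} → (∃ λ t′ → term I J t′ ≢ 0ℤ × sum t′ (U ∖ I) ≡ sum start (U ∖ I) ℕ.+ length L′
                                       × apply L′ start (δ (U ∖ I) t′) ≢ 0ℤ) → Reply U X L t
      fromMonomial {start} (t′ , term≢0 , _ , nonzero) = record
        { I = I ; I⊆X = Interleaving⇒⊆ split ; independent = independent split ne ; start = start ; t′ = t′
        ; nonzero = nonzero ; unmarked = unmarked {I} {J} term≢0 ; marked = marked split term≢0 }
      fromStart : (∃ λ start → apply L′ start (term I J) ≢ 0ℤ) → Reply U X L t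
      fromStart (start , ne) =
        fromMonomial (apply-coefficient (Unique.filter⁺ (λ e → ¬? (e ∈? I)) uniq) (local split) (Inside-∖ I ins) ne)

  matching : {I : EdgeSet n} → Unique I → (∀ {e f} → e ∈ I → f ∈ I → ¬ Adjacent e f) → Matching I
  matching {I} uniq nonadj v = length-≤1 (filter (v incident?_) I) (Unique.filter⁺ (v incident?_) uniq) same
    where
    same : ∀ {e f} → e ∈ filter (v incident?_) I → f ∈ filter (v incident?_) I → e ≡ f
    same {e} {f} e∈ f∈ with e ≟ₑ f
    ... | yes e≡f = e≡f
    ... | no  e≢f = let e∈I , ve = ∈-filter⁻ (v incident?_) {xs = I} e∈
                        f∈I , vf = ∈-filter⁻ (v incident?_) {xs = I} f∈
                    in  contradiction (e≢f , v , ve , vf) (nonadj e∈I f∈I)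

  spend-∈ : ∀ X f {e : Edge n} → e ∈ X → spend X f e ≡ f e ∸ 1
  spend-∈ X f {e} e∈ with e ∈? X
  ... | yes _ = refl
  ... | no e∉ = contradiction e∈ e∉

  spend-∉ : ∀ X f {e : Edge n} → e ∉ X → spend X f e ≡ f e
  spend-∉ X f {e} e∉ with e ∈? X
  ... | yes e∈ = contradiction e∈ e∉
  ... | no _   = refl

  spend-≤ : ∀ X f (e : Edge n) → spend X f e ≤ f e
  spend-≤ X f e with e ∈? X
  ... | yes _ = ℕ.m∸n≤m (f e) 1
  ... | no _  = ℕ.≤-refl

  Covers : EdgeSet n → List (Edge n × Edge n) → Set
  Covers U L = ∀ {e f} → e ∈ U → f ∈ U → Adjacent e f → (e , f) ∈ L ⊎ (f , e) ∈ L

  -- The invariant of the game is a nonzero coefficient whose exponents stay below the tokens. N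
  -- bounds the tokens still held by uncolored edges and makes the recursion structural.
  painterWins : ∀ N {U L s f t} → sum f U ≤ N → Unique U → Inside U L → Covers U L →
                (∀ {u} → u ∈ U → t u < f u) → apply L s (δ U t) ≢ 0ℤ → PainterWins U f
  painterWins N {U} {L} {s} {f} {t} sum≤N uniq ins covers t<f ne =
    wins (All.tabulate (λ u∈ → ℕ.≤-<-trans ℕ.z≤n (t<f u∈))) (answer N sum≤N)
    where
    -- A marked edge x still has a token, since t x < f x, so the truncated subtraction in `spend`
    -- really lowers the sum.
    decrease : ∀ X I → X ⊆ U → 0 < length X → sum (spend X f) (U ∖ I) < sum f U
    decrease X@(x ∷ _) I X⊆U _ = ℕ.≤-<-trans (sum-filter-≤ (λ e → ¬? (e ∈? I)) (spend X f) U)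
      (sum-mono-< U (λ {e} _ → spend-≤ X f e) x∈U
        (subst (_< f x) (sym (spend-∈ X f {x} (here refl)))
            (ℕ.∸-monoʳ-< {f x} {1} {0} (ℕ.s≤s ℕ.z≤n) (ℕ.≤-<-trans ℕ.z≤n (t<f x∈U)))))
      where
      x∈U = ⊆-∈ X⊆U (here refl)

    answer : ∀ N → sum f U ≤ N → ∀ X → X ⊆ U → 0 < length X → ∃ λ P →
        P ⊆ X × Matching P × PainterWins (U ∖ P) (spend X f)
    answer zero    sum≤N X X⊆U X≢[] = contradiction (ℕ.<-≤-trans (decrease X [] X⊆U X≢[]) sum≤N) ℕ.n≮0
    answer (suc N) sum≤N X X⊆U X≢[] = follow (reply uniq X⊆U ins ne)
      where
      follow : Reply U X L t → ∃ λ P → P ⊆ X × Matching P × PainterWins (U ∖ P) (spend X f)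
      follow r = I , I⊆X , matching (⊆-Unique (⊆-trans I⊆X X⊆U) uniq) nonadjacent
        , painterWins N (ℕ.≤-pred (ℕ.<-≤-trans (decrease X I X⊆U X≢[]) sum≤N)) (Unique.filter⁺ (λ e → ¬? (e ∈? I)) uniq)
            (Inside-∖ I ins) covers′ t′<f′ nonzero
        where
        open Reply r

        nonadjacent : ∀ {e f} → e ∈ I → f ∈ I → ¬ Adjacent e f
        nonadjacent e∈ f∈ adj with covers (⊆-∈ X⊆U (⊆-∈ I⊆X e∈)) (⊆-∈ X⊆U (⊆-∈ I⊆X f∈)) adj
        ... | inj₁ ef∈ = independent e∈ f∈ ef∈
        ... | inj₂ fe∈ = independent f∈ e∈ fe∈

        covers′ : Covers (U ∖ I) (filter (avoids? I) L)
        covers′ e∈ f∈ adj with ∉-∖ U e∈ | ∉-∖ U f∈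
        ... | e∈U , e∉I | f∈U , f∉I with covers e∈U f∈U adj
        ...   | inj₁ ef∈ = inj₁ (∈-filter⁺ (avoids? I) ef∈ (e∉I , f∉I))
        ...   | inj₂ fe∈ = inj₂ (∈-filter⁺ (avoids? I) fe∈ (f∉I , e∉I))

        t′<f′ : ∀ {u} → u ∈ U ∖ I → t′ u < spend X f u
        t′<f′ {u} u∈ with u ∈? X
        ... | yes u∈X = ℕ.<-≤-trans (marked u∈ u∈X) (ℕ.∸-monoˡ-≤ 1 (t<f (proj₁ (∉-∖ U u∈))))
        ... | no  u∉X = subst (_< f u) (sym (unmarked u∈ u∉X)) (t<f (proj₁ (∉-∖ U u∈)))

-- Endpoints of edges, counted with multiplicity

-1^length-filter : {A : Set} {P : Pred A 0ℓ} (P? : Decidable P) (xs : List A) →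
                   -1ℤ ℤ.^ length (filter P? xs) ≡ ∏ (λ x → if does (P? x) then -1ℤ else 1ℤ) xs
-1^length-filter P? []       = refl
-1^length-filter P? (x ∷ xs) with does (P? x)
... | true  = cong (-1ℤ *_) (-1^length-filter P? xs)
... | false = trans (-1^length-filter P? xs) (sym (ℤ.*-identityˡ _))

module Count {A : Set} (_≟_ : DecidableEquality A) where

  count : A → List A → ℕ
  count x = sum (λ y → if does (x ≟ y) then 1 else 0)

  count-∉ : ∀ {x} xs → x ∉ xs → count x xs ≡ 0
  count-∉ []       _  = refl
  count-∉ {x} (y ∷ xs) x∉ =
    cong₂ ℕ._+_ (cong (if_then 1 else 0) (dec-false (x ≟ y) (x∉ ∘ here))) (count-∉ xs (x∉ ∘ there))

  count-here : ∀ x xs → count x (x ∷ xs) ≡ suc (count x xs)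
  count-here x xs = cong (λ b → (if b then 1 else 0) ℕ.+ count x xs) (dec-true (x ≟ x) refl)

  count-Unique : ∀ {x xs} → Unique xs → x ∈ xs → count x xs ≡ 1
  count-Unique {x} {_ ∷ xs} u (here refl) = trans (count-here x xs) (cong suc (count-∉ xs (∉-head u)))
  count-Unique {x} {y ∷ xs} u@(_ ∷ u′) (there x∈) =
    cong₂ ℕ._+_ (cong (if_then 1 else 0) (dec-false (x ≟ y) (λ { refl → ∉-head u x∈ }))) (count-Unique u′ x∈)

  count-∈ : ∀ {x} xs → 0 < count x xs → x ∈ xs
  count-∈ {x} (y ∷ xs) 0< with x ≟ y
  ... | yes refl = here refl
  ... | no  _    = there (count-∈ xs 0<)

  count⇒↭ : ∀ xs ys → (∀ x → count x xs ≡ count x ys) → xs ↭ ys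
  count⇒↭ []       []       _  = Perm.refl
  count⇒↭ []       (y ∷ ys) eq with trans (eq y) (count-here y ys)
  ... | ()
  count⇒↭ (x ∷ xs) ys eq
    with ys₁ , ys₂ , refl ← ∈-∃++ (count-∈ ys (subst (0 <_) (trans (sym (count-here x xs)) (eq x)) (ℕ.s≤s ℕ.z≤n))) =
    ↭-trans (prep x (count⇒↭ xs (ys₁ ++ ys₂) rest)) (↭-sym (shift x ys₁ ys₂))
    where
    rest : ∀ y → count y xs ≡ count y (ys₁ ++ ys₂)
    rest y = ℕ.+-cancelˡ-≡ (if does (y ≟ x) then 1 else 0) _ _ (trans (eq y) (sum-↭ _ (shift x ys₁ ys₂)))

module _ {n : ℕ} where

  open Count (Fin._≟_ {n}) public

  ends : Edge n → List (Fin n)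
  ends (a , b) = a ∷ b ∷ []

  vertices : EdgeSet n → List (Fin n)
  vertices = concatMap ends

  Increasing : Edge n → Set
  Increasing (a , b) = a Fin.< b

  count-ends : ∀ v {e} → Increasing e → count v (ends e) ≡ (if does (v incident? e) then 1 else 0)
  count-ends v {a , b} a<b with v Fin.≟ a | v Fin.≟ b
  ... | yes refl | yes refl = contradiction refl (Fin.<⇒≢ a<b)
  ... | yes _    | no _     = refl
  ... | no _     | yes _    = refl
  ... | no _     | no _     = refl

  degree-count : ∀ {E} → All Increasing E → ∀ v → degree E v ≡ count v (vertices E)
  degree-count {E} incr v = begin
    degree E v  ≡⟨ length-filter-sum (v incident?_) E ⟩
    sum (λ e → if does (v incident? e) then 1 else 0) E  ≡⟨ sum-cong∈ E (λ e∈ → count-ends v (All.lookup incr e∈)) ⟨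
    sum (λ e → count v (ends e)) E  ≡⟨ sum-concatMap _ ends E ⟨
    count v (vertices E)  ∎

  -- The degree of a vertex is its multiplicity among the endpoints. This turns a product over the
  -- ends of the edges of M into a product over all vertices, in which M no longer occurs.
  vertices-perfect : ∀ {M} → All Increasing M → Perfect M → vertices M ↭ allFin n
  vertices-perfect incr perf = count⇒↭ _ _ λ v →
    trans (sym (degree-count incr v)) (trans (perf v) (sym (count-Unique (Unique.allFin⁺ n) (∈-allFin v))))

  -- Signs of matchings

  sgn : Fin n → Fin n → ℤ
  sgn x y = if does (y Fin.<? x) then -1ℤ else 1ℤ

  sgn-< : ∀ {x y} → x Fin.< y → sgn x y ≡ 1ℤ
  sgn-< {x} {y} x<y = cong (if_then -1ℤ else 1ℤ) (dec-false (y Fin.<? x) (Fin.<-asym x<y))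

  sgn-> : ∀ {x y} → y Fin.< x → sgn x y ≡ -1ℤ
  sgn-> {x} {y} y<x = cong (if_then -1ℤ else 1ℤ) (dec-true (y Fin.<? x) y<x)

  -- The factor of a pair of endpoints x, y of two edges: z, later the
  -- difference of the colours, if they coincide, and a sign otherwise.
  θ : ℤ → Fin n → Fin n → ℤ
  θ z x y = if does (x Fin.≟ y) then z else sgn x y

  θ-≡ : ∀ z x → θ z x x ≡ z
  θ-≡ z x = cong (if_then z else sgn x x) (dec-true (x Fin.≟ x) refl)

  θ-≢ : ∀ z {x y} → x ≢ y → θ z x y ≡ sgn x y
  θ-≢ z {x} {y} x≢y = cong (if_then z else sgn x y) (dec-false (x Fin.≟ y) x≢y)

  θ-antisym : ∀ z x y → θ (ℤ.- z) y x ≡ ℤ.- θ z x y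
  θ-antisym z x y with Fin.<-cmp x y
  ... | tri≈ _ refl _  = trans (θ-≡ (ℤ.- z) x) (cong ℤ.-_ (sym (θ-≡ z x)))
  ... | tri< x<y x≢y _ = trans (trans (θ-≢ _ (x≢y ∘ sym)) (sgn-> x<y)) (cong ℤ.-_ (sym (trans (θ-≢ z x≢y) (sgn-< x<y))))
  ... | tri> _ x≢y y<x = trans (trans (θ-≢ _ (x≢y ∘ sym)) (sgn-< y<x)) (cong ℤ.-_ (sym (trans (θ-≢ z x≢y) (sgn-> y<x))))

  θ-nonzero : ∀ {z} x y → z ≢ 0ℤ → θ z x y ≢ 0ℤ
  θ-nonzero x y z≢0 with does (x Fin.≟ y) | does (y Fin.<? x)
  ... | true  | _     = z≢0
  ... | false | true  = λ ()
  ... | false | false = λ ()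

  Θ : ℤ → Edge n → Edge n → ℤ
  Θ z e f = ∏ (λ x → ∏ (θ z x) (ends f)) (ends e)

  -- All four factors change sign by `θ-antisym`, so the product does not.
  Θ-swap : ∀ z e f → Θ z e f ≡ Θ (ℤ.- z) f e
  Θ-swap z e@(a , b) f@(c , d) = begin
    ∏ (λ x → ∏ (λ y → θ z x y) (ends f)) (ends e)  ≡⟨ ∏-swap (θ z) (ends e) (ends f) ⟩
    ∏ (λ y → ∏ (λ x → θ z x y) (ends e)) (ends f)  ≡⟨ ∏-cong (ends f) (λ y → flip y) ⟩
    ∏ (λ y → ∏ (λ x → θ (ℤ.- z) y x) (ends e)) (ends f)  ∎
    where
    neg-neg : ∀ p q → ℤ.- p * (ℤ.- q * 1ℤ) ≡ p * (q * 1ℤ)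
    neg-neg = ℤ-Solver.solve-∀
    flip : ∀ y → ∏ (λ x → θ z x y) (ends e) ≡ ∏ (λ x → θ (ℤ.- z) y x) (ends e)
    flip y = trans (sym (neg-neg (θ z a y) (θ z b y)))
                   (sym (cong₂ (λ p q → p * (q * 1ℤ)) (θ-antisym z a y) (θ-antisym z b y)))

  crossSign : Edge n → Edge n → ℤ
  crossSign e f = if does (crossing? e f) then -1ℤ else 1ℤ

  -- Two disjoint edges cross exactly when an odd number of the four pairs of ends, one from each
  -- edge, is inverted: 0 or 4 for separated edges, 2 for nested ones, 1 or 3 for crossing ones.
  crossSign-Θ : ∀ {e f} → Increasing e → Increasing f → (∀ {x} → x ∈ ends e → x ∉ ends f) →
                crossSign e f * crossSign f e ≡ Θ 0ℤ e f
  crossSign-Θ {a , c} {b , d} a<c b<d disj =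
    trans (go (Fin.<-cmp a b) (Fin.<-cmp a d) (Fin.<-cmp c b) (Fin.<-cmp c d))
          (cong₂ _*_ (cong₂ (λ p q → p * (q * 1ℤ)) (sym (θ-≢ 0ℤ a≢b)) (sym (θ-≢ 0ℤ a≢d)))
                       (cong (_* 1ℤ) (cong₂ (λ p q → p * (q * 1ℤ)) (sym (θ-≢ 0ℤ c≢b)) (sym (θ-≢ 0ℤ c≢d)))))
    where
    a≢b : a ≢ b
    a≢b eq = disj (here refl) (here eq)
    a≢d : a ≢ d
    a≢d eq = disj (here refl) (there (here eq))
    c≢b : c ≢ b
    c≢b eq = disj (there (here refl)) (here eq)
    c≢d : c ≢ d
    c≢d eq = disj (there (here refl)) (there (here eq))
    e = a , c
    f = b , d
    cross : ∀ p q → Crossing p q → crossSign p q ≡ -1ℤ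
    cross p q pq = cong (if_then -1ℤ else 1ℤ) (dec-true (crossing? p q) pq)
    uncross : ∀ p q → ¬ Crossing p q → crossSign p q ≡ 1ℤ
    uncross p q ¬pq = cong (if_then -1ℤ else 1ℤ) (dec-false (crossing? p q) ¬pq)
    prod : ∀ {p q r t} → sgn a b ≡ p → sgn a d ≡ q → sgn c b ≡ r → sgn c d ≡ t →
           (p * (q * 1ℤ)) * ((r * (t * 1ℤ)) * 1ℤ) ≡
           (sgn a b * (sgn a d * 1ℤ)) * ((sgn c b * (sgn c d * 1ℤ)) * 1ℤ)
    prod refl refl refl refl = refl
    go : Tri (a Fin.< b) (a ≡ b) (b Fin.< a) → Tri (a Fin.< d) (a ≡ d) (d Fin.< a) →
         Tri (c Fin.< b) (c ≡ b) (b Fin.< c) → Tri (c Fin.< d) (c ≡ d) (d Fin.< c) →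
         crossSign (a , c) (b , d) * crossSign (b , d) (a , c) ≡
         (sgn a b * (sgn a d * 1ℤ)) * ((sgn c b * (sgn c d * 1ℤ)) * 1ℤ)
    go (tri≈ _ eq _) _ _ _ = contradiction eq a≢b
    go _ (tri≈ _ eq _) _ _ = contradiction eq a≢d
    go _ _ (tri≈ _ eq _) _ = contradiction eq c≢b
    go _ _ _ (tri≈ _ eq _) = contradiction eq c≢d
    go (tri< a<b _ _) (tri> _ _ d<a) _ _ = contradiction (Fin.<-trans (Fin.<-trans a<b b<d) d<a) (Fin.<-irrefl refl)
    go (tri< a<b _ _) (tri< a<d _ _) (tri< c<b _ _) (tri> _ _ d<c) =
      contradiction (Fin.<-trans (Fin.<-trans c<b b<d) d<c) (Fin.<-irrefl refl)
    go (tri< a<b _ _) (tri< a<d _ _) (tri< c<b _ _) (tri< c<d _ _) =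
      trans (cong₂ _*_ (uncross e f (λ (_ , b<c , _) → Fin.<-asym b<c c<b))
          (uncross f e (λ (b<a , _) → Fin.<-asym a<b b<a)))
            (prod (sgn-< a<b) (sgn-< a<d) (sgn-< c<b) (sgn-< c<d))
    go (tri< a<b _ _) (tri< a<d _ _) (tri> _ _ b<c) (tri< c<d _ _) =
      trans (cong₂ _*_ (cross e f (a<b , b<c , c<d)) (uncross f e (λ (b<a , _) → Fin.<-asym a<b b<a)))
            (prod (sgn-< a<b) (sgn-< a<d) (sgn-> b<c) (sgn-< c<d))
    go (tri< a<b _ _) (tri< a<d _ _) (tri> _ _ b<c) (tri> _ _ d<c) =
      trans (cong₂ _*_ (uncross e f (λ (_ , _ , c<d) → Fin.<-asym c<d d<c))
          (uncross f e (λ (b<a , _) → Fin.<-asym a<b b<a)))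
            (prod (sgn-< a<b) (sgn-< a<d) (sgn-> b<c) (sgn-> d<c))
    go (tri> _ _ b<a) _ (tri< c<b _ _) _ = contradiction (Fin.<-trans (Fin.<-trans c<b b<a) a<c) (Fin.<-irrefl refl)
    go (tri> _ _ b<a) (tri> _ _ d<a) (tri> _ _ b<c) (tri< c<d _ _) =
      contradiction (Fin.<-trans (Fin.<-trans c<d d<a) a<c) (Fin.<-irrefl refl)
    go (tri> _ _ b<a) (tri> _ _ d<a) (tri> _ _ b<c) (tri> _ _ d<c) =
      trans (cong₂ _*_ (uncross e f (λ (a<b , _) → Fin.<-asym a<b b<a))
          (uncross f e (λ (_ , a<d , _) → Fin.<-asym a<d d<a)))
            (prod (sgn-> b<a) (sgn-> d<a) (sgn-> b<c) (sgn-> d<c))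
    go (tri> _ _ b<a) (tri< a<d _ _) (tri> _ _ b<c) (tri> _ _ d<c) =
      trans (cong₂ _*_ (uncross e f (λ (a<b , _) → Fin.<-asym a<b b<a)) (cross f e (b<a , a<d , d<c)))
            (prod (sgn-> b<a) (sgn-< a<d) (sgn-> b<c) (sgn-> d<c))
    go (tri> _ _ b<a) (tri< a<d _ _) (tri> _ _ b<c) (tri< c<d _ _) =
      trans (cong₂ _*_ (uncross e f (λ (a<b , _) → Fin.<-asym a<b b<a))
          (uncross f e (λ (_ , _ , d<c) → Fin.<-asym c<d d<c)))
            (prod (sgn-> b<a) (sgn-< a<d) (sgn-> b<c) (sgn-< c<d))

  ε-square : ∀ M → ε M ≡ ∏ (λ e → ∏ (crossSign e) M) M
  ε-square M = trans (-1^length-filter (λ { (e , f) → crossing? e f }) (cartesianProduct M M)) (product M M)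
    where
    product : ∀ M N → ∏ (λ { (e , f) → crossSign e f }) (cartesianProduct M N) ≡ ∏ (λ e → ∏ (crossSign e) N) M
    product []      N = refl
    product (e ∷ M) N = trans (∏-++ _ (map (e ,_) N) (cartesianProduct M N))
        (cong₂ _*_ (∏-map _ (e ,_) N) (product M N))

  ∈-vertices : ∀ {x e} M → e ∈ M → x ∈ ends e → x ∈ vertices M
  ∈-vertices (e ∷ M) (here refl) x∈ = ∈-++⁺ˡ x∈
  ∈-vertices (f ∷ M) (there e∈)  x∈ = ∈-++⁺ʳ (ends f) (∈-vertices M e∈ x∈)

  ∏Pairs-Θ : ∀ M → All Increasing M → Unique (vertices M) → ∏Pairs (λ e f → crossSign e f * crossSign f e) M ≡
      ∏Pairs (Θ 0ℤ) M
  ∏Pairs-Θ []       _            _ = refl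
  ∏Pairs-Θ (e@(a , b) ∷ M) (a<b ∷ incr) u@(a≢ ∷ b≢ ∷ u′) = begin
    ∏Pairs (λ e f → crossSign e f * crossSign f e) (e ∷ M)  ≡⟨ ∏Pairs-∷ _ e M ⟩
    ∏ (λ f → crossSign e f * crossSign f e) M * ∏Pairs (λ e f → crossSign e f * crossSign f e) M
      ≡⟨ cong₂ _*_ (∏-cong∈ M (λ {f} f∈ → crossSign-Θ a<b (All.lookup incr f∈) (disjoint f∈))) (∏Pairs-Θ M incr u′) ⟩
    ∏ (Θ 0ℤ e) M * ∏Pairs (Θ 0ℤ) M  ≡⟨ ∏Pairs-∷ (Θ 0ℤ) e M ⟨
    ∏Pairs (Θ 0ℤ) (e ∷ M)  ∎
    where
    disjoint : ∀ {f} → f ∈ M → ∀ {x} → x ∈ ends e → x ∉ ends f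
    disjoint f∈ (here refl)         x∈f = All.lookup a≢ (there (∈-vertices M f∈ x∈f)) refl
    disjoint f∈ (there (here refl)) x∈f = All.lookup b≢ (∈-vertices M f∈ x∈f) refl

  -- Edges of one colour class have colour difference 0, hence the parameter `0ℤ`; as the ends are
  -- distinct, only signs enter the product.
  ε-Θ : ∀ {M} → All Increasing M → Unique (vertices M) → ε M ≡ ∏Pairs (Θ 0ℤ) M
  ε-Θ {M} incr u = begin
    ε M  ≡⟨ ε-square M ⟩
    ∏ (λ e → ∏ (crossSign e) M) M  ≡⟨ ∏-square crossSign M ⟩
    ∏ (λ e → crossSign e e) M * ∏Pairs (λ e f → crossSign e f * crossSign f e) M
      ≡⟨ cong₂ _*_ (trans (∏-cong M noSelf) (∏-1 M)) (∏Pairs-Θ M incr u) ⟩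
    1ℤ * ∏Pairs (Θ 0ℤ) M  ≡⟨ ℤ.*-identityˡ _ ⟩
    ∏Pairs (Θ 0ℤ) M  ∎
    where
    noSelf : ∀ e → crossSign e e ≡ 1ℤ
    noSelf e@(a , _) = cong (if_then -1ℤ else 1ℤ) (dec-false (crossing? e e)
        (λ (a<a , _) → Fin.<-irrefl {x = a} refl a<a))

-- Finite differences

Δ : (ℕ → ℤ) → (ℕ → ℤ)
Δ p c = p (suc c) ℤ.- p c

-- Polynomial degree less than m, expressed as the vanishing of the m-th difference.
DegreeBelow : ℕ → (ℕ → ℤ) → Set
DegreeBelow zero    p = ∀ c → p c ≡ 0ℤ
DegreeBelow (suc m) p = DegreeBelow m (Δ p)

DegreeBelow-cong : ∀ m (p q : ℕ → ℤ) → (∀ c → p c ≡ q c) → DegreeBelow m p → DegreeBelow m q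
DegreeBelow-cong zero    p q eq p≡0 c = trans (sym (eq c)) (p≡0 c)
DegreeBelow-cong (suc m) p q eq d     = DegreeBelow-cong m (Δ p) (Δ q) (λ c → cong₂ ℤ._-_ (eq (suc c)) (eq c)) d

DegreeBelow-+ : ∀ m (p q : ℕ → ℤ) → DegreeBelow m p → DegreeBelow m q → DegreeBelow m (λ c → p c ℤ.+ q c)
DegreeBelow-+ zero    p q p≡0 q≡0 c = cong₂ ℤ._+_ (p≡0 c) (q≡0 c)
DegreeBelow-+ (suc m) p q dp dq = DegreeBelow-cong m _ _ regroup (DegreeBelow-+ m (Δ p) (Δ q) dp dq)
  where
  ring : ∀ p′ p q′ q → (p′ ℤ.- p) ℤ.+ (q′ ℤ.- q) ≡ (p′ ℤ.+ q′) ℤ.- (p ℤ.+ q)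
  ring = ℤ-Solver.solve-∀
  regroup : ∀ c → Δ p c ℤ.+ Δ q c ≡ Δ (λ c → p c ℤ.+ q c) c
  regroup c = ring (p (suc c)) (p c) (q (suc c)) (q c)

DegreeBelow-suc : ∀ m (p : ℕ → ℤ) → DegreeBelow m p → DegreeBelow (suc m) p
DegreeBelow-suc zero    p p≡0 c = cong₂ ℤ._-_ (p≡0 (suc c)) (p≡0 c)
DegreeBelow-suc (suc m) p d     = DegreeBelow-suc m (Δ p) d

-- The product rule: the difference of c * p c is c * Δ p c + p (c + 1). Writing p (c + 1) as Δ p c
-- + p c lets the induction run on Δ p.
DegreeBelow-x* : ∀ m (p : ℕ → ℤ) → DegreeBelow m p → DegreeBelow (suc m) (λ c → + c * p c)
DegreeBelow-x* zero p p≡0 c = cong₂ ℤ._-_ (trans (cong (+ suc c *_) (p≡0 (suc c))) (ℤ.*-zeroʳ (+ suc c)))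
                                        (trans (cong (+ c *_) (p≡0 c)) (ℤ.*-zeroʳ (+ c)))
DegreeBelow-x* (suc m) p d = DegreeBelow-cong (suc m) _ (Δ (λ c → + c * p c)) leibniz
  (DegreeBelow-+ (suc m) (λ c → + c * Δ p c) (λ c → Δ p c ℤ.+ p c) (DegreeBelow-x* m (Δ p) d)
    (DegreeBelow-+ (suc m) (Δ p) p (DegreeBelow-suc m (Δ p) d) d))
  where
  ring : ∀ c p′ p → c * (p′ ℤ.- p) ℤ.+ ((p′ ℤ.- p) ℤ.+ p) ≡ (1ℤ ℤ.+ c) * p′ ℤ.- c * p
  ring = ℤ-Solver.solve-∀
  leibniz : ∀ c → + c * Δ p c ℤ.+ (Δ p c ℤ.+ p c) ≡ Δ (λ c → + c * p c) c
  leibniz c = ring (+ c) (p (suc c)) (p c)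

DegreeBelow-^ : ∀ j → DegreeBelow (suc j) (λ c → (+ c) ℤ.^ j)
DegreeBelow-^ zero    c = refl
DegreeBelow-^ (suc j) = DegreeBelow-x* (suc j) (λ c → (+ c) ℤ.^ j) (DegreeBelow-^ j)

DegreeBelow-≤ : ∀ {j m} (p : ℕ → ℤ) → j ≤ m → DegreeBelow j p → DegreeBelow m p
DegreeBelow-≤ {j} {m} p j≤m d = go (ℕ.≤⇒≤′ j≤m)
  where
  go : ∀ {m} → j ℕ.≤′ m → DegreeBelow m p
  go ℕ.≤′-refl       = d
  go (ℕ.≤′-step {n} le) = DegreeBelow-suc n p (go le)

-- Weights α m of the functional p ↦ (Δᵐ p) 0 = ∑_{c ≤ m} α m c p c.

pascal : ℕ → ℕ → ℕ
pascal zero    zero    = 1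
pascal zero    (suc c) = 0
pascal (suc m) zero    = pascal m zero
pascal (suc m) (suc c) = pascal m c ℕ.+ pascal m (suc c)

pascal-positive : ∀ {m c} → c ≤ m → 0 < pascal m c
pascal-positive {zero}  {zero}  _           = ℕ.s≤s ℕ.z≤n
pascal-positive {suc m} {zero}  _           = pascal-positive {m} ℕ.z≤n
pascal-positive {suc m} {suc c} (ℕ.s≤s c≤m) = ℕ.<-≤-trans (pascal-positive c≤m) (ℕ.m≤m+n _ _)

pascal-> : ∀ {m c} → m < c → pascal m c ≡ 0
pascal-> {zero}  {suc c} _           = refl
pascal-> {suc m} {suc c} (ℕ.s≤s m<c) = cong₂ ℕ._+_ (pascal-> m<c) (pascal-> (ℕ.m<n⇒m<1+n m<c))

-- The usual sign has exponent m - c; m + c has the same parity and avoids subtraction.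
α : ℕ → ℕ → ℤ
α m c = -1ℤ ℤ.^ (m ℕ.+ c) * (+ pascal m c)

α-nonzero : ∀ {m c} → c ≤ m → α m c ≢ 0ℤ
α-nonzero {m} {c} c≤m = *-≢0 (power (m ℕ.+ c)) (λ eq → ℕ.<⇒≢ (pascal-positive c≤m) (sym (ℤ.+-injective eq)))
  where
  power : ∀ k → -1ℤ ℤ.^ k ≢ 0ℤ
  power zero    = λ ()
  power (suc k) = *-≢0 { -1ℤ} (λ ()) (power k)

α-suc-zero : ∀ m → α (suc m) 0 ≡ ℤ.- α m 0
α-suc-zero m = trans (ℤ.*-assoc -1ℤ (-1ℤ ℤ.^ (m ℕ.+ 0)) (+ pascal m 0)) (ℤ.-1*i≡-i (α m 0))

α-suc-suc : ∀ m c → α (suc m) (suc c) ≡ α m c ℤ.- α m (suc c)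
α-suc-suc m c rewrite ℕ.+-suc m c = ring (-1ℤ ℤ.^ (m ℕ.+ c)) (+ pascal m c) (+ pascal m (suc c))
  where
  ring : ∀ s p q → (-1ℤ * (-1ℤ * s)) * (p ℤ.+ q) ≡ s * p ℤ.- (-1ℤ * s) * q
  ring = ℤ-Solver.solve-∀

∑-downFrom-suc : ∀ (f : ℕ → ℤ) k → ∑ f (downFrom (suc k)) ≡ ∑ (f ∘ suc) (downFrom k) ℤ.+ f 0
∑-downFrom-suc f zero    = ℤ.+-comm (f 0) 0ℤ
∑-downFrom-suc f (suc k) = trans (cong (λ z → f (suc k) ℤ.+ z) (∑-downFrom-suc f k))
    (sym (ℤ.+-assoc (f (suc k)) (∑ (f ∘ suc) (downFrom k)) (f 0)))

∑-neg : {A : Set} (f : A → ℤ) (xs : List A) → ∑ (λ x → ℤ.- f x) xs ≡ ℤ.- ∑ f xs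
∑-neg f []       = refl
∑-neg f (x ∷ xs) = trans (cong (λ z → ℤ.- f x ℤ.+ z) (∑-neg f xs)) (sym (ℤ.neg-distrib-+ (f x) (∑ f xs)))

-- Pascal's rule writes α (m + 1) as a difference of two shifts of α m. Moving the shift over to p
-- gives Δ p, and the extra term c = m + 1 has binomial weight 0.
∑-α-suc : ∀ m p → ∑ (λ c → α (suc m) c * p c) (downFrom (suc (suc m))) ≡ ∑ (λ c → α m c * Δ p c) (downFrom (suc m))
∑-α-suc m p = begin
  ∑ (λ c → α (suc m) c * p c) (downFrom (suc (suc m)))  ≡⟨ ∑-downFrom-suc (λ c → α (suc m) c * p c) (suc m) ⟩
  ∑ (λ c → α (suc m) (suc c) * p (suc c)) ds ℤ.+ α (suc m) 0 * p 0
    ≡⟨ cong₂ ℤ._+_ (trans (∑-cong ds split) (∑-+ (λ c → α m c * p (suc c)) (λ c → ℤ.- (α m (suc c) * p (suc c))) ds))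
                   (trans (cong (_* p 0) (α-suc-zero m)) (sym (ℤ.neg-distribˡ-* (α m 0) (p 0)))) ⟩
  (A ℤ.+ ∑ (λ c → ℤ.- (α m (suc c) * p (suc c))) ds) ℤ.+ ℤ.- (α m 0 * p 0)
    ≡⟨ trans (ℤ.+-assoc A _ _) (cong (λ z → A ℤ.+ z)
        (trans (cong (ℤ._+ (ℤ.- (α m 0 * p 0))) (∑-neg (λ c → α m (suc c) * p (suc c)) ds))
         (sym (ℤ.neg-distrib-+ (∑ (λ c → α m (suc c) * p (suc c)) ds) (α m 0 * p 0))))) ⟩
  A ℤ.- (∑ (λ c → α m (suc c) * p (suc c)) ds ℤ.+ α m 0 * p 0)
    ≡⟨ cong (λ z → A ℤ.- z) (sym (∑-downFrom-suc (λ c → α m c * p c) (suc m))) ⟩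
  A ℤ.- (α m (suc m) * p (suc m) ℤ.+ ∑ (λ c → α m c * p c) ds)
    ≡⟨ cong (λ z → A ℤ.- z) (trans (cong (ℤ._+ ∑ (λ c → α m c * p c) ds) top) (ℤ.+-identityˡ _)) ⟩
  A ℤ.- ∑ (λ c → α m c * p c) ds  ≡⟨ cong (λ z → A ℤ.+ z) (∑-neg (λ c → α m c * p c) ds) ⟨
  A ℤ.+ ∑ (λ c → ℤ.- (α m c * p c)) ds  ≡⟨ ∑-+ (λ c → α m c * p (suc c)) (λ c → ℤ.- (α m c * p c)) ds ⟨
  ∑ (λ c → α m c * p (suc c) ℤ.- α m c * p c) ds  ≡⟨ ∑-cong ds (λ c → sym (distrib (α m c) (p (suc c)) (p c))) ⟩
  ∑ (λ c → α m c * Δ p c) ds  ∎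
  where
  ds = downFrom (suc m)
  A = ∑ (λ c → α m c * p (suc c)) ds
  distrib : ∀ x y z → x * (y ℤ.- z) ≡ x * y ℤ.- x * z
  distrib = ℤ-Solver.solve-∀
  distribʳ : ∀ x y z → (x ℤ.- y) * z ≡ x * z ℤ.- y * z
  distribʳ = ℤ-Solver.solve-∀
  split : ∀ c → α (suc m) (suc c) * p (suc c) ≡ α m c * p (suc c) ℤ.- α m (suc c) * p (suc c)
  split c = trans (cong (_* p (suc c)) (α-suc-suc m c)) (distribʳ (α m c) (α m (suc c)) (p (suc c)))
  top : α m (suc m) * p (suc m) ≡ 0ℤ
  top = trans (cong (_* p (suc m)) (trans (cong (λ z → -1ℤ ℤ.^ (m ℕ.+ suc m) * + z) (pascal-> (ℕ.n<1+n m)))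
      (ℤ.*-zeroʳ (-1ℤ ℤ.^ (m ℕ.+ suc m)))))
              (ℤ.*-zeroˡ (p (suc m)))

∑-α-DegreeBelow : ∀ m (p : ℕ → ℤ) → DegreeBelow m p → ∑ (λ c → α m c * p c) (downFrom (suc m)) ≡ 0ℤ
∑-α-DegreeBelow zero    p p≡0 = trans (ℤ.+-identityʳ _) (trans (cong (α 0 0 *_) (p≡0 0)) (ℤ.*-zeroʳ (α 0 0)))
∑-α-DegreeBelow (suc m) p d = trans (∑-α-suc m p) (∑-α-DegreeBelow m (Δ p) d)

differences : ℕ → ℕ → ℤ
differences m j = ∑ (λ c → α m c * (+ c) ℤ.^ j) (downFrom (suc m))

-- The power c^j has degree below m when j < m, so its m-th difference vanishes. This bounds the
-- surviving exponents from below.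
differences-≢0 : ∀ {m j} → differences m j ≢ 0ℤ → m ≤ j
differences-≢0 {m} {j} ne with m ℕ.≤? j
... | yes m≤j = m≤j
... | no  m≰j = contradiction (∑-α-DegreeBelow m (λ c → (+ c) ℤ.^ j)
    (DegreeBelow-≤ (λ c → (+ c) ℤ.^ j) (ℕ.≰⇒> m≰j) (DegreeBelow-^ j))) ne

-- Ordered partitions and colourings

data Parts {A : Set} : ℕ → List A → List (List A) → Set where
  []  : Parts zero [] []
  _∷_ : ∀ {k M R E Ms} → Interleaving M R E → Parts k R Ms → Parts (suc k) E (M ∷ Ms)

∑Parts : {A : Set} → ℕ → (List (List A) → ℤ) → List A → ℤ
∑Parts zero    F []      = F []
∑Parts zero    F (_ ∷ _) = 0ℤ
∑Parts (suc k) F E       = ∑Splits (λ M R → ∑Parts k (λ Ms → F (M ∷ Ms)) R) E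

∑Parts-cong : {A : Set} → ∀ k {F G : List (List A) → ℤ} E → (∀ {Ms} → Parts k E Ms → F Ms ≡ G Ms) → ∑Parts k F E ≡
    ∑Parts k G E
∑Parts-cong zero    []      eq = eq []
∑Parts-cong zero    (_ ∷ _) eq = refl
∑Parts-cong (suc k) E       eq = ∑Splits-cong E (λ {M} {R} i → ∑Parts-cong k R (λ ps → eq (i ∷ ps)))

∑Parts-*ˡ : {A : Set} → ∀ k c (F : List (List A) → ℤ) E → ∑Parts k (λ Ms → c * F Ms) E ≡ c * ∑Parts k F E
∑Parts-*ˡ zero    c F []      = refl
∑Parts-*ˡ zero    c F (_ ∷ _) = sym (ℤ.*-zeroʳ c)
∑Parts-*ˡ (suc k) c F E       = trans (∑Splits-cong E (λ {M} {R} _ → ∑Parts-*ˡ k c (λ Ms → F (M ∷ Ms)) R))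
    (∑Splits-*ˡ c _ E)

∑Parts-∏ : {A : Set} → ∀ k (φ : List A → ℤ) E → ∑Parts k (∏ φ) E ≡ ordered k φ E
∑Parts-∏ zero    φ []      = refl
∑Parts-∏ zero    φ (_ ∷ _) = refl
∑Parts-∏ (suc k) φ E       = ∑Splits-cong E (λ {M} {R} _ →
    trans (∑Parts-*ˡ k (φ M) (∏ φ) R) (cong (φ M *_) (∑Parts-∏ k φ R)))

Parts-length : {A : Set} → ∀ {k} {E : List A} {Ms} → Parts k E Ms → length Ms ≡ k
Parts-length []       = refl
Parts-length (_ ∷ ps) = cong suc (Parts-length ps)

pairs-∈⁻ : ∀ {A : Set} {x y : A} xs → (x , y) ∈ pairs xs → x ∈ xs × y ∈ xs
pairs-∈⁻ (z ∷ xs) p∈ with ∈-++⁻ (map (z ,_) xs) p∈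
... | inj₂ p∈′ = let x∈ , y∈ = pairs-∈⁻ xs p∈′ in there x∈ , there y∈
... | inj₁ p∈′ with ∈-map⁻ (z ,_) p∈′
...   | _ , y∈ , refl = here refl , there y∈

pairs-∈⁺ : ∀ {A : Set} {x y : A} xs → x ∈ xs → y ∈ xs → x ≢ y → (x , y) ∈ pairs xs ⊎ (y , x) ∈ pairs xs
pairs-∈⁺ (_ ∷ xs) (here refl) (here refl) x≢y = contradiction refl x≢y
pairs-∈⁺ (x ∷ xs) (here refl) (there y∈)  _   = inj₁ (∈-++⁺ˡ (∈-map⁺ (x ,_) y∈))
pairs-∈⁺ (y ∷ xs) (there x∈)  (here refl) _   = inj₂ (∈-++⁺ˡ (∈-map⁺ (y ,_) x∈))
pairs-∈⁺ (z ∷ xs) (there x∈)  (there y∈)  x≢y with pairs-∈⁺ xs x∈ y∈ x≢y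
... | inj₁ p∈ = inj₁ (∈-++⁺ʳ (map (z ,_) xs) p∈)
... | inj₂ p∈ = inj₂ (∈-++⁺ʳ (map (z ,_) xs) p∈)

module Colouring {n : ℕ} where

  open GraphPolynomial (_≟ₑ_ {n})
  open Painting {n} using (Covers)

  -- The colour of a class is the number of classes after it: putting a class in front does not
  -- recolour the others, and k classes use the colours of `downFrom k`.
  colour : List (EdgeSet n) → Edge n → ℕ
  colour []       e = 0
  colour (M ∷ Ms) e = if does (e ∈? M) then length Ms else colour Ms e

  colour-∈ : ∀ {M Ms e} → e ∈ M → colour (M ∷ Ms) e ≡ length Ms
  colour-∈ {M} {Ms} {e} e∈ = cong (if_then length Ms else colour Ms e) (dec-true (e ∈? M) e∈)

  colour-∉ : ∀ {M Ms e} → e ∉ M → colour (M ∷ Ms) e ≡ colour Ms e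
  colour-∉ {M} {Ms} {e} e∉ = cong (if_then length Ms else colour Ms e) (dec-false (e ∈? M) e∉)

  ∏-split : ∀ {M R E : EdgeSet n} (f : Edge n → ℤ) → Interleaving M R E → ∏ f E ≡ ∏ f M * ∏ f R
  ∏-split {M} {R} f i = trans (∏-↭ f (toPermutation i)) (∏-++ f M R)

  module _ {M R E : EdgeSet n} (u : Unique E) (i : Interleaving M R E) where

    rest : ∀ {Ms e} → e ∈ R → colour (M ∷ Ms) e ≡ colour Ms e
    rest {Ms} e∈ = colour-∉ {Ms = Ms} (λ e∈M → Interleaving-disjoint u i e∈M e∈)

    ∏-colour : ∀ {Ms} (h : Edge n → ℕ → ℤ) →
               ∏ (λ e → h e (colour (M ∷ Ms) e)) E ≡ ∏ (λ e → h e (length Ms)) M * ∏ (λ e → h e (colour Ms e)) R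
    ∏-colour {Ms} h = trans (∏-split (λ e → h e (colour (M ∷ Ms) e)) i)
      (cong₂ _*_ (∏-cong∈ M (λ {e} e∈ → cong (h e) (colour-∈ {Ms = Ms} e∈)))
          (∏-cong∈ R (λ {e} e∈ → cong (h e) (rest {Ms} e∈))))

    uniqR : Unique R
    uniqR = ⊆-Unique (Interleaving⇒⊆ (Interleaving.swap i)) u

  -- Multiplying out picks a colour for every edge, and such a choice is an ordered partition into k
  -- classes.
  ∏-∑-colours : ∀ k (h : Edge n → ℕ → ℤ) {E} → Unique E →
                ∏ (λ e → ∑ (h e) (downFrom k)) E ≡ ∑Parts k (λ Ms → ∏ (λ e → h e (colour Ms e)) E) E
  ∏-∑-colours zero    h {[]}    u = refl
  ∏-∑-colours zero    h {_ ∷ E} u = ℤ.*-zeroˡ (∏ (λ _ → 0ℤ) E)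
  ∏-∑-colours (suc k) h {E}     u = begin
    ∏ (λ e → h e k ℤ.+ ∑ (h e) (downFrom k)) E
      ≡⟨ ∏-+ (λ e → h e k) (λ e → ∑ (h e) (downFrom k)) E ⟩
    ∑Splits (λ M R → ∏ (λ e → h e k) M * ∏ (λ e → ∑ (h e) (downFrom k)) R) E
      ≡⟨ ∑Splits-cong E (λ {M} {R} i → trans (cong (∏ (λ e → h e k) M *_) (∏-∑-colours k h (uniqR u i)))
           (sym (∑Parts-*ˡ k (∏ (λ e → h e k) M) (λ Ms → ∏ (λ e → h e (colour Ms e)) R) R))) ⟩
    ∑Splits (λ M R → ∑Parts k (λ Ms → ∏ (λ e → h e k) M * ∏ (λ e → h e (colour Ms e)) R) R) E
      ≡⟨ ∑Splits-cong E (λ {M} {R} i → ∑Parts-cong k R (λ {Ms} ps →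
           trans (cong (λ z → ∏ (λ e → h e z) M * ∏ (λ e → h e (colour Ms e)) R) (sym (Parts-length ps)))
               (sym (∏-colour u i {Ms} h)))) ⟩
    ∑Parts (suc k) (λ Ms → ∏ (λ e → h e (colour Ms e)) E) E ∎

  apply-∑Parts : ∀ k L s (w : List (EdgeSet n) → (Edge n → ℕ) → ℤ) E →
                 apply L s (λ r → ∑Parts k (λ Ms → w Ms r) E) ≡ ∑Parts k (λ Ms → apply L s (w Ms)) E
  apply-∑Parts zero    L s w []      = refl
  apply-∑Parts zero    L s w (_ ∷ _) = apply-0 L s
  apply-∑Parts (suc k) L s w E = trans (apply-∑Splits E L s (λ M R r → ∑Parts k (λ Ms → w (M ∷ Ms) r) R))
    (∑Splits-cong E (λ {M} {R} _ → apply-∑Parts k L s (λ Ms → w (M ∷ Ms)) R))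

  monomial : EdgeSet n → (Edge n → ℤ) → (Edge n → ℕ) → ℤ
  monomial U a s = ∏ (λ u → a u ℤ.^ s u) U

  monomial-bump : ∀ {U} a {v} s → Unique U → v ∈ U → monomial U a (bump v s) ≡ a v * monomial U a s
  monomial-bump {_ ∷ U} a {v} s u (here refl) = trans
    (cong₂ _*_ (cong (a v ℤ.^_) (bump-≡ v s)) (∏-cong∈ U
        (λ {e} e∈ → cong (a e ℤ.^_) (bump-≢ s λ { refl → ∉-head u e∈ }))))
    (ℤ.*-assoc (a v) (a v ℤ.^ s v) (monomial U a s))
  monomial-bump {x ∷ U} a {v} s u@(_ ∷ u′) (there v∈) = trans
    (cong₂ _*_ (cong (a x ℤ.^_) (bump-≢ s λ { refl → ∉-head u v∈ })) (monomial-bump a s u′ v∈))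
    (*-leftComm (a x ℤ.^ s x) (a v) (monomial U a s))

  difference : (Edge n → ℤ) → Edge n × Edge n → ℤ
  difference a (e , f) = a e ℤ.- a f

  -- The functional that sends x^r to a^r is evaluation at the point a, so it is multiplicative.
  apply-monomial : ∀ {U} a L s → Unique U → Inside U L → apply L s (monomial U a) ≡ monomial U a s * ∏ (difference a) L
  apply-monomial {U} a []            s u []                = sym (ℤ.*-identityʳ (monomial U a s))
  apply-monomial {U} a ((e , f) ∷ L) s u ((e∈ , f∈) ∷ ins) = begin
    apply L (bump e s) (monomial U a) ℤ.- apply L (bump f s) (monomial U a)
      ≡⟨ cong₂ ℤ._-_ (side e e∈) (side f f∈) ⟩
    a e * (m * p) ℤ.- a f * (m * p)  ≡⟨ ring (a e) (a f) m p ⟩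
    m * ((a e ℤ.- a f) * p)  ∎
    where
    ring : ∀ x y m p → x * (m * p) ℤ.- y * (m * p) ≡ m * ((x ℤ.- y) * p)
    ring = ℤ-Solver.solve-∀
    m = monomial U a s ; p = ∏ (difference a) L
    side : ∀ e → e ∈ U → apply L (bump e s) (monomial U a) ≡ a e * (m * p)
    side e e∈ = trans (apply-monomial a L (bump e s) u ins)
                      (trans (cong (_* p) (monomial-bump a s u e∈)) (ℤ.*-assoc (a e) m p))

  -- One entry for each coincidence of ends, in the same shape as the double product in `Θ`, so that
  -- colour differences and signs can be matched factor by factor.
  link : Edge n × Edge n → Fin n → Fin n → List (Edge n × Edge n)
  link p x y = if does (x Fin.≟ y) then p ∷ [] else []

  linksAt : Edge n × Edge n → Fin n → List (Edge n × Edge n)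
  linksAt p x = concatMap (link p x) (ends (proj₂ p))

  links : Edge n × Edge n → List (Edge n × Edge n)
  links p = concatMap (linksAt p) (ends (proj₁ p))

  lineGraph : EdgeSet n → List (Edge n × Edge n)
  lineGraph E = concatMap links (pairs E)

  links-∈⁻ : ∀ {p q} → q ∈ links p → q ≡ p
  links-∈⁻ {p} {q} q∈ with find (∈-concatMap⁻ (linksAt p) {xs = ends (proj₁ p)} q∈)
  ... | x , _ , q∈x with find (∈-concatMap⁻ (link p x) {xs = ends (proj₂ p)} q∈x)
  ...   | y , _ , q∈xy with does (x Fin.≟ y) | q∈xy
  ...     | true | here eq = eq

  links-∈⁺ : ∀ {v p} → v ∈ ends (proj₁ p) → v ∈ ends (proj₂ p) → p ∈ links p
  links-∈⁺ {v} {p} v∈e v∈f = ∈-concatMap⁺ (linksAt p) (lose v∈e (∈-concatMap⁺ (link p v) (lose v∈f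
    (subst (λ b → p ∈ (if b then p ∷ [] else [])) (sym (dec-true (v Fin.≟ v) refl)) (here refl)))))

  lineGraph-Inside : ∀ E → Inside E (lineGraph E)
  lineGraph-Inside E = All.tabulate inside
    where
    inside : ∀ {q} → q ∈ lineGraph E → proj₁ q ∈ E × proj₂ q ∈ E
    inside q∈ with find (∈-concatMap⁻ links {xs = pairs E} q∈)
    ... | p , p∈ , q∈p with links-∈⁻ {p} q∈p
    ...   | refl = pairs-∈⁻ E p∈

  incident-ends : {v : Fin n} (e : Edge n) → v incident e → v ∈ ends e
  incident-ends _ (inj₁ refl) = here refl
  incident-ends _ (inj₂ refl) = there (here refl)

  lineGraph-Covers : ∀ E → Covers E (lineGraph E)
  lineGraph-Covers E {e} {f} e∈ f∈ (e≢f , v , ve , vf) with pairs-∈⁺ E e∈ f∈ e≢f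
  ... | inj₁ p∈ = inj₁ (∈-concatMap⁺ links (lose p∈ (links-∈⁺ {v} {e , f} (incident-ends e ve) (incident-ends f vf))))
  ... | inj₂ p∈ = inj₂ (∈-concatMap⁺ links (lose p∈ (links-∈⁺ {v} {f , e} (incident-ends f vf) (incident-ends e ve))))

-- Values of the graph polynomial at colourings

Unique-↭ : {A : Set} {xs ys : List A} → xs ↭ ys → Unique xs → Unique ys
Unique-↭ {A} p = Permutationₛ.Unique-resp-↭ (setoid A) (↭⇒↭ₛ p)

neg-minus : ∀ i j → ℤ.- (i ℤ.- j) ≡ j ℤ.- i
neg-minus = ℤ-Solver.solve-∀

^-nonzero : ∀ {i} k → i ≢ 0ℤ → i ℤ.^ k ≢ 0ℤ
^-nonzero     zero    i≢0 = λ ()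
^-nonzero {i} (suc k) i≢0 = *-≢0 {i} i≢0 (^-nonzero k i≢0)

∏-const : {A : Set} (z : ℤ) (xs : List A) → ∏ (λ _ → z) xs ≡ z ℤ.^ length xs
∏-const z []       = refl
∏-const z (x ∷ xs) = cong (z *_) (∏-const z xs)

length-allFin : ∀ n → length (allFin n) ≡ n
length-allFin n = length-tabulate {n = n} id

module Signs {n : ℕ} where

  open GraphPolynomial (_≟ₑ_ {n})
  open Colouring {n}

  spread : (Edge n → ℤ) → Edge n → Edge n → ℤ
  spread a e f = Θ (a e ℤ.- a f) e f

  spread-sym : ∀ a e f → spread a e f ≡ spread a f e
  spread-sym a e f = trans (Θ-swap (a e ℤ.- a f) e f) (cong (λ z → Θ z f e) (neg-minus (a e) (a f)))

  -- `Θ 1ℤ` supplies exactly the signs, since coinciding ends contribute 1 to it; the links supply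
  -- the colour differences at the coincidences.
  ∏-lineGraph : ∀ a E → ∏ (difference a) (lineGraph E) * ∏Pairs (Θ 1ℤ) E ≡ ∏Pairs (spread a) E
  ∏-lineGraph a E = begin
    ∏ (difference a) (lineGraph E) * ∏Pairs (Θ 1ℤ) E
      ≡⟨ cong (_* ∏Pairs (Θ 1ℤ) E) (∏-concatMap (difference a) links (pairs E)) ⟩
    ∏Pairs (λ e f → ∏ (difference a) (links (e , f))) E * ∏Pairs (Θ 1ℤ) E
      ≡⟨ ∏Pairs-* (λ e f → ∏ (difference a) (links (e , f))) (Θ 1ℤ) E ⟨
    ∏Pairs (λ e f → ∏ (difference a) (links (e , f)) * Θ 1ℤ e f) E
      ≡⟨ ∏Pairs-cong∈ E (λ {e} {f} _ _ → pair e f) ⟩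
    ∏Pairs (spread a) E ∎
    where
    pair : ∀ e f → ∏ (difference a) (links (e , f)) * Θ 1ℤ e f ≡ spread a e f
    pair e f = begin
      ∏ (difference a) (links (e , f)) * Θ 1ℤ e f
        ≡⟨ cong (_* Θ 1ℤ e f) (trans (∏-concatMap (difference a) (linksAt (e , f)) (ends e))
             (∏-cong (ends e) (λ x → ∏-concatMap (difference a) (link (e , f) x) (ends f)))) ⟩
      ∏ (λ x → ∏ (λ y → ∏ (difference a) (link (e , f) x y)) (ends f)) (ends e) * Θ 1ℤ e f
        ≡⟨ ∏-* (λ x → ∏ (λ y → ∏ (difference a) (link (e , f) x y)) (ends f)) (λ x → ∏ (θ 1ℤ x) (ends f)) (ends e) ⟨
      ∏ (λ x → ∏ (λ y → ∏ (difference a) (link (e , f) x y)) (ends f) * ∏ (θ 1ℤ x) (ends f)) (ends e)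
        ≡⟨ ∏-cong (ends e) (λ x → trans (sym (∏-* (λ y → ∏ (difference a) (link (e , f) x y)) (θ 1ℤ x) (ends f)))
             (∏-cong (ends f) (point x))) ⟩
      spread a e f ∎
      where
      point : ∀ x y → ∏ (difference a) (link (e , f) x y) * θ 1ℤ x y ≡ θ (a e ℤ.- a f) x y
      point x y with does (x Fin.≟ y)
      ... | true  = trans (ℤ.*-identityʳ ((a e ℤ.- a f) * 1ℤ)) (ℤ.*-identityʳ (a e ℤ.- a f))
      ... | false = ℤ.*-identityˡ (sgn x y)

  spread-split : ∀ a {M R E} → Interleaving M R E →
    ∏Pairs (spread a) E ≡ (∏Pairs (spread a) M * ∏Pairs (spread a) R) * ∏ (λ e → ∏ (spread a e) R) M
  spread-split a {M} {R} i = trans (∏Pairs-↭ (spread a) (spread-sym a) (toPermutation i)) (∏Pairs-++ (spread a) M R)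

  spread-zeroˡ : ∀ a {M R E} → Interleaving M R E → ∏Pairs (spread a) M ≡ 0ℤ → ∏Pairs (spread a) E ≡ 0ℤ
  spread-zeroˡ a {M} {R} i eq = trans (spread-split a i)
    (trans (cong (λ z → (z * ∏Pairs (spread a) R) * F) eq) (ℤ.*-zeroˡ F))
    where F = ∏ (λ e → ∏ (spread a e) R) M

  spread-zeroʳ : ∀ a {M R E} → Interleaving M R E → ∏Pairs (spread a) R ≡ 0ℤ → ∏Pairs (spread a) E ≡ 0ℤ
  spread-zeroʳ a {M} {R} i eq = trans (spread-split a i)
    (trans (cong (λ z → (∏Pairs (spread a) M * z) * F) eq)
        (trans (cong (_* F) (ℤ.*-zeroʳ (∏Pairs (spread a) M))) (ℤ.*-zeroˡ F)))
    where F = ∏ (λ e → ∏ (spread a e) R) M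

  spread-cong : ∀ {a b} E → (∀ {e} → e ∈ E → a e ≡ b e) → ∏Pairs (spread a) E ≡ ∏Pairs (spread b) E
  spread-cong E eq = ∏Pairs-cong∈ E (λ {e} {f} e∈ f∈ → cong₂ (λ x y → Θ (x ℤ.- y) e f) (eq e∈) (eq f∈))

  Θ-zero : ∀ {v} (e f : Edge n) → v ∈ ends e → v ∈ ends f → Θ 0ℤ e f ≡ 0ℤ
  Θ-zero {v} e f v∈e v∈f = ∏-zero (λ x → ∏ (θ 0ℤ x) (ends f)) (ends e) v∈e (∏-zero (θ 0ℤ v) (ends f) v∈f (θ-≡ 0ℤ v))

  -- Two edges of one colour that meet at v have a factor equal to their colour difference, which is
  -- 0.
  clash : ∀ {a M v} → 2 ≤ degree M v → (∀ {e f} → e ∈ M → f ∈ M → a e ≡ a f) → ∏Pairs (spread a) M ≡ 0ℤ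
  clash {a} {M} {v} 2≤ const = trans (∏Pairs-↭ (spread a) (spread-sym a) perm)
    (go (filter (v incident?_) M) 2≤ (λ e∈ → ∈-filter⁻ (v incident?_) {xs = M} e∈))
    where
    others = filter (¬? ∘ (v incident?_)) M
    -- The edges at v move to the front, so that two of them form the first entry of `pairs`.
    perm : M ↭ filter (v incident?_) M ++ others
    perm = ↭-trans (filter-split-↭ (v incident?_) M) (++-comm others (filter (v incident?_) M))
    go : ∀ Mᵥ → 2 ≤ length Mᵥ → (∀ {e} → e ∈ Mᵥ → e ∈ M × v incident e) → ∏Pairs (spread a) (Mᵥ ++ others) ≡ 0ℤ
    go (e ∷ f ∷ Mᵥ) _ at-v = ∏-zero (λ (e , f) → spread a e f) (pairs (e ∷ f ∷ Mᵥ ++ others)) (here refl)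
      (trans (cong (λ z → Θ z e f) (ℤ.i≡j⇒i-j≡0 (const (proj₁ (at-v (here refl))) (proj₁ (at-v (there (here refl)))))))
             (Θ-zero e f (incident-ends e (proj₂ (at-v (here refl))))
                 (incident-ends f (proj₂ (at-v (there (here refl)))))))
    go []      () _
    go (_ ∷ []) (ℕ.s≤s ()) _

  colourℤ : List (EdgeSet n) → Edge n → ℤ
  colourℤ Ms e = + colour Ms e

  monochromatic : ∀ M Ms {e} → e ∈ M → colourℤ (M ∷ Ms) e ≡ + length Ms
  monochromatic M Ms e∈ = cong +_ (colour-∈ {Ms = Ms} e∈)

  -- Either the first class has two edges at v, or removing it costs at most one edge there together
  -- with one colour.
  pigeonhole : ∀ {k E Ms v} → Parts k E Ms → Unique E → k < degree E v → ∏Pairs (spread (colourℤ Ms)) E ≡ 0ℤ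
  pigeonhole {v = v} (_∷_ {k} {M} {R} {E} {Ms} i ps) u k< with 2 ℕ.≤? degree M v
  ... | yes 2≤ = spread-zeroˡ a i (clash {a} 2≤ (λ e∈ f∈ → trans (monochromatic M Ms e∈) (sym (monochromatic M Ms f∈))))
    where a = colourℤ (M ∷ Ms)
  ... | no 2≰ = spread-zeroʳ (colourℤ (M ∷ Ms)) i
    (trans (spread-cong R (λ e∈ → cong +_ (rest u i {Ms} e∈))) (pigeonhole ps (uniqR u i) k<R))
    where
    k<R : k < degree R v
    k<R = ℕ.+-cancelˡ-< 1 _ _ (ℕ.<-≤-trans k< (ℕ.≤-trans (ℕ.≤-reflexive (degree-Interleaving i v))
            (ℕ.+-monoˡ-≤ (degree R v) (ℕ.≤-pred (ℕ.≰⇒> 2≰)))))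

  Increasing-Interleaving : ∀ {M R E : EdgeSet n} → Interleaving M R E → All Increasing E →
      All Increasing M × All Increasing R
  Increasing-Interleaving i incr = Sublist.All-resp-⊆ (Interleaving⇒⊆ i) incr , Sublist.All-resp-⊆
      (Interleaving⇒⊆ (Interleaving.swap i)) incr

  -- In a perfect class every vertex is an end exactly once, so its share of the product depends on
  -- its colour alone.
  ∏-classes : ∀ {k E Ms} (Q : ℕ → Fin n → ℤ) → Parts k E Ms → Unique E → All Increasing E → All Perfect Ms →
              ∏ (λ f → ∏ (Q (colour Ms f)) (ends f)) E ≡ ∏ (λ c → ∏ (Q c) (allFin n)) (downFrom k)
  ∏-classes Q [] u incr [] = refl
  ∏-classes {suc k} {E} {M ∷ Ms} Q (_∷_ {R = R} i ps) u incr (perf ∷ perfs) = begin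
    ∏ (λ f → ∏ (Q (colour (M ∷ Ms) f)) (ends f)) E  ≡⟨ ∏-colour u i {Ms} (λ f c → ∏ (Q c) (ends f)) ⟩
    ∏ (λ f → ∏ (Q (length Ms)) (ends f)) M * ∏ (λ f → ∏ (Q (colour Ms f)) (ends f)) R
      ≡⟨ cong₂ _*_ (trans (cong (λ c → ∏ (λ f → ∏ (Q c) (ends f)) M) (Parts-length ps))
          (trans (sym (∏-concatMap (Q k) ends M)) (∏-↭ (Q k) (vertices-perfect incrM perf))))
                     (∏-classes Q ps (uniqR u i) incrR perfs) ⟩
    ∏ (Q k) (allFin n) * ∏ (λ c → ∏ (Q c) (allFin n)) (downFrom k)  ∎
    where
    incrM = proj₁ (Increasing-Interleaving i incr)
    incrR = proj₂ (Increasing-Interleaving i incr)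

  column : ℕ → ℕ → Fin n → ℤ
  column k c y = ∏ (λ x → θ (+ k ℤ.- + c) x y) (allFin n)

  -- What a perfect class of colour k contributes together with perfect classes of all lower
  -- colours; it depends on n and k only.
  between : ℕ → ℤ
  between k = ∏ (λ c → ∏ (column k c) (allFin n)) (downFrom k)

  ∏-between : ∀ {k M R Ms} → Parts k R Ms → Unique R → All Increasing M → All Increasing R → Perfect M →
      All Perfect Ms →
              ∏ (λ e → ∏ (λ f → Θ (+ k ℤ.- + colour Ms f) e f) R) M ≡ between k
  ∏-between {k} {M} {R} {Ms} ps u incrM incrR perf perfs = begin
    ∏ (λ e → ∏ (λ f → Θ (z f) e f) R) M  ≡⟨ ∏-swap (λ e f → Θ (z f) e f) M R ⟩
    ∏ (λ f → ∏ (λ e → Θ (z f) e f) M) R  ≡⟨ ∏-cong R collect ⟩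
    ∏ (λ f → ∏ (column k (colour Ms f)) (ends f)) R  ≡⟨ ∏-classes (column k) ps u incrR perfs ⟩
    between k  ∎
    where
    z : Edge n → ℤ
    z f = + k ℤ.- + colour Ms f
    collect : ∀ f → ∏ (λ e → Θ (z f) e f) M ≡ ∏ (column k (colour Ms f)) (ends f)
    collect f = begin
      ∏ (λ e → ∏ (λ x → ∏ (θ (z f) x) (ends f)) (ends e)) M  ≡⟨ ∏-concatMap (λ x → ∏ (θ (z f) x) (ends f)) ends M ⟨
      ∏ (λ x → ∏ (θ (z f) x) (ends f)) (vertices M)  ≡⟨ ∏-↭ _ (vertices-perfect incrM perf) ⟩
      ∏ (λ x → ∏ (θ (z f) x) (ends f)) (allFin n)  ≡⟨ ∏-swap (θ (z f)) (allFin n) (ends f) ⟩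
      ∏ (column k (colour Ms f)) (ends f)  ∎

  -- Each of the ⌊ n /2⌋ edges of a perfect class of colour k brings one weight β k.
  constant : (ℕ → ℤ) → ℕ → ℤ
  constant β zero    = 1ℤ
  constant β (suc k) = (β k ℤ.^ ℕ.⌊ n /2⌋ * between k) * constant β k

  constant-nonzero : ∀ {β} k → (∀ {c} → c < k → β c ≢ 0ℤ) → constant β k ≢ 0ℤ
  constant-nonzero         zero    β≢0 = λ ()
  constant-nonzero {β = β} (suc k) β≢0 =
    *-≢0 {β k ℤ.^ ℕ.⌊ n /2⌋ * between k} (*-≢0 {β k ℤ.^ ℕ.⌊ n /2⌋} (^-nonzero ℕ.⌊ n /2⌋ (β≢0 (ℕ.n<1+n k))) between≢0)
      (constant-nonzero {β} k (λ c<k → β≢0 (ℕ.m<n⇒m<1+n c<k)))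
    where
    between≢0 : between k ≢ 0ℤ
    between≢0 = ∏-nonzero (λ c → ∏ (column k c) (allFin n)) (downFrom k)
        (λ {c} c∈ → ∏-nonzero (column k c) (allFin n) (λ {y} _ →
      ∏-nonzero (λ x → θ (+ k ℤ.- + c) x y) (allFin n) (λ {x} _ → θ-nonzero x y
        (λ eq → ℕ.<⇒≢ (∈-downFrom⁻ c∈) (sym (ℤ.+-injective (ℤ.i-j≡0⇒i≡j (+ k) (+ c) eq)))))))

  length-perfect : {M : EdgeSet n} → All Increasing M → Perfect M → length M ≡ ℕ.⌊ n /2⌋
  length-perfect {M} incr perf = trans (ℕ.n≡⌊n+n/2⌋ (length M))
    (cong ℕ.⌊_/2⌋ (trans (sym (double M)) (trans (↭-length (vertices-perfect incr perf)) (length-allFin n))))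
    where
    double : ∀ M → length (vertices M) ≡ length M ℕ.+ length M
    double []      = refl
    double (e ∷ M) = trans (cong (suc ∘ suc) (double M)) (cong suc (sym (ℕ.+-suc (length M) (length M))))

  ∏-signed-zero : (Ms : List (EdgeSet n)) → ¬ All Perfect Ms → ∏ signed Ms ≡ 0ℤ
  ∏-signed-zero Ms ¬perfs with find (All.¬All⇒Any¬ perfect? Ms ¬perfs)
  ... | M , M∈ , ¬perf = ∏-zero signed Ms M∈ (⟦⟧-no (perfect? M) (ε M) ¬perf)

  value : (ℕ → ℤ) → List (EdgeSet n) → EdgeSet n → ℤ
  value β Ms E = ∏ (λ e → β (colour Ms e)) E * ∏Pairs (spread (colourℤ Ms)) E

  value-split : ∀ β {k M R E Ms} → Unique E → Interleaving M R E → Parts k R Ms →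
    value β (M ∷ Ms) E ≡ ((∏ (λ _ → β k) M * ∏ (λ e → ∏ (λ f → Θ (+ k ℤ.- + colour Ms f) e f) R) M) * ∏Pairs
        (Θ 0ℤ) M) * value β Ms R
  value-split β {k} {M} {R} {E} {Ms} u i ps = begin
    ∏ (λ e → β (colour (M ∷ Ms) e)) E * ∏Pairs (spread a) E
      ≡⟨ cong₂ _*_ (trans (∏-colour u i {Ms} (λ _ c → β c)) (cong (λ c → ∏ (λ _ → β c) M * B) len))
                     (trans (spread-split a i) (cong₂ _*_ (cong₂ _*_ own others) cross)) ⟩
    (A * B) * ((C * D) * F)  ≡⟨ ring A B C D F ⟩
    ((A * F) * C) * (B * D)  ∎
    where
    a = colourℤ (M ∷ Ms)
    ring : ∀ a b c d f → (a * b) * ((c * d) * f) ≡ ((a * f) * c) * (b * d)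
    ring = ℤ-Solver.solve-∀
    len = Parts-length ps
    A = ∏ (λ _ → β k) M ; B = ∏ (λ e → β (colour Ms e)) R ; C = ∏Pairs (Θ 0ℤ) M ; D = ∏Pairs (spread (colourℤ Ms)) R
    F = ∏ (λ e → ∏ (λ f → Θ (+ k ℤ.- + colour Ms f) e f) R) M
    own : ∏Pairs (spread a) M ≡ C
    own = ∏Pairs-cong∈ M (λ {e} {f} e∈ f∈ → cong (λ z → Θ z e f)
      (ℤ.i≡j⇒i-j≡0 (trans (monochromatic M Ms e∈) (sym (monochromatic M Ms f∈)))))
    others : ∏Pairs (spread a) R ≡ D
    others = spread-cong R (λ e∈ → cong +_ (rest u i {Ms} e∈))
    cross : ∏ (λ e → ∏ (spread a e) R) M ≡ F
    cross = ∏-cong∈ M (λ {e} e∈ → ∏-cong∈ R (λ {f} f∈ → cong₂ (λ x y → Θ (x ℤ.- y) e f)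
      (trans (monochromatic M Ms e∈) (cong +_ len)) (cong +_ (rest u i {Ms} f∈))))

  -- Both sides vanish if some class is not perfect: a class that meets a vertex twice has a clash,
  -- and one that misses a vertex leaves more edges there than colours. Perfect classes split off
  -- one by one.
  value-signed : ∀ β {k E Ms} → Parts k E Ms → Unique E → All Increasing E → (∀ v → degree E v ≡ k) →
                 value β Ms E ≡ constant β k * ∏ signed Ms
  value-signed β [] u incr reg = refl
  value-signed β {suc k} {E} {M ∷ Ms} (_∷_ {R = R} i ps) u incr reg = go (perfect? M) (all? perfect? Ms)
    where
    incrM = proj₁ (Increasing-Interleaving i incr)
    incrR = proj₂ (Increasing-Interleaving i incr)
    a = colourℤ (M ∷ Ms)
    Q = β k ℤ.^ ℕ.⌊ n /2⌋ * between k
    uR = uniqR u i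

    regular : Perfect M → ∀ v → degree R v ≡ k
    regular perf v = ℕ.suc-injective (trans (sym (trans (degree-Interleaving i v)
        (cong (λ d → d ℕ.+ degree R v) (perf v)))) (reg v))

    vanish : ∀ x → ∏Pairs (spread a) E ≡ 0ℤ → x * ∏Pairs (spread a) E ≡ 0ℤ
    vanish x eq = trans (cong (x *_) eq) (ℤ.*-zeroʳ x)

    rhs-zero : ¬ All Perfect (M ∷ Ms) → constant β (suc k) * ∏ signed (M ∷ Ms) ≡ 0ℤ
    rhs-zero ¬perfs = trans (cong (constant β (suc k) *_) (∏-signed-zero (M ∷ Ms) ¬perfs))
        (ℤ.*-zeroʳ (constant β (suc k)))

    imperfect : ∀ {v} → degree M v ≢ 1 → ∏Pairs (spread a) E ≡ 0ℤ
    imperfect {v} deg≢1 with degree M v in deg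
    ... | 0 = spread-zeroʳ a i
      (trans (spread-cong R (λ e∈ → cong +_ (rest u i {Ms} e∈))) (pigeonhole {v = v} ps uR k<R))
      where
      k<R : k < degree R v
      k<R = ℕ.≤-reflexive (trans (sym (reg v)) (trans (degree-Interleaving i v) (cong (λ d → d ℕ.+ degree R v) deg)))
    ... | 1 = contradiction refl deg≢1
    ... | suc (suc d) = spread-zeroˡ a i (clash {a} {v = v} (subst (2 ≤_) (sym deg) (ℕ.s≤s (ℕ.s≤s ℕ.z≤n)))
      (λ e∈ f∈ → trans (monochromatic M Ms e∈) (sym (monochromatic M Ms f∈))))

    go : Dec (Perfect M) → Dec (All Perfect Ms) → value β (M ∷ Ms) E ≡ constant β (suc k) * ∏ signed (M ∷ Ms)
    go (no ¬perf) _ with Fin.¬∀⟶∃¬ n (λ v → degree M v ≡ 1) (λ v → degree M v ℕ.≟ 1) ¬perf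
    ... | v , deg≢1 = trans (vanish (∏ (λ e → β (colour (M ∷ Ms) e)) E) (imperfect {v} deg≢1))
        (sym (rhs-zero (¬perf ∘ All.head)))
    go (yes perf) (no ¬perfs) = trans (value-split β u i ps) (trans
      (cong (P *_) (trans (value-signed β ps uR incrR (regular perf))
          (trans (cong (constant β k *_) (∏-signed-zero Ms ¬perfs)) (ℤ.*-zeroʳ (constant β k)))))
      (trans (ℤ.*-zeroʳ P) (sym (rhs-zero (¬perfs ∘ All.tail)))))
      where
      P = (∏ (λ _ → β k) M * ∏ (λ e → ∏ (λ f → Θ (+ k ℤ.- + colour Ms f) e f) R) M) * ∏Pairs (Θ 0ℤ) M
    go (yes perf) (yes perfs) = begin
      value β (M ∷ Ms) E
        ≡⟨ value-split β u i ps ⟩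
      ((∏ (λ _ → β k) M * ∏ (λ e → ∏ (λ f → Θ (+ k ℤ.- + colour Ms f) e f) R) M) * ∏Pairs (Θ 0ℤ) M) * value β Ms R
        ≡⟨ cong₂ _*_ (cong₂ _*_ (cong₂ _*_ (trans (∏-const (β k) M) (cong (β k ℤ.^_) (length-perfect {M} incrM perf)))
                                                 (∏-between ps uR incrM incrR perf perfs))
                                    (trans (sym (ε-Θ incrM unique)) (sym (⟦⟧-yes (perfect? M) (ε M) perf))))
                       (value-signed β ps uR incrR (regular perf)) ⟩
      (Q * signed M) * (constant β k * ∏ signed Ms)  ≡⟨ *-interchange Q (signed M) (constant β k) (∏ signed Ms) ⟩
      (Q * constant β k) * (signed M * ∏ signed Ms)  ∎
      where
      unique : Unique (vertices M)
      unique = Unique-↭ (↭-sym (vertices-perfect incrM perf)) (Unique.allFin⁺ n)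

-- The coefficient with all exponents equal to the degree minus 1

sum-const : {A : Set} (c : ℕ) (xs : List A) → sum (λ _ → c) xs ≡ length xs ℕ.* c
sum-const c []       = refl
sum-const c (x ∷ xs) = cong (c ℕ.+_) (sum-const c xs)

module _ {n : ℕ} where

  open GraphPolynomial (_≟ₑ_ {suc n})
  open Painting {suc n}
  open Colouring {suc n}
  open Signs {suc n}

  common : Edge (suc n) → Edge (suc n) → ℕ
  common e f = sum (λ x → count x (ends f)) (ends e)

  common-sym : ∀ e f → common e f ≡ common f e
  common-sym e f = trans (sum-swap (λ x y → if does (x Fin.≟ y) then 1 else 0) (ends e) (ends f))
    (sum-cong (ends f) (λ y → sum-cong (ends e) (λ x → flip x y)))
    where
    flip : ∀ x y → (if does (x Fin.≟ y) then 1 else 0) ≡ (if does (y Fin.≟ x) then 1 else 0)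
    flip x y with x Fin.≟ y
    ... | yes refl = cong (if_then 1 else 0) (sym (dec-true (x Fin.≟ x) refl))
    ... | no  x≢y  = cong (if_then 1 else 0) (sym (dec-false (y Fin.≟ x) (x≢y ∘ sym)))

  length-lineGraph : ∀ E → length (lineGraph E) ≡ sumPairs common E
  length-lineGraph E = begin
    length (lineGraph E)  ≡⟨ length-sum (lineGraph E) ⟩
    sum (λ _ → 1) (lineGraph E)  ≡⟨ sum-concatMap (λ _ → 1) links (pairs E) ⟩
    sum (λ p → sum (λ _ → 1) (links p)) (pairs E)  ≡⟨ sum-cong (pairs E) size ⟩
    sumPairs common E  ∎
    where
    size : ∀ p → sum (λ _ → 1) (links p) ≡ common (proj₁ p) (proj₂ p)
    size p = trans (sum-concatMap (λ _ → 1) (linksAt p) (ends (proj₁ p)))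
      (sum-cong (ends (proj₁ p)) (λ x → trans (sum-concatMap (λ _ → 1) (link p x) (ends (proj₂ p)))
          (sum-cong (ends (proj₂ p)) (point x))))
      where
      point : ∀ x y → sum (λ _ → 1) (link p x y) ≡ (if does (x Fin.≟ y) then 1 else 0)
      point x y with does (x Fin.≟ y)
      ... | true  = refl
      ... | false = refl

  module _ {E : EdgeSet (suc n)} {m : ℕ} (u : Unique E) (incr : All Increasing E) (reg : ∀ v → degree E v ≡ suc m) where

    -- Count coincidences of ends over ordered pairs of edges. Each edge has 2 (m + 1) of them, 2
    -- with itself, and the others count every link twice. So the graph polynomial has the same
    -- degree as the product of all x_e^m.
    lineGraph-size : length (lineGraph E) ≡ length E ℕ.* m
    lineGraph-size = half (ℕ.+-cancelˡ-≡ (length E ℕ.* 2) _ _ (trans (sym doubleCount) (arith (length E) m)))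
      where
      half : ∀ {x y} → x ℕ.+ x ≡ y ℕ.+ y → x ≡ y
      half {x} {y} eq = trans (ℕ.n≡⌊n+n/2⌋ x) (trans (cong ℕ.⌊_/2⌋ eq) (sym (ℕ.n≡⌊n+n/2⌋ y)))
      arith : ∀ l m → l ℕ.* (suc m ℕ.+ (suc m ℕ.+ 0)) ≡ l ℕ.* 2 ℕ.+ (l ℕ.* m ℕ.+ l ℕ.* m)
      arith = ℕ-Solver.solve-∀
      self : ∀ {e} → e ∈ E → common e e ≡ 2
      self {e@(a , b)} e∈ = cong₂ ℕ._+_
        (trans (count-ends a (All.lookup incr e∈)) (cong (if_then 1 else 0) (dec-true (a incident? e) (inj₁ refl))))
        (cong (ℕ._+ 0) (trans (count-ends b (All.lookup incr e∈))
            (cong (if_then 1 else 0) (dec-true (b incident? e) (inj₂ refl)))))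
      row : ∀ e → sum (common e) E ≡ suc m ℕ.+ (suc m ℕ.+ 0)
      row e = trans (sum-swap (λ f x → count x (ends f)) E (ends e)) (sum-cong (ends e) (λ x →
        trans (sym (sum-concatMap _ ends E)) (trans (sym (degree-count incr x)) (reg x))))
      doubleCount : length E ℕ.* (suc m ℕ.+ (suc m ℕ.+ 0)) ≡
          length E ℕ.* 2 ℕ.+ (length (lineGraph E) ℕ.+ length (lineGraph E))
      doubleCount = begin
        length E ℕ.* (suc m ℕ.+ (suc m ℕ.+ 0))  ≡⟨ sum-const _ E ⟨
        sum (λ _ → suc m ℕ.+ (suc m ℕ.+ 0)) E  ≡⟨ sum-cong E row ⟨
        sum (λ e → sum (common e) E) E  ≡⟨ sum-square common E ⟩
        sum (λ e → common e e) E ℕ.+ sumPairs (λ e f → common e f ℕ.+ common f e) E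
          ≡⟨ cong₂ ℕ._+_ (trans (sum-cong∈ E self) (sum-const 2 E))
               (trans (sumPairs-+ common (λ e f → common f e) E) (cong₂ ℕ._+_ (sym (length-lineGraph E))
                 (trans (sumPairs-cong∈ E (λ {e} {f} _ _ → common-sym f e)) (sym (length-lineGraph E))))) ⟩
        length E ℕ.* 2 ℕ.+ (length (lineGraph E) ℕ.+ length (lineGraph E))  ∎

    private
      L = lineGraph E
      T = ∏Pairs (Θ 1ℤ) E

      origin : Edge (suc n) → ℕ
      origin _ = 0

      -- The m-th difference at 0 in every variable. In the degree of the graph polynomial it sees
      -- only the monomial with all exponents m.
      w : (Edge (suc n) → ℕ) → ℤ
      w r = ∏ (λ e → differences m (r e)) E

      weights : List (EdgeSet (suc n)) → ℤ
      weights Ms = ∏ (λ e → α m (colour Ms e)) E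

      w-colours : ∀ r → w r ≡ ∑Parts (suc m) (λ Ms → weights Ms * monomial E (colourℤ Ms) r) E
      w-colours r = trans (∏-∑-colours (suc m) (λ e c → α m c * (+ c) ℤ.^ r e) u)
        (∑Parts-cong (suc m) E (λ {Ms} _ → ∏-* (λ e → α m (colour Ms e)) (λ e → colourℤ Ms e ℤ.^ r e) E))

      evaluate : ∀ Ms → T * apply L origin (λ r → weights Ms * monomial E (colourℤ Ms) r) ≡ value (α m) Ms E
      evaluate Ms = begin
        T * apply L origin (λ r → weights Ms * monomial E a r)  ≡⟨ cong (T *_)
            (apply-*ˡ (weights Ms) L origin (monomial E a)) ⟩
        T * (weights Ms * apply L origin (monomial E a))
          ≡⟨ cong (λ z → T * (weights Ms * z)) (trans (apply-monomial a L origin u (lineGraph-Inside E))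
               (trans (cong (_* ∏ (difference a) L) (∏-1 E)) (ℤ.*-identityˡ _))) ⟩
        T * (weights Ms * ∏ (difference a) L)  ≡⟨ *-leftComm T (weights Ms) (∏ (difference a) L) ⟩
        weights Ms * (T * ∏ (difference a) L)  ≡⟨ cong (weights Ms *_) (trans (ℤ.*-comm T _) (∏-lineGraph a E)) ⟩
        value (α m) Ms E  ∎
        where
        a = colourℤ Ms

      apply-w : T * apply L origin w ≡ constant (α m) (suc m) * (factorial (suc m) * signedSum E)
      apply-w = begin
        T * apply L origin w  ≡⟨ cong (T *_) (trans (apply-ext L w-colours)
                                                                                 (apply-∑Parts (suc m) L origin (λ Ms
                                                                                     r → weights Ms * monomial E (colourℤ Ms) r) E)) ⟩
        T * ∑Parts (suc m) (λ Ms → apply L origin (λ r → weights Ms * monomial E (colourℤ Ms) r)) E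
          ≡⟨ ∑Parts-*ˡ (suc m) T (λ Ms → apply L origin (λ r → weights Ms * monomial E (colourℤ Ms) r)) E ⟨
        ∑Parts (suc m) (λ Ms → T * apply L origin (λ r → weights Ms * monomial E (colourℤ Ms) r)) E
          ≡⟨ ∑Parts-cong (suc m) E (λ {Ms} ps → trans (evaluate Ms) (value-signed (α m) ps u incr reg)) ⟩
        ∑Parts (suc m) (λ Ms → constant (α m) (suc m) * ∏ signed Ms) E  ≡⟨ ∑Parts-*ˡ (suc m) (constant (α m) (suc m))
            (∏ signed) E ⟩
        constant (α m) (suc m) * ∑Parts (suc m) (∏ signed) E
          ≡⟨ cong (constant (α m) (suc m) *_) (trans (∑Parts-∏ (suc m) signed E) (ordered≡signedSum (suc m) u reg)) ⟩
        constant (α m) (suc m) * (factorial (suc m) * signedSum E)  ∎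

    coefficient-nonzero : signedSum E ≢ 0ℤ → ∃ λ t → (∀ {e} → e ∈ E → t e < suc m) × apply L origin (δ E t) ≢ 0ℤ
    coefficient-nonzero S≢0 = exponents (apply-coefficient {w = w} u local (lineGraph-Inside E) apply-w≢0)
      where
      local : Local E w
      local agree = ∏-cong∈ E (λ e∈ → cong (differences m) (agree e∈))
      apply-w≢0 : apply L origin w ≢ 0ℤ
      apply-w≢0 eq = *-≢0 {constant (α m) (suc m)} (constant-nonzero {α m} (suc m) (λ c< → α-nonzero (ℕ.≤-pred c<)))
        (*-≢0 {factorial (suc m)} (factorial≢0 (suc m)) S≢0)
        (trans (sym apply-w) (trans (cong (T *_) eq) (ℤ.*-zeroʳ T)))
      exponents : (∃ λ t → w t ≢ 0ℤ × sum t E ≡ sum origin E ℕ.+ length L × apply L origin (δ E t) ≢ 0ℤ) →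
                  ∃ λ t → (∀ {e} → e ∈ E → t e < suc m) × apply L origin (δ E t) ≢ 0ℤ
      exponents (t , wt≢0 , sum≡ , ne) = t , (λ e∈ → ℕ.s≤s (ℕ.≤-reflexive (sym (exact e∈)))) , ne
        where
        -- Every exponent is at least m, and by `lineGraph-size` they sum to `length E` times m.
        exact : ∀ {e} → e ∈ E → m ≡ t e
        exact = sum-≤⇒≡ {f = λ _ → m} {g = t} E
          (λ {e} e∈ → differences-≢0 {m} {t e} (∏-nonzero⁻ (λ e → differences m (t e)) E wt≢0 e∈))
          (trans (sum-const m E) (sym (trans sum≡ (trans (cong (ℕ._+ length L) (sum-0 E)) lineGraph-size))))

    signedSum≢0⇒paintable : signedSum E ≢ 0ℤ → PainterWins E (λ _ → suc m)
    signedSum≢0⇒paintable S≢0 = play (coefficient-nonzero S≢0)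
      where
      play : (∃ λ t → (∀ {e} → e ∈ E → t e < suc m) × apply L origin (δ E t) ≢ 0ℤ) → PainterWins E (λ _ → suc m)
      play (t , t< , ne) = painterWins (sum (λ _ → suc m) E) {t = t} ℕ.≤-refl u (lineGraph-Inside E)
          (lineGraph-Covers E) t< ne

-- List colourings

length-⊆ : {A : Set} {xs ys : List A} → Unique xs → (∀ {x} → x ∈ xs → x ∈ ys) → length xs ≤ length ys
length-⊆ {xs = []}     _ _ = ℕ.z≤n
length-⊆ {xs = x ∷ xs} {ys} u@(_ ∷ u′) inc with ∈-∃++ (inc (here refl))
... | ys₁ , ys₂ , refl = subst (suc (length xs) ≤_) (sym (↭-length (shift x ys₁ ys₂))) (ℕ.s≤s (length-⊆ u′ inc′))
  where
  inc′ : ∀ {y} → y ∈ xs → y ∈ ys₁ ++ ys₂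
  inc′ y∈ with ∈-resp-↭ (shift x ys₁ ys₂) (inc (there y∈))
  ... | here refl = contradiction y∈ (∉-head u)
  ... | there y∈′ = y∈′

Unique-map : {A B : Set} {f : A → B} (xs : List A) → Unique xs → (∀ {x y} → x ∈ xs → y ∈ xs → x ≢ y → f x ≢ f y) →
    Unique (map f xs)
Unique-map []       _             _   = []
Unique-map (x ∷ xs) (x≢ ∷ u)      inj =
  All.map⁺ (All.tabulate (λ y∈ → inj (here refl) (there y∈) (All.lookup x≢ y∈))) ∷
  Unique-map xs u (λ x∈ y∈ → inj (there x∈) (there y∈))

module _ {n : ℕ} where

  open Painting {n}

  matching-nonadjacent : ∀ {P : EdgeSet n} → Matching P → ∀ {e f} → e ∈ P → f ∈ P → ¬ Adjacent e f
  matching-nonadjacent {P} matching {e} {f} e∈ f∈ (e≢f , v , ve , vf) = ℕ.<⇒≱ two (matching v)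
    where
    two : 2 ≤ degree P v
    two = length-⊆ {xs = e ∷ f ∷ []} ((e≢f ∷ []) ∷ [] ∷ [])
      λ { (here refl) → ∈-filter⁺ (v incident?_) e∈ ve ; (there (here refl)) → ∈-filter⁺ (v incident?_) f∈ vf }

  -- Asking that the colours also come from cs keeps later choices different from the colours
  -- already presented.
  Colourable : EdgeSet n → (Edge n → List ℕ) → List ℕ → Set
  Colourable U L cs = ∃ λ (c : Edge n → ℕ) →
    (∀ {e} → e ∈ U → c e ∈ L e × c e ∈ cs) × (∀ {e f} → e ∈ U → f ∈ U → Adjacent e f → c e ≢ c f)

  -- Lister presents the colours one at a time.
  colour-online : ∀ (L : Edge n → List ℕ) cs {U t} → Unique cs → PainterWins U t →
                  (∀ {e} → e ∈ U → t e ≤ length (filter (_∈ℕ? L e) cs)) → Colourable U L cs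
  colour-online L [] {U} _ (wins positive _) enough =
    (λ _ → 0) , (λ e∈ → impossible e∈) , (λ e∈ → contradiction (ℕ.<-≤-trans (All.lookup positive e∈) (enough e∈)) ℕ.n≮0)
    where
    impossible : ∀ {e} → e ∈ U → 0 ∈ L e × 0 ∈ []
    impossible e∈ = contradiction (ℕ.<-≤-trans (All.lookup positive e∈) (enough e∈)) ℕ.n≮0
  colour-online L (c ∷ cs) {U} {t} u@(_ ∷ u′) w@(wins positive respond) enough =
    play (filter (λ e → c ∈ℕ? L e) U) refl
    where
    missing : ∀ {e} → c ∉ L e → e ∈ U → t e ≤ length (filter (_∈ℕ? L e) cs)
    missing {e} c∉ e∈ = subst (t e ≤_) (cong length (filter-reject (_∈ℕ? L e) c∉)) (enough e∈)

    offered : ∀ {e} → c ∈ L e → e ∈ U → t e ∸ 1 ≤ length (filter (_∈ℕ? L e) cs)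
    offered {e} c∈ e∈ = ℕ.∸-monoˡ-≤ 1 (subst (t e ≤_) (cong length (filter-accept (_∈ℕ? L e) c∈)) (enough e∈))

    play : ∀ X → filter (λ e → c ∈ℕ? L e) U ≡ X → Colourable U L (c ∷ cs)
    -- Lister may not mark the empty set, so a colour on no list is passed over without a round.
    play [] X≡ with colour-online L cs u′ w (λ {e} e∈ →
        missing {e} (λ c∈ → none (∈-filter⁺ (λ e → c ∈ℕ? L e) e∈ c∈)) e∈)
      where
      none : ∀ {e} → e ∉ filter (λ e → c ∈ℕ? L e) U
      none {e} e∈ with subst (e ∈_) X≡ e∈
      ... | ()
    ... | col , valid , proper = col , (λ e∈ → proj₁ (valid e∈) , there (proj₂ (valid e∈))) , proper
    play X@(_ ∷ _) X≡ = extend (respond X X⊆U (ℕ.s≤s ℕ.z≤n))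
      where
      X⊆U : X ⊆ U
      X⊆U = subst (_⊆ U) X≡ (Sublist.filter-⊆ (λ e → c ∈ℕ? L e) U)
      ∈X⁻ : ∀ {e} → e ∈ X → c ∈ L e
      ∈X⁻ {e} e∈ = proj₂ (∈-filter⁻ (λ e → c ∈ℕ? L e) {xs = U} (subst (e ∈_) (sym X≡) e∈))
      ∈X⁺ : ∀ {e} → e ∈ U → c ∈ L e → e ∈ X
      ∈X⁺ {e} e∈ c∈ = subst (e ∈_) X≡ (∈-filter⁺ (λ e → c ∈ℕ? L e) e∈ c∈)

      extend : (∃ λ P → P ⊆ X × Matching P × PainterWins (U ∖ P) (spend X t)) → Colourable U L (c ∷ cs)
      extend (P , P⊆X , matching , w′) = combine (colour-online L cs u′ w′ enough′)
        where
        enough′ : ∀ {e} → e ∈ U ∖ P → spend X t e ≤ length (filter (_∈ℕ? L e) cs)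
        enough′ {e} e∈ with proj₁ (∉-∖ U e∈) | c ∈ℕ? L e
        ... | e∈U | yes c∈ = subst (_≤ _) (sym (spend-∈ X t (∈X⁺ e∈U c∈))) (offered c∈ e∈U)
        ... | e∈U | no  c∉ = subst (_≤ _) (sym (spend-∉ X t (c∉ ∘ ∈X⁻))) (missing c∉ e∈U)

        combine : Colourable (U ∖ P) L cs → Colourable U L (c ∷ cs)
        combine (col , valid , proper) = col′ , valid′ , proper′
          where
          col′ : Edge n → ℕ
          col′ e = if does (e ∈? P) then c else col e
          col-∈ : ∀ {e} → e ∈ P → col′ e ≡ c
          col-∈ {e} e∈ = cong (if_then c else col e) (dec-true (e ∈? P) e∈)
          col-∉ : ∀ {e} → e ∉ P → col′ e ≡ col e
          col-∉ {e} e∉ = cong (if_then c else col e) (dec-false (e ∈? P) e∉)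
          later : ∀ {e} → e ∈ U → e ∉ P → col e ≢ c
          later e∈ e∉ eq = ∉-head u (subst (_∈ cs) eq (proj₂ (valid (∈-∖ e∈ e∉))))
          valid′ : ∀ {e} → e ∈ U → col′ e ∈ L e × col′ e ∈ c ∷ cs
          valid′ {e} e∈ = go (e ∈? P)
            where
            go : Dec (e ∈ P) → col′ e ∈ L e × col′ e ∈ c ∷ cs
            go (yes e∈P) = subst (_∈ L e) (sym (col-∈ e∈P)) (∈X⁻ (⊆-∈ P⊆X e∈P)) , here (col-∈ e∈P)
            go (no  e∉P) = let c∈L , c∈cs = valid (∈-∖ e∈ e∉P) in
              subst (_∈ L e) (sym (col-∉ e∉P)) c∈L , there (subst (_∈ cs) (sym (col-∉ e∉P)) c∈cs)
          proper′ : ∀ {e f} → e ∈ U → f ∈ U → Adjacent e f → col′ e ≢ col′ f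
          proper′ {e} {f} e∈ f∈ adj = go (e ∈? P) (f ∈? P)
            where
            go : Dec (e ∈ P) → Dec (f ∈ P) → col′ e ≢ col′ f
            go (yes e∈P) (yes f∈P) _  = matching-nonadjacent matching e∈P f∈P adj
            go (yes e∈P) (no  f∉P) eq = later f∈ f∉P (trans (sym (col-∉ f∉P)) (trans (sym eq) (col-∈ e∈P)))
            go (no  e∉P) (yes f∈P) eq = later e∈ e∉P (trans (sym (col-∉ e∉P)) (trans eq (col-∈ f∈P)))
            go (no  e∉P) (no  f∉P) eq = proper (∈-∖ e∈ e∉P) (∈-∖ f∈ f∉P) adj
                (trans (sym (col-∉ e∉P)) (trans eq (col-∉ f∉P)))

  paintable⇒choosable : ∀ (G : Graph n) k → EdgePaintable G k → EdgeChoosable G k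
  paintable⇒choosable G k w L lists with colour-online L (upTo N) (Unique.upTo⁺ N) w enough
    where
    -- Exceeds every colour on every list, so presenting all colours below N exhausts each list.
    N = suc (sum (λ e → sum id (L e)) (edges G))
    enough : ∀ {e} → e ∈ edges G → k ≤ length (filter (_∈ℕ? L e) (upTo N))
    enough {e} e∈ = subst (_≤ _) (proj₂ (lists e∈)) (length-⊆ (proj₁ (lists e∈)) λ {c} c∈ →
      ∈-filter⁺ (_∈ℕ? L e) (∈-upTo⁺ (ℕ.s≤s (ℕ.≤-trans (∈⇒≤sum id (L e) c∈)
          (∈⇒≤sum (λ e → sum id (L e)) (edges G) e∈)))) c∈)
  ... | c , valid , proper = c , (λ e∈ → proj₁ (valid e∈)) , proper

  -- With equal lists of k colours everywhere, the edges at v need pairwise different ones.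
  choosable⇒degree≤ : ∀ (G : Graph n) k v → Unique (edges G) → EdgeChoosable G k → degree (edges G) v ≤ k
  choosable⇒degree≤ G k v u choose with choose (λ _ → upTo k) (λ _ → Unique.upTo⁺ k , length-upTo k)
  ... | c , valid , proper = subst₂ _≤_ (length-map c Eᵥ) (length-upTo k)
    (length-⊆ (Unique-map Eᵥ (Unique.filter⁺ (v incident?_) u) distinct) inside)
    where
    Eᵥ = filter (v incident?_) (edges G)
    at-v : ∀ {e} → e ∈ Eᵥ → e ∈ edges G × v incident e
    at-v = ∈-filter⁻ (v incident?_) {xs = edges G}
    distinct : ∀ {e f} → e ∈ Eᵥ → f ∈ Eᵥ → e ≢ f → c e ≢ c f
    distinct e∈ f∈ e≢f = proper (proj₁ (at-v e∈)) (proj₁ (at-v f∈)) (e≢f , v , proj₂ (at-v e∈) , proj₂ (at-v f∈))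
    inside : ∀ {j} → j ∈ map c Eᵥ → j ∈ upTo k
    inside j∈ with ∈-map⁻ c j∈
    ... | e , e∈ , refl = valid (proj₁ (at-v e∈))

-- Edge lists of graphs

filter-filter : {A : Set} {P Q R : Pred A 0ℓ} (P? : Decidable P) (Q? : Decidable Q) (R? : Decidable R) (xs : List A) →
                (∀ {x} → R x → P x × Q x) → (∀ {x} → P x → Q x → R x) → filter R? xs ≡ filter Q? (filter P? xs)
filter-filter P? Q? R? []       to from = refl
filter-filter P? Q? R? (x ∷ xs) to from with P? x
... | no ¬px = trans (filter-reject R? (¬px ∘ proj₁ ∘ to)) (filter-filter P? Q? R? xs to from)
... | yes px with Q? x
...   | yes qx = trans (filter-accept R? (from px qx)) (cong (x ∷_) (filter-filter P? Q? R? xs to from))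
...   | no ¬qx = trans (filter-reject R? (¬qx ∘ proj₂ ∘ to)) (filter-filter P? Q? R? xs to from)

module _ {n : ℕ} where

  edges-Unique : (G : Graph n) → Unique (edges G)
  edges-Unique G = Unique.filter⁺ _ (Unique.cartesianProduct⁺ (Unique.allFin⁺ n) (Unique.allFin⁺ n))

  edges-∈⁻ : (G : Graph n) {a b : Fin n} → (a , b) ∈ edges G → a Fin.< b × Graph.Adj G a b
  edges-∈⁻ G e∈ = proj₂ (∈-filter⁻ _ {xs = cartesianProduct (allFin n) (allFin n)} e∈)

  edges-∈⁺ : (G : Graph n) {a b : Fin n} → a Fin.< b → Graph.Adj G a b → (a , b) ∈ edges G
  edges-∈⁺ G {a} {b} a<b adj = ∈-filter⁺ _ (∈-cartesianProduct⁺ (∈-allFin a) (∈-allFin b)) (a<b , adj)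

  edges-Increasing : (G : Graph n) → All Increasing (edges G)
  edges-Increasing G = All.tabulate (λ e∈ → proj₁ (edges-∈⁻ G e∈))

  edges-─ : (G : Graph n) {M : EdgeSet n} → M ⊆ edges G → edges (G ─ M) ≡ edges G ∖ M
  edges-─ G {M} M⊆ = filter-filter _ (λ e → ¬? (e ∈? M)) _ (cartesianProduct (allFin n) (allFin n))
    (λ (a<b , adj , e∉ , _) → (a<b , adj) , e∉)
    (λ (a<b , adj) e∉ → a<b , adj , e∉ , λ e′∈ → Fin.<-asym a<b (proj₁ (edges-∈⁻ G (⊆-∈ M⊆ e′∈))))

  -- `pairs` recurses on the vertex list, which allows induction on vertices for degrees and
  -- matchings. The two lists agree even in order because `allFin n` is sorted.
  edges-K : edges (K n) ≡ pairs (allFin n)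
  edges-K = rows (allFin n) (allFin-sorted n)
    where
    P? : (e : Edge n) → Dec (proj₁ e Fin.< proj₂ e × proj₁ e ≢ proj₂ e)
    P? e = (proj₁ e Fin.<? proj₂ e) ×-dec ¬? (proj₁ e Fin.≟ proj₂ e)
    allFin-sorted : ∀ n → AllPairs Fin._<_ (allFin n)
    allFin-sorted n = tabulate⁺-< (λ i<j → i<j)
    smaller : ∀ z xs ys → All (z Fin.<_) xs → filter P? (cartesianProduct xs (z ∷ ys)) ≡
        filter P? (cartesianProduct xs ys)
    smaller z []       ys _             = refl
    smaller z (x ∷ xs) ys (z<x ∷ z<xs) = trans (filter-reject P? (λ (x<z , _) → Fin.<-asym x<z z<x))
      (trans (filter-++ P? (map (x ,_) ys) _) (trans (cong (filter P? (map (x ,_) ys) ++_) (smaller z xs ys z<xs))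
        (sym (filter-++ P? (map (x ,_) ys) _))))
    rows : ∀ xs → AllPairs Fin._<_ xs → filter P? (cartesianProduct xs xs) ≡ pairs xs
    rows []       _             = refl
    rows (x ∷ xs) (x<xs ∷ sorted) = trans (filter-reject P? (λ (x<x , _) → Fin.<-irrefl {x = x} refl x<x))
      (trans (filter-++ P? (map (x ,_) xs) _) (cong₂ _++_
          (filter-all P? (All.map⁺ (All.map (λ x<y → x<y , Fin.<⇒≢ x<y) x<xs)))
        (trans (smaller x xs xs x<xs) (rows xs sorted))))

-- Relabelling the vertices

infix 4 _²≡1
_²≡1 : ℤ → Set
z ²≡1 = z * z ≡ 1ℤ

*-²≡1 : ∀ {x y} → x ²≡1 → y ²≡1 → x * y ²≡1
*-²≡1 {x} {y} x² y² = trans (*-interchange x y x y) (cong₂ _*_ x² y²)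

∏-²≡1 : {A : Set} (f : A → ℤ) (xs : List A) → (∀ {x} → x ∈ xs → f x ²≡1) → ∏ f xs ²≡1
∏-²≡1 f []       _  = refl
∏-²≡1 f (x ∷ xs) sq = *-²≡1 {f x} {∏ f xs} (sq (here refl)) (∏-²≡1 f xs (sq ∘ there))

-1^-²≡1 : ∀ k → -1ℤ ℤ.^ k ²≡1
-1^-²≡1 zero    = refl
-1^-²≡1 (suc k) = *-²≡1 { -1ℤ} { -1ℤ ℤ.^ k} refl (-1^-²≡1 k)

ε-²≡1 : ∀ {n} (M : EdgeSet n) → ε M ²≡1
ε-²≡1 M = -1^-²≡1 (cr M)

∏Pairs-map : {A B : Set} (f : B → B → ℤ) (g : A → B) (xs : List A) → ∏Pairs f (map g xs) ≡
    ∏Pairs (λ x y → f (g x) (g y)) xs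
∏Pairs-map f g []       = refl
∏Pairs-map f g (x ∷ xs) = trans (∏Pairs-∷ f (g x) (map g xs))
  (trans (cong₂ _*_ (∏-map (f (g x)) g xs) (∏Pairs-map f g xs)) (sym (∏Pairs-∷ (λ x y → f (g x) (g y)) x xs)))

↭-cancelˡ : {A : Set} (xs : List A) {ys zs : List A} → xs ++ ys ↭ xs ++ zs → ys ↭ zs
↭-cancelˡ []       p = p
↭-cancelˡ (x ∷ xs) p = ↭-cancelˡ xs (drop-∷ p)

Unique⇒↭ : {A : Set} → DecidableEquality A → {xs ys : List A} → Unique xs → Unique ys →
           (∀ {x} → x ∈ xs → x ∈ ys) → (∀ {x} → x ∈ ys → x ∈ xs) → xs ↭ ys
Unique⇒↭ _≟_ {xs} {ys} uxs uys to from = count⇒↭′ xs ys same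
  where
  open Count _≟_ renaming (count⇒↭ to count⇒↭′; count to count′; count-Unique to count-Unique′; count-∉ to count-∉′;
      count-∈ to count-∈′)
  same : ∀ x → count′ x xs ≡ count′ x ys
  same x with 0 ℕ.<? count′ x xs
  ... | yes 0< = trans (count-Unique′ uxs (count-∈′ xs 0<)) (sym (count-Unique′ uys (to (count-∈′ xs 0<))))
  ... | no  0≮ = trans (ℕ.n≤0⇒n≡0 (ℕ.≮⇒≥ 0≮)) (sym (count-∉′ ys
      (λ x∈ → 0≮ (subst (0 <_) (sym (count-Unique′ uxs (from x∈))) (ℕ.s≤s ℕ.z≤n)))))

ordered-↭ : {A : Set} → ∀ k (φ : List A → ℤ) → (∀ {M M′} → M ↭ M′ → φ M ≡ φ M′) → ∀ {E E′} → E ↭ E′ → ordered k φ E ≡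
    ordered k φ E′
ordered-↭ zero φ φ-↭ {[]}    {[]}    p = refl
ordered-↭ zero φ φ-↭ {_ ∷ _} {_ ∷ _} p = refl
ordered-↭ zero φ φ-↭ {[]}    {_ ∷ _} p with ↭-length p
... | ()
ordered-↭ zero φ φ-↭ {_ ∷ _} {[]}    p with ↭-length p
... | ()
ordered-↭ (suc k) φ φ-↭ p = ∑Splits-↭ _ (λ q r → cong₂ _*_ (φ-↭ q) (ordered-↭ k φ φ-↭ r)) p

ε-↭ : ∀ {n} {M M′ : EdgeSet n} → M ↭ M′ → ε M ≡ ε M′
ε-↭ {M = M} {M′} p = trans (ε-square M) (trans (∏-↭ _ p)
    (trans (∏-cong M′ (λ e → ∏-↭ (crossSign e) p)) (sym (ε-square M′))))

signed-↭ : ∀ {n} {M M′ : EdgeSet n} → M ↭ M′ → signed M ≡ signed M′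
signed-↭ {M = M} {M′} p = ⟦⟧-⇔ (perfect? M) (perfect? M′) (Perfect-↭ p) (Perfect-↭ (↭-sym p)) (λ _ → ε-↭ p)

-- A record and not a bare function type, so that both maps can be inferred from a proof.
record Undoes {A : Set} (g f : A → A) : Set where
  constructor mk
  field undo : ∀ x → g (f x) ≡ x

open Undoes

module Relabelling {n : ℕ} (π ρ : Fin n → Fin n) (ρπ : Undoes ρ π) (πρ : Undoes π ρ) where

  open Colouring {n} using (∏-split)

  injective : ∀ {f g : Fin n → Fin n} → Undoes g f → ∀ {x y} → f x ≡ f y → x ≡ y
  injective {g = g} gf {x} {y} eq = trans (sym (undo gf x)) (trans (cong g eq) (undo gf y))

  sort : Fin n → Fin n → Edge n
  sort x y = if does (x Fin.<? y) then (x , y) else (y , x)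

  sort-< : ∀ {x y} → x Fin.< y → sort x y ≡ (x , y)
  sort-< {x} {y} x<y = cong (if_then (x , y) else (y , x)) (dec-true (x Fin.<? y) x<y)

  sort-> : ∀ {x y} → y Fin.< x → sort x y ≡ (y , x)
  sort-> {x} {y} y<x = cong (if_then (x , y) else (y , x)) (dec-false (x Fin.<? y) (Fin.<-asym y<x))

  act : (Fin n → Fin n) → Edge n → Edge n
  act f (a , b) = sort (f a) (f b)

  act-Increasing : ∀ {f g} → Undoes g f → ∀ {e} → Increasing e → Increasing (act f e)
  act-Increasing {f} gf {a , b} a<b with Fin.<-cmp (f a) (f b)
  ... | tri< lt _ _ = subst Increasing (sym (sort-< lt)) lt
  ... | tri≈ _ eq _ = contradiction (injective gf eq) (Fin.<⇒≢ a<b)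
  ... | tri> _ _ gt = subst Increasing (sym (sort-> gt)) gt

  act-inverse : ∀ {f g} → Undoes g f → ∀ {e} → Increasing e → act g (act f e) ≡ e
  act-inverse {f} {g} gf {a , b} a<b with Fin.<-cmp (f a) (f b)
  ... | tri< lt _ _ = trans (cong (act g) (sort-< lt)) (trans (cong₂ sort (undo gf a) (undo gf b)) (sort-< a<b))
  ... | tri≈ _ eq _ = contradiction (injective gf eq) (Fin.<⇒≢ a<b)
  ... | tri> _ _ gt = trans (cong (act g) (sort-> gt)) (trans (cong₂ sort (undo gf b) (undo gf a)) (sort-> a<b))

  ends-act : ∀ f e → ends (act f e) ↭ map f (ends e)
  ends-act f (a , b) with does (f a Fin.<? f b)
  ... | true  = Perm.refl
  ... | false = swap (f b) (f a) Perm.refl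

  vertices-act : ∀ f M → vertices (map (act f) M) ↭ map f (vertices M)
  vertices-act f []      = Perm.refl
  vertices-act f (e ∷ M) = ↭-trans (++⁺ (ends-act f e) (vertices-act f M))
      (Perm.↭-reflexive (sym (map-++ f (ends e) (vertices M))))

  map-allFin : ∀ {f g} → Undoes g f → Undoes f g → map f (allFin n) ↭ allFin n
  map-allFin {f} {g} gf fg = Unique⇒↭ Fin._≟_ (Unique.map⁺ (injective gf) (Unique.allFin⁺ n)) (Unique.allFin⁺ n)
      (λ {x} _ → ∈-allFin x)
    (λ {x} _ → subst (_∈ map f (allFin n)) (undo fg x) (∈-map⁺ f (∈-allFin (g x))))

  act-All : ∀ {f g} → Undoes g f → ∀ {M} → All Increasing M → All Increasing (map (act f) M)
  act-All gf incr = All.map⁺ (All.map (act-Increasing gf) incr)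

  perfect-vertices : ∀ {M} → All Increasing M → vertices M ↭ allFin n → Perfect M
  perfect-vertices incr p v = trans (degree-count incr v)
      (trans (sum-↭ _ p) (count-Unique (Unique.allFin⁺ n) (∈-allFin v)))

  act-Perfect : ∀ {f g} → Undoes g f → Undoes f g → ∀ {M} → All Increasing M → Perfect M → Perfect (map (act f) M)
  act-Perfect {f} gf fg {M} incr perf = perfect-vertices (act-All gf incr)
    (↭-trans (vertices-act f M) (↭-trans (map⁺ f (vertices-perfect incr perf)) (map-allFin gf fg)))

  act-Perfect⁻ : ∀ {M} → All Increasing M → Perfect (map (act π) M) → Perfect M
  act-Perfect⁻ {M} incr perf = subst Perfect restore (act-Perfect {ρ} {π} πρ ρπ (act-All ρπ incr) perf)
    where
    restore : map (act ρ) (map (act π) M) ≡ M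
    restore = trans (sym (map-∘ M)) (map-id-local (All.map (act-inverse ρπ) incr))

  g : Fin n → Fin n → ℤ
  g x y = θ 0ℤ x y * θ 0ℤ (π x) (π y)

  g-sym : ∀ x y → g x y ≡ g y x
  g-sym x y = sym (trans (cong₂ _*_ (θ-antisym 0ℤ x y) (θ-antisym 0ℤ (π x) (π y)))
      (neg*neg (θ 0ℤ x y) (θ 0ℤ (π x) (π y))))
    where
    neg*neg : ∀ p q → (ℤ.- p) * (ℤ.- q) ≡ p * q
    neg*neg = ℤ-Solver.solve-∀

  θ-²≡1 : ∀ {x y : Fin n} → x ≢ y → θ 0ℤ x y ²≡1
  θ-²≡1 {x} {y} x≢y = subst _²≡1 (sym (θ-≢ 0ℤ x≢y)) (square (does (y Fin.<? x)))
    where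
    square : ∀ b → (if b then -1ℤ else 1ℤ) ²≡1
    square true  = refl
    square false = refl

  gₑ : Edge n → ℤ
  gₑ (x , y) = g x y

  gₑ-²≡1 : ∀ {e} → Increasing e → gₑ e ²≡1
  gₑ-²≡1 {a , b} a<b = *-²≡1 {θ 0ℤ a b} {θ 0ℤ (π a) (π b)} (θ-²≡1 (Fin.<⇒≢ a<b)) (θ-²≡1 (Fin.<⇒≢ a<b ∘ injective ρπ))

  G : ℤ
  G = ∏Pairs g (allFin n)

  ∏Pairs-vertices : ∀ M → ∏Pairs g (vertices M) ≡ ∏ gₑ M * ∏Pairs (λ e f → ∏ (λ x → ∏ (g x) (ends f)) (ends e)) M
  ∏Pairs-vertices []      = refl
  ∏Pairs-vertices (e@(a , b) ∷ M) = begin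
    ∏Pairs g (ends e ++ vertices M)  ≡⟨ ∏Pairs-++ g (ends e) (vertices M) ⟩
    (∏Pairs g (ends e) * ∏Pairs g (vertices M)) * ∏ (λ x → ∏ (g x) (vertices M)) (ends e)
      ≡⟨ cong₂ _*_ (cong₂ _*_ (ℤ.*-identityʳ (g a b)) (∏Pairs-vertices M)) cross ⟩
    (g a b * (A * B)) * C  ≡⟨ ring (g a b) A B C ⟩
    (g a b * A) * (C * B)  ≡⟨ cong ((g a b * A) *_) (sym (∏Pairs-∷ _ e M)) ⟩
    ∏ gₑ (e ∷ M) * ∏Pairs (λ e f → ∏ (λ x → ∏ (g x) (ends f)) (ends e)) (e ∷ M) ∎
    where
    ring : ∀ z a b c → (z * (a * b)) * c ≡ (z * a) * (c * b)
    ring = ℤ-Solver.solve-∀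
    A = ∏ gₑ M ; B = ∏Pairs (λ e f → ∏ (λ x → ∏ (g x) (ends f)) (ends e)) M
    C = ∏ (λ f → ∏ (λ x → ∏ (g x) (ends f)) (ends e)) M
    cross : ∏ (λ x → ∏ (g x) (vertices M)) (ends e) ≡ C
    cross = trans (∏-cong (ends e) (λ x → ∏-concatMap (g x) ends M)) (∏-swap (λ x f → ∏ (g x) (ends f)) (ends e) M)

  Unique-vertices : ∀ {M} → All Increasing M → Perfect M → Unique (vertices M)
  Unique-vertices incr perf = Unique-↭ (↭-sym (vertices-perfect incr perf)) (Unique.allFin⁺ n)

  -- Every pair of distinct vertices is either an edge of M or lies between
  -- two edges of M.
  G-perfect : ∀ {M} → All Increasing M → Perfect M → G ≡ ∏ gₑ M * (ε M * ε (map (act π) M))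
  G-perfect {M} incr perf = begin
    ∏Pairs g (allFin n)  ≡⟨ ∏Pairs-↭ g g-sym (vertices-perfect incr perf) ⟨
    ∏Pairs g (vertices M)  ≡⟨ ∏Pairs-vertices M ⟩
    ∏ gₑ M * ∏Pairs (λ e f → ∏ (λ x → ∏ (g x) (ends f)) (ends e)) M  ≡⟨ cong (∏ gₑ M *_)
        (∏Pairs-cong∈ M (λ {e} {f} _ _ → pair e f)) ⟩
    ∏ gₑ M * ∏Pairs (λ e f → Θ 0ℤ e f * Θ 0ℤ (act π e) (act π f)) M
      ≡⟨ cong (∏ gₑ M *_) (trans (∏Pairs-* (Θ 0ℤ) (λ e f → Θ 0ℤ (act π e) (act π f)) M)
           (cong₂ _*_ (sym (ε-Θ incr (Unique-vertices incr perf)))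
             (trans (sym (∏Pairs-map (Θ 0ℤ) (act π) M))
                    (sym (ε-Θ (act-All ρπ incr) (Unique-vertices (act-All ρπ incr) (act-Perfect ρπ πρ incr perf))))))) ⟩
    ∏ gₑ M * (ε M * ε (map (act π) M))  ∎
    where
    pair : ∀ e f → ∏ (λ x → ∏ (g x) (ends f)) (ends e) ≡ Θ 0ℤ e f * Θ 0ℤ (act π e) (act π f)
    pair e f = begin
      ∏ (λ x → ∏ (g x) (ends f)) (ends e)
        ≡⟨ ∏-cong (ends e) (λ x → ∏-* (θ 0ℤ x) (λ y → θ 0ℤ (π x) (π y)) (ends f)) ⟩
      ∏ (λ x → ∏ (θ 0ℤ x) (ends f) * ∏ (λ y → θ 0ℤ (π x) (π y)) (ends f)) (ends e)
        ≡⟨ ∏-* (λ x → ∏ (θ 0ℤ x) (ends f)) (λ x → ∏ (λ y → θ 0ℤ (π x) (π y)) (ends f)) (ends e) ⟩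
      Θ 0ℤ e f * ∏ (λ x → ∏ (λ y → θ 0ℤ (π x) (π y)) (ends f)) (ends e)
        ≡⟨ cong (Θ 0ℤ e f *_) (trans (∏-cong (ends e)
            (λ x → trans (sym (∏-map (θ 0ℤ (π x)) π (ends f))) (sym (∏-↭ (θ 0ℤ (π x)) (ends-act π f)))))
             (trans (sym (∏-map (λ x → ∏ (θ 0ℤ x) (ends (act π f))) π (ends e)))
                 (sym (∏-↭ (λ x → ∏ (θ 0ℤ x) (ends (act π f))) (ends-act π e))))) ⟩
      Θ 0ℤ e f * Θ 0ℤ (act π e) (act π f) ∎

  -- `G-perfect` solved for the new sign; the sign of M and the product of its `gₑ` are their own
  -- inverses.
  ε-act : ∀ {M} → All Increasing M → Perfect M → ε (map (act π) M) ≡ (G * ∏ gₑ M) * ε M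
  ε-act {M} incr perf = sym (begin
    (G * a) * x  ≡⟨ cong (λ z → (z * a) * x) (G-perfect incr perf) ⟩
    ((a * (x * y)) * a) * x  ≡⟨ ring a x y ⟩
    ((a * a) * (x * x)) * y  ≡⟨ cong (_* y) (cong₂ _*_ a² (ε-²≡1 M)) ⟩
    1ℤ * y  ≡⟨ ℤ.*-identityˡ y ⟩
    y  ∎)
    where
    a = ∏ gₑ M ; x = ε M ; y = ε (map (act π) M)
    ring : ∀ a x y → ((a * (x * y)) * a) * x ≡ ((a * a) * (x * x)) * y
    ring = ℤ-Solver.solve-∀
    a² = ∏-²≡1 gₑ M (λ {e} e∈ → gₑ-²≡1 {e} (All.lookup incr e∈))

  signed-act : ∀ {M} → All Increasing M → signed (map (act π) M) ≡ (G * ∏ gₑ M) * signed M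
  signed-act {M} incr = trans
    (⟦⟧-⇔ (perfect? (map (act π) M)) (perfect? M) (act-Perfect⁻ incr) (act-Perfect ρπ πρ incr)
        (λ perf → ε-act incr (act-Perfect⁻ incr perf)))
    (sym (⟦⟧-*ˡ (perfect? M) (G * ∏ gₑ M) (ε M)))

  -- Each of the k classes contributes G and the `gₑ` of its own edges, and the latter multiply to
  -- one product over E, whatever the partition.
  ordered-act : ∀ k {E} → All Increasing E → ordered k signed (map (act π) E) ≡ (G ℤ.^ k * ∏ gₑ E) * ordered k signed E
  ordered-act zero    {[]}    _ = refl
  ordered-act zero    {e ∷ E} _ = sym (ℤ.*-zeroʳ (1ℤ * ∏ gₑ (e ∷ E)))
  ordered-act (suc k) {E} incr = begin
    ordered (suc k) signed (map (act π) E)  ≡⟨ ∑Splits-map (act π) _ E ⟩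
    ∑Splits (λ M R → signed (map (act π) M) * ordered k signed (map (act π) R)) E  ≡⟨ ∑Splits-cong E step ⟩
    ∑Splits (λ M R → (G ℤ.^ suc k * ∏ gₑ E) * (signed M * ordered k signed R)) E
      ≡⟨ ∑Splits-*ˡ (G ℤ.^ suc k * ∏ gₑ E) _ E ⟩
    (G ℤ.^ suc k * ∏ gₑ E) * ordered (suc k) signed E  ∎
    where
    step : ∀ {M R} → Interleaving M R E → signed (map (act π) M) * ordered k signed (map (act π) R) ≡
           (G ℤ.^ suc k * ∏ gₑ E) * (signed M * ordered k signed R)
    step {M} {R} i = begin
      signed (map (act π) M) * ordered k signed (map (act π) R)
        ≡⟨ cong₂ _*_ (signed-act (Sublist.All-resp-⊆ (Interleaving⇒⊆ i) incr))
                       (ordered-act k (Sublist.All-resp-⊆ (Interleaving⇒⊆ (Interleaving.swap i)) incr)) ⟩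
      ((G * ∏ gₑ M) * s) * ((G ℤ.^ k * ∏ gₑ R) * o)  ≡⟨ *-interchange (G * ∏ gₑ M) s (G ℤ.^ k * ∏ gₑ R) o ⟩
      ((G * ∏ gₑ M) * (G ℤ.^ k * ∏ gₑ R)) * (s * o)  ≡⟨ cong (_* (s * o))
          (trans (*-interchange G (∏ gₑ M) (G ℤ.^ k) (∏ gₑ R))
                                                                       (cong (G ℤ.^ suc k *_) (sym (∏-split gₑ i)))) ⟩
      (G ℤ.^ suc k * ∏ gₑ E) * (s * o)  ∎
      where
      s = signed M ; o = ordered k signed R

  G-²≡1 : G ²≡1
  G-²≡1 = ∏-²≡1 gₑ (pairs (allFin n)) (λ {e} e∈ → gₑ-²≡1 {e} (proj₁ (edges-∈⁻ (K n) (subst (e ∈_) (sym edges-K) e∈))))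

-- Independence of the perfect matching removed from the complete graph

assign : {A B : Set} → DecidableEquality A → B → List A → List B → A → B
assign _≟_ d (x ∷ xs) (y ∷ ys) z = if does (z ≟ x) then y else assign _≟_ d xs ys z
assign _≟_ d _        _        z = d

map-assign : {A B : Set} (_≟_ : DecidableEquality A) (d : B) (xs : List A) (ys : List B) → Unique xs → length xs ≡
    length ys →
             map (assign _≟_ d xs ys) xs ≡ ys
map-assign _≟_ d []       []       _ _  = refl
map-assign _≟_ d (x ∷ xs) (y ∷ ys) u@(x≢ ∷ u′) eq = cong₂ _∷_
    (cong (if_then y else assign _≟_ d xs ys x) (dec-true (x ≟ x) refl))
  (trans (map-cong-local (All.map (λ {z} x≢z → cong (if_then y else assign _≟_ d xs ys z)
      (dec-false (z ≟ x) (x≢z ∘ sym))) x≢))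
         (map-assign _≟_ d xs ys u′ (ℕ.suc-injective eq)))

map-≡id : {A : Set} {f : A → A} (xs : List A) → map f xs ≡ xs → ∀ {x} → x ∈ xs → f x ≡ x
map-≡id (_ ∷ xs) eq (here refl) = ∷-injectiveˡ eq
map-≡id (_ ∷ xs) eq (there x∈)  = map-≡id xs (∷-injectiveʳ eq) x∈

module _ {m : ℕ} where

  private
    n = suc (suc m)
    E = edges (K n)

  module _ {I J : EdgeSet n} (I∈ : I ∈ matchings E) (J∈ : J ∈ matchings E) where

    private
      I⊆E = proj₁ (∈-matchings⁻ {E = E} I∈) ; perfI = proj₂ (∈-matchings⁻ {E = E} I∈)
      J⊆E = proj₁ (∈-matchings⁻ {E = E} J∈) ; perfJ = proj₂ (∈-matchings⁻ {E = E} J∈)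
      incrE = edges-Increasing (K n)
      uE = edges-Unique (K n)
      incrI = Sublist.All-resp-⊆ I⊆E incrE
      incrJ = Sublist.All-resp-⊆ J⊆E incrE
      vI = vertices I ; vJ = vertices J
      vI↭ = vertices-perfect incrI perfI
      vJ↭ = vertices-perfect incrJ perfJ
      -- Sends the ends of I to those of J in list order, hence I to J edge by edge. The default
      -- `zero` is never reached, as the ends of I exhaust the vertices.
      π = assign Fin._≟_ Fin.zero vI vJ
      π⁻ = assign Fin._≟_ Fin.zero vJ vI
      sameLength : length vI ≡ length vJ
      sameLength = trans (↭-length vI↭) (sym (↭-length vJ↭))
      πI : map π vI ≡ vJ
      πI = map-assign Fin._≟_ Fin.zero vI vJ (Unique-↭ (↭-sym vI↭) (Unique.allFin⁺ n)) sameLength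
      ρJ : map π⁻ vJ ≡ vI
      ρJ = map-assign Fin._≟_ Fin.zero vJ vI (Unique-↭ (↭-sym vJ↭) (Unique.allFin⁺ n)) (sym sameLength)
      ρπ : Undoes π⁻ π
      ρπ = mk λ x → map-≡id {f = π⁻ ∘ π} vI (trans (map-∘ vI) (trans (cong (map π⁻) πI) ρJ))
          (∈-resp-↭ (↭-sym vI↭) (∈-allFin x))
      πρ : Undoes π π⁻
      πρ = mk λ x → map-≡id {f = π ∘ π⁻} vJ (trans (map-∘ vJ) (trans (cong (map π) ρJ) πI))
          (∈-resp-↭ (↭-sym vJ↭) (∈-allFin x))

    open Relabelling π π⁻ ρπ πρ

    private
      actI : ∀ I J → All Increasing J → map π (vertices I) ≡ vertices J → map (act π) I ≡ J
      actI []            []            _            _  = refl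
      actI ((a , b) ∷ I) ((c , d) ∷ J) (c<d ∷ incr) eq = cong₂ _∷_
        (trans (cong₂ sort (∷-injectiveˡ eq) (∷-injectiveˡ (∷-injectiveʳ eq))) (sort-< c<d))
        (actI I J incr (∷-injectiveʳ (∷-injectiveʳ eq)))

      splitI = Interleaving-∖ uE I⊆E
      splitJ = Interleaving-∖ uE J⊆E

      ∈E : ∀ {e : Edge n} → Increasing e → e ∈ E
      ∈E {a , b} a<b = edges-∈⁺ (K n) a<b (Fin.<⇒≢ a<b)

      act-E : map (act π) E ↭ E
      act-E = Unique⇒↭ _≟ₑ_
        (Unique-map E uE (λ e∈ f∈ e≢f eq → e≢f (trans (sym (act-inverse ρπ (All.lookup incrE e∈)))
            (trans (cong (act π⁻) eq) (act-inverse ρπ (All.lookup incrE f∈))))))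
        uE
        (λ e∈ → ∈E (All.lookup (act-All ρπ incrE) e∈))
        (λ {e} e∈ → subst (_∈ map (act π) E) (act-inverse πρ (All.lookup incrE e∈))
            (∈-map⁺ (act π) (∈E (act-Increasing πρ (All.lookup incrE e∈)))))

      act-rest : map (act π) (E ∖ I) ↭ E ∖ J
      act-rest = ↭-cancelˡ J (↭-trans
        (Perm.↭-reflexive (sym (trans (map-++ (act π) I (E ∖ I)) (cong (_++ map (act π) (E ∖ I)) (actI I J incrJ πI)))))
        (↭-trans (map⁺ (act π) (↭-sym (toPermutation splitI))) (↭-trans act-E (toPermutation splitJ))))

      incr-rest : All Increasing (E ∖ I)
      incr-rest = Sublist.All-resp-⊆ (Interleaving⇒⊆ (Interleaving.swap splitI)) incrE

      ∏-E : ∏ gₑ I * ∏ gₑ (E ∖ I) ≡ G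
      ∏-E = trans (sym (∏-split gₑ splitI)) (cong (∏ gₑ) edges-K)
        where open Colouring {n} using (∏-split)

      -- The signs picked up by I and by m one-factors of the rest multiply
      -- to G to the number of vertices.
      ordered-invariant : G ℤ.^ n ≡ 1ℤ → ε J * ordered m signed (E ∖ J) ≡ ε I * ordered m signed (E ∖ I)
      ordered-invariant Gⁿ = begin
        ε J * ordered m signed (E ∖ J)
          ≡⟨ cong₂ _*_ (trans (cong ε (sym (actI I J incrJ πI))) (ε-act incrI perfI))
                         (trans (ordered-↭ m signed signed-↭ (↭-sym act-rest)) (ordered-act m incr-rest)) ⟩
        ((G * ∏ gₑ I) * ε I) * ((G ℤ.^ m * ∏ gₑ (E ∖ I)) * o)
          ≡⟨ *-interchange (G * ∏ gₑ I) (ε I) (G ℤ.^ m * ∏ gₑ (E ∖ I)) o ⟩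
        ((G * ∏ gₑ I) * (G ℤ.^ m * ∏ gₑ (E ∖ I))) * (ε I * o)
          ≡⟨ cong (_* (ε I * o)) (trans (*-interchange G (∏ gₑ I) (G ℤ.^ m) (∏ gₑ (E ∖ I)))
               (trans (cong (G ℤ.^ suc m *_) ∏-E) (trans (ℤ.*-comm (G ℤ.^ suc m) G) Gⁿ))) ⟩
        1ℤ * (ε I * o)  ≡⟨ ℤ.*-identityˡ (ε I * o) ⟩
        ε I * o  ∎
        where
        o = ordered m signed (E ∖ I)

    ordered-matching : (∃ λ h → n ≡ h ℕ.+ h) → ε J * ordered m signed (E ∖ J) ≡ ε I * ordered m signed (E ∖ I)
    ordered-matching (h , n≡) = ordered-invariant (trans (cong (G ℤ.^_) n≡) (even h))
      where
      even : ∀ h → G ℤ.^ (h ℕ.+ h) ≡ 1ℤ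
      even zero    = refl
      even (suc h) rewrite ℕ.+-suc h h = trans (sym (ℤ.*-assoc G G (G ℤ.^ (h ℕ.+ h)))) (cong₂ _*_ G-²≡1 (even h))

-- Degrees in complete graphs

module _ {n : ℕ} where

  pairs-⊆ : ∀ {V : List (Fin n)} {M v} → M ⊆ pairs V → v ∉ V → ∀ {e} → e ∈ M → ¬ v incident e
  pairs-⊆ {V} s v∉ {a , b} e∈ (inj₁ refl) = v∉ (proj₁ (pairs-∈⁻ V (⊆-∈ s e∈)))
  pairs-⊆ {V} s v∉ {a , b} e∈ (inj₂ refl) = v∉ (proj₂ (pairs-∈⁻ V (⊆-∈ s e∈)))

  degree-outside : ∀ {V : List (Fin n)} {M v} → M ⊆ pairs V → v ∉ V → degree M v ≡ 0
  degree-outside {v = v} s v∉ = cong length (filter-none (v incident?_) (All.tabulate (pairs-⊆ s v∉)))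

  degree-star : ∀ v (V : List (Fin n)) {M} → M ⊆ map (v ,_) V → degree M v ≡ length M
  degree-star v V s = cong length (filter-all (v incident?_) (All.tabulate at-v))
    where
    at-v : ∀ {e} → e ∈ _ → v incident e
    at-v e∈ with ∈-map⁻ (v ,_) (⊆-∈ s e∈)
    ... | w , _ , refl = inj₁ refl

  degree-star-other : ∀ {v u} (V : List (Fin n)) → u ≢ v → degree (map (v ,_) V) u ≡ count u V
  degree-star-other         []      u≢v = refl
  degree-star-other {v} {u} (w ∷ V) u≢v = trans (degree-++ ((v , w) ∷ []) (map (v ,_) V) u)
      (cong₂ ℕ._+_ (head (u Fin.≟ w)) (degree-star-other V u≢v))
    where
    head : Dec (u ≡ w) → degree ((v , w) ∷ []) u ≡ (if does (u Fin.≟ w) then 1 else 0)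
    head (yes u≡w) = trans (cong length (filter-accept (u incident?_) {xs = []} (inj₂ u≡w)))
        (cong (if_then 1 else 0) (sym (dec-true (u Fin.≟ w) u≡w)))
    head (no  u≢w) = trans (cong length (filter-reject
        (u incident?_) {xs = []} λ { (inj₁ u≡v) → u≢v u≡v ; (inj₂ u≡w) → u≢w u≡w }))
                           (cong (if_then 1 else 0) (sym (dec-false (u Fin.≟ w) u≢w)))

  degree-pairs : ∀ {V : List (Fin n)} {v} → Unique V → v ∈ V → suc (degree (pairs V) v) ≡ length V
  degree-pairs {_ ∷ V} {v} u (here refl) = cong suc (trans (degree-++ (map (v ,_) V) (pairs V) v)
    (trans (cong₂ ℕ._+_ (trans (degree-star v V ⊆-refl) (length-map (v ,_) V)) (degree-outside {V} ⊆-refl (∉-head u)))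
        (ℕ.+-identityʳ (length V))))
  degree-pairs {x ∷ V} {v} u@(_ ∷ u′) (there v∈) = cong suc (trans (degree-++ (map (x ,_) V) (pairs V) v)
    (trans (cong (ℕ._+ degree (pairs V) v) (trans (degree-star-other V (λ { refl → ∉-head u v∈ }))
        (count-Unique u′ v∈))) (degree-pairs u′ v∈)))

  degree-K : ∀ v → suc (degree (edges (K n)) v) ≡ n
  degree-K v = trans (cong (λ E → suc (degree E v)) edges-K)
      (trans (degree-pairs (Unique.allFin⁺ n) (∈-allFin v)) (length-allFin n))

-- Counting the perfect matchings of K n

∑-const : {A : Set} (c : ℤ) (xs : List A) → ∑ (λ _ → c) xs ≡ + length xs * c
∑-const c []       = refl
∑-const c (x ∷ xs) = trans (cong (λ z → c ℤ.+ z) (∑-const c xs)) (sym (ℤ.suc-* (+ length xs) c))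

∑Splits-++ : {A : Set} (f : List A → ℤ) (xs ys : List A) → ∑Splits (λ M _ → f M) (xs ++ ys) ≡
    ∑Splits (λ M _ → ∑Splits (λ N _ → f (M ++ N)) ys) xs
∑Splits-++ f []       ys = refl
∑Splits-++ f (x ∷ xs) ys = cong₂ ℤ._+_ (∑Splits-++ (f ∘ (x ∷_)) xs ys) (∑Splits-++ f xs ys)

∑Splits-empty : {A : Set} (f : List A → ℤ) (xs : List A) → (∀ {M} → M ⊆ xs → length M ≢ 0 → f M ≡ 0ℤ) →
    ∑Splits (λ M _ → f M) xs ≡ f []
∑Splits-empty f []       f≡0 = refl
∑Splits-empty f (x ∷ xs) f≡0 = trans (cong₂ ℤ._+_
  (trans (∑Splits-cong xs (λ i → f≡0 (refl ∷ Interleaving⇒⊆ i) (λ ()))) (∑Splits-0 xs))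
      (∑Splits-empty f xs (λ s → f≡0 (x ∷ʳ s)))) (ℤ.+-identityˡ (f []))

∑Splits-singletons : {A : Set} (f : List A → ℤ) (xs : List A) → (∀ {M} → M ⊆ xs → length M ≢ 1 → f M ≡ 0ℤ) →
               ∑Splits (λ M _ → f M) xs ≡ ∑ (λ x → f (x ∷ [])) xs
∑Splits-singletons f []       f≡0 = f≡0 [] (λ ())
∑Splits-singletons f (x ∷ xs) f≡0 = cong₂ ℤ._+_
  (∑Splits-empty (f ∘ (x ∷_)) xs (λ s ne → f≡0 (refl ∷ s) (ne ∘ ℕ.suc-injective)))
  (∑Splits-singletons f xs (λ s → f≡0 (x ∷ʳ s)))

module _ {n : ℕ} where

  -- Relative to V, because the count deletes vertices while the ambient vertex set stays `Fin n`.
  PerfectOn : List (Fin n) → EdgeSet n → Set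
  PerfectOn V M = All (λ u → degree M u ≡ 1) V

  perfectOn? : ∀ V M → Dec (PerfectOn V M)
  perfectOn? V M = all? (λ u → degree M u ℕ.≟ 1) V

  matchingCount : List (Fin n) → ℤ
  matchingCount V = ∑Splits (λ M _ → ⟦ perfectOn? V M ⟧ 1ℤ) (pairs V)

  without : Fin n → List (Fin n) → List (Fin n)
  without w = filter (λ u → ¬? (u Fin.≟ w))

  length-without : ∀ {w V} → Unique V → w ∈ V → suc (length (without w V)) ≡ length V
  length-without {w} {_ ∷ V} u (here refl) = cong suc (trans
    (cong length (filter-reject (λ u → ¬? (u Fin.≟ w)) {xs = V} (λ w≢w → w≢w refl)))
    (cong length (filter-all (λ u → ¬? (u Fin.≟ w)) (All.tabulate (λ x∈ x≡w → ∉-head u (subst (_∈ V) x≡w x∈))))))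
  length-without {w} {x ∷ V} u@(_ ∷ u′) (there w∈) = cong suc (trans
    (cong length (filter-accept (λ u → ¬? (u Fin.≟ w)) {xs = V} (λ x≡w → ∉-head u (subst (_∈ V) (sym x≡w) w∈))))
    (length-without u′ w∈))

  pairs-without : ∀ w V → filter (λ e → ¬? (w incident? e)) (pairs V) ≡ pairs (without w V)
  pairs-without w []      = refl
  pairs-without w (x ∷ V) = trans (filter-++ P? (map (x ,_) V) (pairs V)) (go (x Fin.≟ w))
    where
    P? = λ (e : Edge n) → ¬? (w incident? e)
    go : Dec (x ≡ w) → filter P? (map (x ,_) V) ++ filter P? (pairs V) ≡ pairs (without w (x ∷ V))
    go (yes refl) = trans
      (cong₂ _++_ (filter-none P? (All.tabulate touches)) (pairs-without w V))
      (cong pairs (sym (filter-reject (λ u → ¬? (u Fin.≟ w)) {xs = V} (λ w≢w → w≢w refl))))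
      where
      touches : ∀ {e} → e ∈ map (x ,_) V → ¬ ¬ (w incident e)
      touches e∈ ¬we with ∈-map⁻ (x ,_) e∈
      ... | _ , _ , refl = ¬we (inj₁ refl)
    go (no x≢w) = trans
      (cong₂ _++_ (trans (filter-map P? (x ,_) V) (cong (map (x ,_)) (filter-≐ (P? ∘ (x ,_)) (λ u → ¬? (u Fin.≟ w))
        ((λ ¬wxu u≡w → ¬wxu (inj₂ (sym u≡w))) , (λ u≢w →
            λ { (inj₁ w≡x) → x≢w (sym w≡x) ; (inj₂ w≡u) → u≢w (sym w≡u) })) V))) (pairs-without w V))
      (cong pairs (sym (filter-accept (λ u → ¬? (u Fin.≟ w)) {xs = V} x≢w)))

  module _ {v : Fin n} {V : List (Fin n)} (u : Unique (v ∷ V)) where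

    private
      v∉V = ∉-head u
      f : EdgeSet n → ℤ
      f M = ⟦ perfectOn? (v ∷ V) M ⟧ 1ℤ

      -- A perfect matching contains exactly one edge at v.
      star : ∀ {M} → M ⊆ map (v ,_) V → length M ≢ 1 → ∑Splits (λ N _ → f (M ++ N)) (pairs V) ≡ 0ℤ
      star {M} s ≢1 = trans (∑Splits-cong (pairs V)
          (λ {N} i → ⟦⟧-no (perfectOn? (v ∷ V) (M ++ N)) 1ℤ λ { (deg ∷ _) → ≢1 (begin
        length M  ≡⟨ ℕ.+-identityʳ (length M) ⟨
        length M ℕ.+ 0  ≡⟨ cong₂ ℕ._+_ (degree-star v V s) (degree-outside {V = V} (Interleaving⇒⊆ i) v∉V) ⟨
        degree M v ℕ.+ degree N v  ≡⟨ degree-++ M N v ⟨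
        degree (M ++ N) v  ≡⟨ deg ⟩
        1  ∎) })) (∑Splits-0 (pairs V))

      module _ {w : Fin n} (w∈ : w ∈ V) where

        at-most-one : ∀ N → ¬ All (λ e → ¬ w incident e) N → f ((v , w) ∷ N) ≡ 0ℤ
        at-most-one N touched = ⟦⟧-no (perfectOn? (v ∷ V) ((v , w) ∷ N)) 1ℤ λ { (_ ∷ degs) →
          touched (All.tabulate (λ {e} e∈ we → ℕ.<⇒≢ (∈-length (∈-filter⁺ (w incident?_) e∈ we))
            (sym (ℕ.suc-injective (trans (sym (cong length
                (filter-accept (w incident?_) {x = v , w} {xs = N} (inj₂ refl)))) (All.lookup degs w∈)))))) }

        remove : ∀ {N} → N ⊆ pairs (without w V) → f ((v , w) ∷ N) ≡ ⟦ perfectOn? (without w V) N ⟧ 1ℤ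
        remove {N} s = ⟦⟧-⇔ (perfectOn? (v ∷ V) ((v , w) ∷ N)) (perfectOn? (without w V) N)
          (λ { (_ ∷ degs) → All.tabulate (λ x∈ → let x∈V , x≢w = in-V x∈ in trans (sym (other x∈V x≢w)) (All.lookup degs x∈V)) })
          (λ degs → trans (at {v} (inj₁ refl)) (cong suc (degree-outside {V = without w V} s (v∉V ∘ proj₁ ∘ in-V)))
                    ∷ All.tabulate (λ {x} x∈ → back degs x∈ (x Fin.≟ w)))
          (λ _ → refl)
          where
          in-V : ∀ {x} → x ∈ without w V → x ∈ V × x ≢ w
          in-V = ∈-filter⁻ (λ u → ¬? (u Fin.≟ w)) {xs = V}
          at : ∀ {x} → x incident (v , w) → degree ((v , w) ∷ N) x ≡ suc (degree N x)
          at {x} xe = cong length (filter-accept (x incident?_) {xs = N} xe)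
          other : ∀ {x} → x ∈ V → x ≢ w → degree ((v , w) ∷ N) x ≡ degree N x
          other {x} x∈ x≢w = cong length (filter-reject (x incident?_) {xs = N}
            λ { (inj₁ x≡v) → v∉V (subst (_∈ V) x≡v x∈) ; (inj₂ x≡w) → x≢w x≡w })
          back : PerfectOn (without w V) N → ∀ {x} → x ∈ V → Dec (x ≡ w) → degree ((v , w) ∷ N) x ≡ 1
          back degs x∈ (yes refl) = trans (at {w} (inj₂ refl))
              (cong suc (degree-outside {V = without w V} s (λ w∈′ → proj₂ (in-V w∈′) refl)))
          back degs x∈ (no  x≢w)  = trans (other x∈ x≢w) (All.lookup degs (∈-filter⁺ (λ u → ¬? (u Fin.≟ w)) x∈ x≢w))

        -- Once v is matched with w, no other edge may touch w, and the rest is a perfect matching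
        -- of the vertices that remain.
        partner : ∑Splits (λ N _ → f ((v , w) ∷ N)) (pairs V) ≡ matchingCount (without w V)
        partner = begin
          ∑Splits (λ N _ → f ((v , w) ∷ N)) (pairs V)  ≡⟨ ∑Splits-filter (λ e → ¬? (w incident? e))
              (λ N → f ((v , w) ∷ N)) (pairs V) at-most-one ⟩
          ∑Splits (λ N _ → f ((v , w) ∷ N)) (filter (λ e → ¬? (w incident? e)) (pairs V))  ≡⟨
              cong (∑Splits (λ N _ → f ((v , w) ∷ N))) (pairs-without w V) ⟩
          ∑Splits (λ N _ → f ((v , w) ∷ N)) (pairs (without w V))  ≡⟨ ∑Splits-cong (pairs (without w V))
              (λ i → remove (Interleaving⇒⊆ i)) ⟩
          matchingCount (without w V)  ∎

    matchingCount-∷ : matchingCount (v ∷ V) ≡ ∑ (λ w → matchingCount (without w V)) V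
    matchingCount-∷ = begin
      matchingCount (v ∷ V)  ≡⟨ ∑Splits-++ f (map (v ,_) V) (pairs V) ⟩
      ∑Splits (λ M _ → ∑Splits (λ N _ → f (M ++ N)) (pairs V)) (map (v ,_) V)  ≡⟨ ∑Splits-singletons _
          (map (v ,_) V) star ⟩
      ∑ (λ e → ∑Splits (λ N _ → f (e ∷ N)) (pairs V)) (map (v ,_) V)  ≡⟨ ∑-map _ (v ,_) V ⟩
      ∑ (λ w → ∑Splits (λ N _ → f ((v , w) ∷ N)) (pairs V)) V  ≡⟨ ∑-cong∈ V partner ⟩
      ∑ (λ w → matchingCount (without w V)) V  ∎

  -- The first of 2h + 2 vertices has 2h + 1 possible partners, and deleting both leaves 2h
  -- vertices. For h = 0 the truncated `0 ∸ 1` and `0 ‼ = 1` account for the empty matching.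
  matchingCount-‼ : ∀ h {V} → Unique V → length V ≡ h ℕ.+ h → matchingCount V ≡ + ((h ℕ.+ h ∸ 1) ‼)
  matchingCount-‼ zero    {[]}    _  _  = refl
  matchingCount-‼ (suc h) {v ∷ V} u@(_ ∷ u′) eq = begin
    matchingCount (v ∷ V)  ≡⟨ matchingCount-∷ u ⟩
    ∑ (λ w → matchingCount (without w V)) V  ≡⟨ ∑-cong∈ V
        (λ {w} w∈ → matchingCount-‼ h (Unique.filter⁺ (λ u → ¬? (u Fin.≟ w)) u′)
                                                             (ℕ.suc-injective (trans (length-without u′ w∈) lengthV))) ⟩
    ∑ (λ _ → + ((h ℕ.+ h ∸ 1) ‼)) V  ≡⟨ ∑-const _ V ⟩
    + length V * + ((h ℕ.+ h ∸ 1) ‼)  ≡⟨ ℤ.pos-* (length V) ((h ℕ.+ h ∸ 1) ‼) ⟨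
    + (length V ℕ.* (h ℕ.+ h ∸ 1) ‼)  ≡⟨ cong (λ l → + (l ℕ.* (h ℕ.+ h ∸ 1) ‼)) lengthV ⟩
    + (suc (h ℕ.+ h) ℕ.* (h ℕ.+ h ∸ 1) ‼)  ≡⟨ cong +_ (‼-suc (h ℕ.+ h)) ⟨
    + ((suc (h ℕ.+ h)) ‼)  ≡⟨ cong (λ l → + (l ‼)) (ℕ.+-suc h h) ⟨
    + ((h ℕ.+ suc h) ‼)  ∎
    where
    lengthV : length V ≡ suc (h ℕ.+ h)
    lengthV = trans (ℕ.suc-injective eq) (ℕ.+-suc h h)
    ‼-suc : ∀ l → (suc l) ‼ ≡ suc l ℕ.* (l ∸ 1) ‼
    ‼-suc zero    = refl
    ‼-suc (suc l) = refl

  ∑-perfectMatchings : ∀ h → n ≡ h ℕ.+ h → ∑ (λ _ → 1ℤ) (matchings (edges (K n))) ≡ + ((n ∸ 1) ‼)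
  ∑-perfectMatchings h n≡ = begin
    ∑ (λ _ → 1ℤ) (matchings (edges (K n)))  ≡⟨ ∑-filter perfect? (λ _ → 1ℤ) (sublists (edges (K n))) ⟩
    ∑ (λ M → ⟦ perfect? M ⟧ 1ℤ) (sublists (edges (K n)))  ≡⟨ ∑-sublists (λ M → ⟦ perfect? {n} M ⟧ 1ℤ) (edges (K n)) ⟩
    ∑Splits (λ M _ → ⟦ perfect? M ⟧ 1ℤ) (edges (K n))  ≡⟨ cong (∑Splits (λ M _ → ⟦ perfect? {n} M ⟧ 1ℤ)) edges-K ⟩
    ∑Splits (λ M _ → ⟦ perfect? M ⟧ 1ℤ) (pairs (allFin n))  ≡⟨ ∑Splits-cong (pairs (allFin n))
        (λ {M} _ → ⟦⟧-⇔ (perfect? M) (perfectOn? (allFin n) M)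
                                                                       (λ perf → All.tabulate (λ {v} _ → perf v))
                                                                           (λ perf v → All.lookup perf (∈-allFin v))
                                                                           (λ _ → refl)) ⟩
    matchingCount (allFin n)  ≡⟨ matchingCount-‼ h (Unique.allFin⁺ n) (trans (length-allFin n) n≡) ⟩
    + ((h ℕ.+ h ∸ 1) ‼)  ≡⟨ cong (λ l → + ((l ∸ 1) ‼)) n≡ ⟨
    + ((n ∸ 1) ‼)  ∎

-- The identities, divisibility and the coloring indices

signedSum-edges : ∀ {n} (G : Graph n) {M} → M ∈ perfectMatchings G → S (G ─ M) ≡ signedSum (edges G ∖ M)
signedSum-edges G M∈ = cong signedSum (edges-─ G (proj₁ (∈-matchings⁻ {E = edges G} M∈)))

∑-ε*S : ∀ n .{{_ : NonZero n}} (G : Graph n) k → Regular k G → ∑ (λ M → ε M * S (G ─ M)) (perfectMatchings G) ≡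
    + k * S G
∑-ε*S (suc n) G k reg = trans (∑-cong∈ (perfectMatchings G) (λ {M} M∈ → cong (ε M *_) (signedSum-edges G M∈)))
                              (signedSum-recursion (edges-Unique G) reg)

module _ {m : ℕ} (even : ∃ λ h → suc (suc m) ≡ h ℕ.+ h) where

  private
    n = suc (suc m)
    E = edges (K n)

  regular-K : Regular (suc m) (K n)
  regular-K v = ℕ.suc-injective (degree-K v)

  regular-K─ : ∀ {I} → I ∈ matchings E → ∀ v → degree (E ∖ I) v ≡ m
  regular-K─ {I} I∈ v = ℕ.suc-injective (trans
    (sym (trans (degree-Interleaving (Interleaving-∖ (edges-Unique (K n)) (proj₁ I∈′)) v)
        (cong (ℕ._+ degree (E ∖ I) v) (proj₂ I∈′ v))))
    (regular-K v))
    where I∈′ = ∈-matchings⁻ {E = E} I∈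

  -- Relabelling acts on `ordered`, which exceeds `signedSum` by the factor m! on both sides; it is
  -- cancelled.
  ε*signedSum-invariant : ∀ {I J} → I ∈ matchings E → J ∈ matchings E → ε J * signedSum (E ∖ J) ≡
      ε I * signedSum (E ∖ I)
  ε*signedSum-invariant {I} {J} I∈ J∈ = ℤ.*-cancelˡ-≡ (factorial m) _ _ {{ℤ.≢-nonZero (factorial≢0 m)}}
    (trans (*-leftComm (factorial m) (ε J) (signedSum (E ∖ J))) (trans (cong (ε J *_) (sym (ordered≡ J∈)))
      (trans (ordered-matching I∈ J∈ even) (trans (cong (ε I *_) (ordered≡ I∈))
          (*-leftComm (ε I) (factorial m) (signedSum (E ∖ I)))))))
    where
    ordered≡ : ∀ {I} → I ∈ matchings E → ordered m signed (E ∖ I) ≡ factorial m * signedSum (E ∖ I)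
    ordered≡ {I} I∈ = ordered≡signedSum m (Unique.filter⁺ (λ e → ¬? (e ∈? I)) (edges-Unique (K n))) (regular-K─ I∈)

  ‼*signedSum : ∀ {I} → I ∈ matchings E → + (suc m ‼) * (ε I * signedSum (E ∖ I)) ≡ + suc m * S (K n)
  ‼*signedSum {I} I∈ = begin
    + (suc m ‼) * c  ≡⟨ cong (_* c) (∑-perfectMatchings (proj₁ even) (proj₂ even)) ⟨
    ∑ (λ _ → 1ℤ) (matchings E) * c  ≡⟨ trans (ℤ.*-comm _ c) (sym (∑-*ˡ c (λ _ → 1ℤ) (matchings E))) ⟩
    ∑ (λ _ → c * 1ℤ) (matchings E)  ≡⟨ ∑-cong∈ (matchings E)
        (λ J∈ → trans (ℤ.*-identityʳ c) (sym (ε*signedSum-invariant I∈ J∈))) ⟩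
    ∑ (λ J → ε J * signedSum (E ∖ J)) (matchings E) ≡⟨ signedSum-recursion (edges-Unique (K n)) regular-K ⟩
    + suc m * S (K n)  ∎
    where c = ε I * signedSum (E ∖ I)

‼*S : ∀ {n m} → n ≡ suc (suc m) → (∃ λ h → n ≡ h ℕ.+ h) → ∀ {I} → I ∈ perfectMatchings (K n) →
      + (suc m ‼) * (ε I * S (K n ─ I)) ≡ + suc m * S (K n)
‼*S {n} {m} refl even {I} I∈ =
  trans (cong (λ z → + (suc m ‼) * (ε I * z)) (signedSum-edges (K n) I∈)) (‼*signedSum even I∈)

K─-regular : ∀ {n m} → n ≡ suc (suc m) → (∃ λ h → n ≡ h ℕ.+ h) → ∀ {I} → I ∈ perfectMatchings (K n) →
    Regular m (K n ─ I)
K─-regular {n} refl even {I} I∈ v =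
  trans (cong (λ E → degree E v) (edges-─ (K n) (proj₁ (∈-matchings⁻ {E = edges (K n)} I∈)))) (regular-K─ even I∈ v)

module _ {n p : ℕ} (n≡ : n ≡ suc (suc (suc (suc p)))) (even : ∃ λ h → n ≡ h ℕ.+ h) where

  -- Here n - 1 is `suc (suc (suc p))`, the leading factor of (n - 1)!!, and cancelling it from
  -- `‼*S` leaves (n - 3)!!.
  S-K : ∀ {I} → I ∈ perfectMatchings (K n) → + (suc p ‼) * (ε I * S (K n ─ I)) ≡ S (K n)
  S-K {I} I∈ = ℤ.*-cancelˡ-≡ (+ suc (suc (suc p))) (+ (suc p ‼) * c) (S (K n)) (begin
    + suc (suc (suc p)) * (+ (suc p ‼) * c)  ≡⟨ ℤ.*-assoc (+ suc (suc (suc p))) (+ (suc p ‼)) c ⟨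
    (+ suc (suc (suc p)) * + (suc p ‼)) * c  ≡⟨ cong (_* c) (ℤ.pos-* (suc (suc (suc p))) (suc p ‼)) ⟨
    + (suc (suc (suc p)) ‼) * c  ≡⟨ ‼*S n≡ even I∈ ⟩
    + suc (suc (suc p)) * S (K n)  ∎)
    where c = ε I * S (K n ─ I)

  S-K─ : ∀ {I} → I ∈ perfectMatchings (K n) → S (K n ─ I) * + (suc p ‼) ≡ ε I * S (K n)
  S-K─ {I} I∈ = sym (begin
    ε I * S (K n)  ≡⟨ cong (ε I *_) (S-K I∈) ⟨
    ε I * (d * (ε I * s))  ≡⟨ cong (ε I *_) (*-leftComm d (ε I) s) ⟩
    ε I * (ε I * (d * s))  ≡⟨ ℤ.*-assoc (ε I) (ε I) (d * s) ⟨
    (ε I * ε I) * (d * s)  ≡⟨ cong (_* (d * s)) (ε-²≡1 I) ⟩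
    1ℤ * (d * s)  ≡⟨ trans (ℤ.*-identityˡ (d * s)) (ℤ.*-comm d s) ⟩
    s * d  ∎)
    where d = + (suc p ‼) ; s = S (K n ─ I)

  S-K─′ : ∀ {I} → I ∈ perfectMatchings (K n) → S (K n ─ I) * + (suc (suc (suc p)) ‼) ≡
      ε I * (+ suc (suc (suc p)) * S (K n))
  S-K─′ {I} I∈ = begin
    s * + (suc (suc (suc p)) ‼)  ≡⟨ cong (s *_) (ℤ.pos-* (suc (suc (suc p))) (suc p ‼)) ⟩
    s * (q * + (suc p ‼))  ≡⟨ *-leftComm s q (+ (suc p ‼)) ⟩
    q * (s * + (suc p ‼))  ≡⟨ cong (q *_) (S-K─ I∈) ⟩
    q * (ε I * S (K n))  ≡⟨ *-leftComm q (ε I) (S (K n)) ⟩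
    ε I * (q * S (K n))  ∎
    where s = S (K n ─ I) ; q = + suc (suc (suc p))

  -- Divisibility of S (K n) mentions no matching, so one has to be produced; it exists because the
  -- count (n - 1)!! is not 0.
  some-perfectMatching : ∃ λ I → I ∈ perfectMatchings (K n)
  some-perfectMatching = found (∑-nonzero (λ _ → 1ℤ) (matchings (edges (K n))) count≢0)
    where
    found : (∃ λ I → I ∈ matchings (edges (K n)) × 1ℤ ≢ 0ℤ) → ∃ λ I → I ∈ perfectMatchings (K n)
    found (I , I∈ , _) = I , I∈
    count≢0 : ∑ (λ _ → 1ℤ) (matchings (edges (K n))) ≢ 0ℤ
    count≢0 eq = ℕ.≢-nonZero⁻¹ ((n ∸ 1) ‼) {{(n ∸ 1) ‼≢0}}
      (ℤ.+-injective (trans (sym (∑-perfectMatchings (proj₁ even) (proj₂ even))) eq))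

  ‼∣S : + (suc p ‼) ∣ S (K n)
  ‼∣S = via (proj₂ some-perfectMatching)
    where
    via : ∀ {I} → I ∈ perfectMatchings (K n) → + (suc p ‼) ∣ S (K n)
    via {I} I∈ = ℕ.divides ℤ.∣ ε I * S (K n ─ I) ∣ (trans (cong ℤ.∣_∣ (sym (S-K I∈)))
      (trans (ℤ.abs-* (+ (suc p ‼)) (ε I * S (K n ─ I))) (ℕ.*-comm (suc p ‼) ℤ.∣ ε I * S (K n ─ I) ∣)))

S≢0⇒paintable : ∀ {n k} (G : Graph (suc n)) → Regular (suc k) G → S G ≢ 0ℤ → EdgePaintable G (suc k)
S≢0⇒paintable G reg S≢0 = signedSum≢0⇒paintable (edges-Unique G) (edges-Increasing G) reg S≢0

-- Paintability implies choosability, so the upper bound for the game and the lower bound from the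
-- degree each serve both indices.
S≢0⇒indices : ∀ {n k} (G : Graph (suc n)) → Regular (suc k) G → S G ≢ 0ℤ → (χ′P[ G ]≡ suc k) × (χ′ℓ[ G ]≡ suc k)
S≢0⇒indices {n} {k} G reg S≢0 =
  (paintable , λ j → lower j ∘ paintable⇒choosable G j) , (paintable⇒choosable G (suc k) paintable , lower)
  where
  paintable = S≢0⇒paintable G reg S≢0
  lower : ∀ j → EdgeChoosable G j → suc k ≤ j
  lower j choosable = subst (_≤ j) (reg Fin.zero) (choosable⇒degree≤ G j Fin.zero (edges-Unique G) choosable)

indices-K─ : ∀ {n p} → n ≡ suc (suc (suc (suc p))) → (∃ λ h → n ≡ h ℕ.+ h) → S (K n) ≢ 0ℤ → ∀ {I} →
    I ∈ perfectMatchings (K n) →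
             (χ′P[ K n ─ I ]≡ suc (suc p)) × (χ′ℓ[ K n ─ I ]≡ suc (suc p))
indices-K─ {suc n} {p} n≡ even S≢0 {I} I∈ = S≢0⇒indices (K (suc n) ─ I) (K─-regular n≡ even I∈)
  (λ eq → S≢0 (trans (sym (S-K n≡ even I∈)) (trans (cong (λ z → + (suc p ‼) * (ε I * z)) eq)
    (trans (cong (+ (suc p ‼) *_) (ℤ.*-zeroʳ (ε I))) (ℤ.*-zeroʳ (+ (suc p ‼)))))))

/-≡ : ∀ {i j d} .{{_ : NonZero d}} → i * + d ≡ j → i / 1 ≡ j / d
/-≡ {i} {j} {suc d} eq = ℚ.fromℚᵘ-cong {ℚᵘ.mkℚᵘ i 0} {ℚᵘ.mkℚᵘ j d} (ℚᵘ.*≡* (trans eq (sym (ℤ.*-identityʳ j))))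

proposition6p1 : (∀ n → .{{_ : NonZero n}} → (G : Graph n) (k : ℕ) →
    Regular k G → OneFactorable G →
    sumℤ (map (λ M → ε M * S (G ─ M)) (perfectMatchings G)) ≡ + k * S G)
    ×
    (∀ n → 4 ≤ n → 2 ℕ.∣ n →
    (∀ I → I ∈ perfectMatchings (K n) →
    (S (K n ─ I) / 1 ≡ ((ε I * (+ (n ∸ 1) * S (K n))) / ((n ∸ 1) ‼)) {{(n ∸ 1) ‼≢0}})
    ×
    (S (K n ─ I) / 1 ≡ ((ε I * S (K n)) / ((n ∸ 3) ‼)) {{(n ∸ 3) ‼≢0}}))
    ×
    (+ ((n ∸ 3) ‼) ∣ S (K n))
    ×
    (S (K n) ≢ 0ℤ → ∀ I → I ∈ perfectMatchings (K n) →
    (χ′P[ K n ─ I ]≡ (n ∸ 2)) × (χ′ℓ[ K n ─ I ]≡ (n ∸ 2))))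
proposition6p1 = (λ n G k reg _ → ∑-ε*S n G k reg) , complete
  where
  complete : ∀ n → 4 ≤ n → 2 ℕ.∣ n →
    (∀ I → I ∈ perfectMatchings (K n) →
      (S (K n ─ I) / 1 ≡ ((ε I * (+ (n ∸ 1) * S (K n))) / ((n ∸ 1) ‼)) {{(n ∸ 1) ‼≢0}})
      ×
      (S (K n ─ I) / 1 ≡ ((ε I * S (K n)) / ((n ∸ 3) ‼)) {{(n ∸ 3) ‼≢0}}))
    ×
    (+ ((n ∸ 3) ‼) ∣ S (K n))
    ×
    (S (K n) ≢ 0ℤ → ∀ I → I ∈ perfectMatchings (K n) →
      (χ′P[ K n ─ I ]≡ (n ∸ 2)) × (χ′ℓ[ K n ─ I ]≡ (n ∸ 2)))
  complete n 4≤n (ℕ.divides h n≡h*2) =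
    (λ I I∈ → /-≡ {S (K n ─ I)} {ε I * (+ (n ∸ 1) * S (K n))} {{(n ∸ 1) ‼≢0}}
                (subst (λ q → S (K n ─ I) * + (q ‼) ≡ ε I * (+ q * S (K n))) (sym (cong (_∸ 1) n≡)) (S-K─′ n≡ even I∈))
            , /-≡ {S (K n ─ I)} {ε I * S (K n)} {{(n ∸ 3) ‼≢0}}
                (subst (λ q → S (K n ─ I) * + (q ‼) ≡ ε I * S (K n)) (sym (cong (_∸ 3) n≡)) (S-K─ n≡ even I∈)))
    , subst (λ q → + (q ‼) ∣ S (K n)) (sym (cong (_∸ 3) n≡)) (‼∣S n≡ even)
    , λ S≢0 I I∈ → subst (λ q → (χ′P[ K n ─ I ]≡ q) × (χ′ℓ[ K n ─ I ]≡ q)) (sym (cong (_∸ 2) n≡))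
        (indices-K─ n≡ even S≢0 I∈)
    where
    n≡ : n ≡ suc (suc (suc (suc (n ∸ 4))))
    n≡ = sym (ℕ.m+[n∸m]≡n 4≤n)
    even : ∃ λ h → n ≡ h ℕ.+ h
    even = h , trans n≡h*2 (trans (ℕ.*-comm h 2) (cong (h ℕ.+_) (ℕ.+-identityʳ h)))
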